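{- For $n\ge 7$: (i) $n=7$: $\mathrm{ex}^{(2)}_3(7;P)=15$ and $\mathrm{Ex}^{(2)}_3(7;P)=\{S^3_7\}$; (ii) $8\le n\le 12$: $\mathrm{ex}^{(2)}_3(n;P)=20+\binom{n-6}{3}$ and $\mathrm{Ex}^{(2)}_3(n;P)=\{K^3_6\cup K^3_{n-6}\}$; (iii) $n=13$: $\mathrm{ex}^{(2)}_3(13;P)=40$ and $\mathrm{Ex}^{(2)}_3(13;P)=\{K^3_6\cup K^3_6\cup K^3_1,\ \mathrm{Co}(13)\}$; (iv) $n\ge 14$: $\mathrm{ex}^{(2)}_3(n;P)=4+\binom{n-4}{2}$ and $\mathrm{Ex}^{(2)}_3(n;P)=\{\mathrm{Co}(n)\}$. (Families are up to isomorphism.)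
   Context: All hypergraphs are 3-uniform (3-graphs); a 3-graph $H$ contains $F$ (written $F\subseteq H$) if $H$ has a sub-3-graph isomorphic to $F$; $H$ is $F$-free otherwise, and $\mathcal F$-free if it is $F$-free for all $F\in\mathcal F$. $P$ is the loose 3-uniform path of length 3: vertices $a,b,c,d,e,f,g$, edges $\{a,b,c\},\{c,d,e\},\{e,f,g\}$. $K^3_m$ is the complete 3-graph on $m$ vertices; $K^3_1$ is an isolated vertex; $F_1\cup F_2$ denotes the vertex-disjoint union. $S^3_n$ is the full star: $n$ vertices, one vertex (center) and all $\binom{n-1}{2}$ triples containing it. The comet $\mathrm{Co}(n)$ ($n\ge 4$) is the $n$-vertex 3-graph consisting of a copy of $K^3_4$ together with all triples containing a fixed vertex $c$ of that $K^3_4$ (the center); i.e. a star with center $c$ on all $n$ vertices restricted to triples meeting... precisely: vertex set $\{c,h_1,h_2,h_3\}\cup R$ with $|R|=n-4$, edges: all triples containing $c$ and two vertices of $R\cup\{c\}$-complement within $R$ (i.e. $\{c,u,v\}$, $u,v\in R$), together with the four triples of $\{c,h_1,h_2,h_3\}$; it has $4+\binom{n-4}{2}$ edges. Turán numbers of higher order: $\mathrm{ex}^{(1)}_3(n;\mathcal F)=\mathrm{ex}_3(n;\mathcal F)$ is the maximum number of edges of an $n$-vertex $\mathcal F$-free 3-graph, and $\mathrm{Ex}^{(1)}_3(n;\mathcal F)$ is the family of $n$-vertex $\mathcal F$-free 3-graphs attaining it. For $s\ge1$, $\mathrm{ex}^{(s+1)}_3(n;\mathcal F)$ is the maximum number of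 edges of an $n$-vertex $\mathcal F$-free 3-graph $H$ such that $H$ is not contained in (i.e. not a sub-3-graph of any copy, on the same vertex set, of) any member of $\mathrm{Ex}^{(1)}_3(n;\mathcal F)\cup\dots\cup\mathrm{Ex}^{(s)}_3(n;\mathcal F)$; $\mathrm{Ex}^{(s+1)}_3(n;\mathcal F)$ is the family of such $H$ attaining this maximum. (For reference, $\mathrm{Ex}^{(1)}_3(7;P)=\{K^3_6\cup K^3_1\}$ and $\mathrm{Ex}^{(1)}_3(n;P)=\{S^3_n\}$ for $n\ge 8$.) -}

module Defs where

open import Data.Bool.Base using (Bool; if_then_else_; T; _∧_)
import Data.Bool.Properties as Bool
open import Data.Fin.Base using (Fin; zero; suc)
open import Data.Fin using (#_)
open import Data.Fin.Permutation using (Permutation; _⟨$⟩ʳ_)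
open import Data.Fin.Subset using (Subset; inside; outside; ⊥; ⊤; ⁅_⁆; _∪_; ∣_∣)
open import Data.Fin.Subset.Properties using (_∈?_; _⊆?_; nonempty?)
open import Data.List.Base using (List; []; _∷_)
import Data.List.Membership.DecPropositional as DecMembership
open import Data.Nat.Base using (ℕ; zero; suc; _+_; _∸_; _≤_; _≡ᵇ_; NonZero)
open import Data.Nat.Properties using (≡ᵇ⇒≡)
open import Data.Product.Base using (∃; ∃-syntax; _×_; _,_; proj₁)
open import Data.Vec.Base using ([]; _∷_; _++_; take; drop)
import Data.Vec.Properties as Vec
open import Function.Bundles using (Equivalence)
open import Function.Definitions using (Injective)
open import Level using (0ℓ)
open import Relation.Binary.PropositionalEquality using (_≡_)
open import Relation.Nullary using (¬_; does)
open import Relation.Nullary.Decidable using (T?; ¬?; _×-dec_; _⊎-dec_)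
open import Relation.Unary using (Pred; Decidable)
open import Relation.Unary.Properties using (U?)

private
  variable
    m n : ℕ

record ThreeGraph (n : ℕ) : Set where
  field
    edge    : Subset n → Bool
    uniform : ∀ e → T (edge e) → ∣ e ∣ ≡ 3

open ThreeGraph public

Edge : ThreeGraph n → Pred (Subset n) 0ℓ
Edge H e = T (edge H e)

countSubsets : ∀ n → (Subset n → Bool) → ℕ
countSubsets zero    f = if f [] then 1 else 0
countSubsets (suc n) f =
  countSubsets n (λ p → f (inside ∷ p)) + countSubsets n (λ p → f (outside ∷ p))

size : ThreeGraph n → ℕ
size {n} H = countSubsets n (edge H)

image : (Fin m → Fin n) → Subset m → Subset n
image f []            = ⊥
image f (inside  ∷ p) = ⁅ f zero ⁆ ∪ image (λ i → f (suc i)) p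
image f (outside ∷ p) = image (λ i → f (suc i)) p

infix 4 _⊑_ _≅_

-- F ⊑ H : H has a (not necessarily induced) sub-3-graph isomorphic to F.
_⊑_ : ThreeGraph m → ThreeGraph n → Set
_⊑_ {m} {n} F H =
  ∃ λ (f : Fin m → Fin n) →
    Injective _≡_ _≡_ f × (∀ e → Edge F e → Edge H (image f e))

_≅_ : ThreeGraph m → ThreeGraph n → Set
_≅_ {m} {n} G H =
  ∃ λ (π : Permutation m n) → ∀ e → edge G e ≡ edge H (image (π ⟨$⟩ʳ_) e)

-- The 3-graph whose edges are the 3-element vertex sets satisfying Q.
triples : {Q : Pred (Subset n) 0ℓ} → Decidable Q → ThreeGraph n
triples Q? = record
  { edge    = λ e → (∣ e ∣ ≡ᵇ 3) ∧ does (Q? e)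
  ; uniform = λ e t → ≡ᵇ⇒≡ ∣ e ∣ 3 (proj₁ (Equivalence.to Bool.T-∧ t))
  }

P : ThreeGraph 7
P = triples (_∈ₗ? path)
  where
  open DecMembership (Vec.≡-dec Bool._≟_) using () renaming (_∈?_ to _∈ₗ?_)
  path : List (Subset 7)
  path = (⁅ # 0 ⁆ ∪ ⁅ # 1 ⁆ ∪ ⁅ # 2 ⁆)
       ∷ (⁅ # 2 ⁆ ∪ ⁅ # 3 ⁆ ∪ ⁅ # 4 ⁆)
       ∷ (⁅ # 4 ⁆ ∪ ⁅ # 5 ⁆ ∪ ⁅ # 6 ⁆)
       ∷ []

K : ∀ m → ThreeGraph m
K m = triples U?

-- The full star, with centre zero.
S : ∀ n → .{{NonZero n}} → ThreeGraph n
S (suc n) = triples (zero ∈?_)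

-- The comet Co(n), for n ≥ 4 (so that 4 + (n ∸ 4) is n): the centre c is
-- vertex zero, h₁, h₂, h₃ are the next three vertices, and R is the rest.
Co : ∀ n → ThreeGraph (4 + (n ∸ 4))
Co n = triples (λ e → (e ⊆? head) ⊎-dec ((zero ∈? e) ×-dec (e ⊆? ⁅ zero ⁆ ∪ R)))
  where
  head R : Subset (4 + (n ∸ 4))
  head = ⊤ {4} ++ ⊥
  R    = ⊥ {4} ++ ⊤

infixr 5 _⊔_

-- Vertex-disjoint union: G lives on the first m vertices, H on the last n.
_⊔_ : ThreeGraph m → ThreeGraph n → ThreeGraph (m + n)
_⊔_ {m} G H = triples (λ e →
    (T? (edge G (take m e)) ×-dec ¬? (nonempty? (drop m e)))
  ⊎-dec
    (¬? (nonempty? (take m e)) ×-dec T? (edge H (drop m e))))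

Family : Set₁
Family = Pred (∃ ThreeGraph) 0ℓ

Free : Family → Pred (ThreeGraph n) 0ℓ
Free 𝓕 H = ∀ {m} (F : ThreeGraph m) → 𝓕 (m , F) → ¬ (F ⊑ H)

IsMaxSize : Pred (ThreeGraph n) 0ℓ → ℕ → Set
IsMaxSize Q k = (∃[ H ] Q H × size H ≡ k) × (∀ H → Q H → size H ≤ k)

Maximizer : Pred (ThreeGraph n) 0ℓ → Pred (ThreeGraph n) 0ℓ
Maximizer Q H = Q H × IsMaxSize Q (size H)

-- The 3-graphs over which ex⁽ˢ⁺¹⁾ is the maximum: those that are 𝓕-free and
-- contained in no member of Ex⁽¹⁾, …, Ex⁽ˢ⁾.
Admissible : Family → ℕ → Pred (ThreeGraph n) 0ℓ
Admissible 𝓕 zero    H = Free 𝓕 H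
Admissible {n} 𝓕 (suc s) H =
  Admissible 𝓕 s H × (∀ (G : ThreeGraph n) → Maximizer (Admissible 𝓕 s) G → ¬ (H ⊑ G))

-- IsEx s n 𝓕 k : ex⁽ˢ⁾(n; 𝓕) exists and equals k.
IsEx : (s : ℕ) .{{_ : NonZero s}} (n : ℕ) → Family → ℕ → Set
IsEx (suc s) n 𝓕 k = IsMaxSize {n} (Admissible 𝓕 s) k

Ex : (s : ℕ) .{{_ : NonZero s}} (n : ℕ) → Family → Pred (ThreeGraph n) 0ℓ
Ex (suc s) n 𝓕 = Maximizer (Admissible 𝓕 s)

{-# OPTIONS --safe #-}

-- Idea.  Edges are counted along a list of vertices, and bounds are obtained by induction, deleting a few vertices
-- that lie in few edges.
--
-- Let H be path-free.  If H has a loose triangle on a set U of six vertices, then no edge meets U in exactly one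
-- vertex, and a vertex outside U that forms an edge with two vertices of U lies in no edge with two other outside
-- vertices.  So either U splits off (giving K 6 ⊔ K (n ∸ 6) and, for n = 13, K 6 ⊔ K 6 ⊔ K 1), or there are a ≥ 1 such
-- vertices, and deleting them together with U costs at most 11 + 3a edges.
--
-- If H has no loose triangle, take edges abc and cde meeting only in c.  If there is also an edge abd (a chord), then
-- {a, b, c, d, e} meets few edges.  If there is an edge abx with x outside (a page), then all but at most three of the edges
-- meeting {a, b} contain both a and b, so deleting a and b is cheap, and the remainder is a star at c only if H is
-- contained in a comet or small.  Otherwise every edge meeting the link of c contains c, that is, a star splits off.

module Submission where

open import Defs
open import Data.Bool.Base using (Bool; true; false; T; if_then_else_)
open import Data.Bool.Properties using (T-∧) renaming (_≟_ to Bool-≟)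
open import Data.Empty using (⊥; ⊥-elim)
open import Data.Fin using (#_)
open import Data.Fin.Base as Fin using (Fin; toℕ)
open import Data.Fin.Patterns
open import Data.Fin.Permutation using (_⟨$⟩ʳ_; _⟨$⟩ˡ_; inverseˡ; inverseʳ; permutation) renaming (id to idₚ; flip to flipₚ)
open import Data.Fin.Properties using (_≟_; any?; all?; toℕ-fromℕ<; ↑ˡ-injective) renaming (suc-injective to Fin-suc-injective)
open import Data.Fin.Subset as Subset using (Subset; ⁅_⁆; _∪_; ∣_∣) renaming (⊥ to ∅)
open import Data.Fin.Subset.Properties
  using (∪-identityˡ; ∪-identityʳ; ∪-assoc; ∪-comm; ∪-idem; x∈⁅y⁆⇒x≡y; x∈⁅x⁆; ∣⁅x⁆∣≡1; x∈p∪q⁻; x∈p∪q⁺; ∉⊥; ∈⊤; _⊆?_; nonempty?)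
  renaming (_∈?_ to _∈ₛ?_)
open import Data.List.Base using (List; []; _∷_; _++_; length; map; lookup; allFin; tabulate)
open import Data.List.Membership.Propositional using (_∈_; _∉_)
open import Data.List.Membership.Propositional.Properties
  using (∈-∃++; ∈-lookup; ∈-++⁺ˡ; ∈-++⁺ʳ; ∈-++⁻; ∈-allFin; ∈-map⁺; ∈-map⁻; ∈-AllPairs₂)
open import Data.List.Properties using (length-++; length-map; length-tabulate; map-tabulate; tabulate-lookup; ++-identityʳ)
open import Data.List.Relation.Binary.Permutation.Propositional as Perm using (_↭_; ↭-sym; ↭-trans; ↭-refl; prep; swap; refl)
open import Data.List.Relation.Binary.Permutation.Propositional.Properties
  using (∈-resp-↭; All-resp-↭; ↭-length; shift; ++⁺ʳ; ++⁺ˡ; ++-comm)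
open import Data.List.Relation.Unary.All as All using (All; []; _∷_)
open import Data.List.Relation.Unary.AllPairs using (AllPairs; []; _∷_)
open import Data.List.Relation.Unary.Any as Any using (here; there)
open import Data.List.Relation.Unary.Any.Properties using (lookup-index)
open import Data.List.Relation.Unary.Unique.DecPropositional using (unique?)
open import Data.List.Relation.Unary.Unique.Propositional using (Unique)
open import Data.List.Relation.Unary.Unique.Propositional.Properties as Uniq using (Unique[x∷xs]⇒x∉xs)
open import Data.Nat.Base using (ℕ; zero; suc; _+_; _*_; _∸_; _≤_; _<_; _≤ᵇ_; _<ᵇ_; z≤n; s≤s) renaming (_⊔_ to _⊔ⁿ_)
open import Data.Nat.Combinatorics using (_C_; nC1≡n; nCk+nC[k+1]≡[n+1]C[k+1])
open import Data.Nat.Induction using (<-rec)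
open import Data.Nat.Properties hiding (_≟_)
open import Data.Nat.Tactic.RingSolver using (solve-∀)
open import Data.Product.Base using (∃; ∃-syntax; _×_; _,_; proj₁; proj₂)
open import Data.Sum.Base using (_⊎_; inj₁; inj₂)
open import Data.Unit.Base using (tt)
open import Data.Vec.Base as Vec using (Vec; []; _∷_)
open import Data.Vec.Properties using () renaming (≡-dec to Vec-≡-dec)
open import Function.Base using (_∘_; id; case_of_)
open import Function.Bundles using (Equivalence; _⇔_; mk⇔)
open import Function.Definitions using (Injective)
open import Relation.Binary.PropositionalEquality
  using (_≡_; _≢_; refl; sym; trans; cong; cong₂; subst; subst₂; module ≡-Reasoning)
open import Relation.Nullary using (¬_; Dec; yes; no; does)
open import Relation.Nullary.Decidable using (True; toWitness; _×-dec_; _⊎-dec_; ¬?; T?; decidable-stable)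
open import Relation.Unary using (｛_｝)
open import Relation.Unary.Properties using (U?)

-- The induction must carry shapes, not only bounds. In the page case the deletion of `a` and `b`
-- can cost n - 3 edges while the other n - 2 vertices carry a star with C(n - 3, 2) edges. The sum
-- exceeds C(n - 4, 2) + 3, so it matters where the centre of that star lies. If no two edges meet
-- in exactly one vertex, a separate recursion over disjoint edges gives the bound.
--
-- From 7 on, `capᴾ₂ n` is the claimed second-order number minus one, so only stars, subgraphs of
-- comets and split 3-graphs can compete. These shapes are mere containments; uniqueness follows
-- because a subgraph with as many edges as its host is the host.
--
-- For n ≥ 8 the first-order extremal 3-graphs are the stars, and two disjoint edges certify that a
-- 3-graph lies in none of them. At n = 7 the roles change: a clique on six vertices has 20 edges
-- and a star only 15. There the split shape is inadmissible, and the star survives because it has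
-- no isolated vertex.

private
  variable
    A B : Set
    n : ℕ

-- Counting edges

-- 3-graphs as symmetric ternary relations on their vertices.
record Hyp (A : Set) : Set where
  field
    E      : A → A → A → Bool
    swap₁₂ : ∀ x y z → E x y z ≡ E y x z
    swap₂₃ : ∀ x y z → E x y z ≡ E x z y
    irr    : ∀ x z → E x x z ≡ false

  Ed : A → A → A → Set
  Ed x y z = T (E x y z)

open Hyp public

pullback : (A → B) → Hyp B → Hyp A
pullback φ H = record
  { E      = λ x y z → E H (φ x) (φ y) (φ z)
  ; swap₁₂ = λ x y z → swap₁₂ H (φ x) (φ y) (φ z)
  ; swap₂₃ = λ x y z → swap₂₃ H (φ x) (φ y) (φ z)
  ; irr    = λ x z → irr H (φ x) (φ z)
  }

-- The binomial coefficients C(n, 2) and C(n, 3), in the recursive form that counting along a list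
-- produces. With shifted arguments they unfold by computation, which leaves polynomial identities.
c2 : ℕ → ℕ
c2 zero    = 0
c2 (suc n) = n + c2 n

c3 : ℕ → ℕ
c3 zero    = 0
c3 (suc n) = c2 n + c3 n

bit : Bool → ℕ
bit true  = 1
bit false = 0

bit≤1 : ∀ b → bit b ≤ 1
bit≤1 true  = ≤-refl
bit≤1 false = z≤n

bit-zero : ∀ {b} → ¬ T b → bit b ≡ 0
bit-zero {true}  ¬t = ⊥-elim (¬t tt)
bit-zero {false} _  = refl

bit-one : ∀ {b} → T b → bit b ≡ 1
bit-one {true} _ = refl

bit-mono : ∀ {a b} → (T a → T b) → bit a ≤ bit b
bit-mono {false}         _ = z≤n
bit-mono {true}  {true}  _ = ≤-refl
bit-mono {true}  {false} f = ⊥-elim (f tt)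

bit-exclusive : ∀ a b → (T a → T b → ⊥) → bit a + bit b ≤ 1
bit-exclusive false b     _ = bit≤1 b
bit-exclusive true  false _ = ≤-refl
bit-exclusive true  true  f = ⊥-elim (f tt tt)

module Count {A : Set} (H : Hyp A) where

  -- Each edge is counted once, at its earliest vertex in the list. On an explicit list the counts
  -- reduce to a sum of `bit`s.
  codeg : A → A → List A → ℕ
  codeg x y []       = 0
  codeg x y (z ∷ zs) = bit (E H x y z) + codeg x y zs

  deg : A → List A → ℕ
  deg x []       = 0
  deg x (y ∷ ys) = codeg x y ys + deg x ys

  cnt : List A → ℕ
  cnt []       = 0
  cnt (x ∷ xs) = deg x xs + cnt xs

  codegs : A → List A → List A → ℕ
  codegs x []       zs = 0
  codegs x (y ∷ ys) zs = codeg x y zs + codegs x ys zs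

  -- The index tells how many vertices of the edge lie in the first list.
  cross₂ : List A → List A → ℕ
  cross₂ []       zs = 0
  cross₂ (x ∷ xs) zs = codegs x xs zs + cross₂ xs zs

  cross₁ : List A → List A → ℕ
  cross₁ []       zs = 0
  cross₁ (x ∷ xs) zs = deg x zs + cross₁ xs zs

  rot : ∀ x y z → Ed H x y z → Ed H y z x
  rot x y z = subst T (trans (swap₁₂ H x y z) (swap₂₃ H y x z))

  sw₁₂ : ∀ x y z → Ed H x y z → Ed H y x z
  sw₁₂ x y z = subst T (swap₁₂ H x y z)

  sw₂₃ : ∀ x y z → Ed H x y z → Ed H x z y
  sw₂₃ x y z = subst T (swap₂₃ H x y z)

  distinct₁₂ : ∀ {x y z} → Ed H x y z → x ≢ y
  distinct₁₂ {x} {z = z} e refl = subst T (irr H x z) e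

  distinct₂₃ : ∀ {x y z} → Ed H x y z → y ≢ z
  distinct₂₃ {x} {y} {z} e = distinct₁₂ (rot x y z e)

  distinct₁₃ : ∀ {x y z} → Ed H x y z → x ≢ z
  distinct₁₃ {x} {y} {z} e = distinct₁₂ (sw₂₃ x y z e)

  codeg-++ : ∀ x y zs ws → codeg x y (zs ++ ws) ≡ codeg x y zs + codeg x y ws
  codeg-++ x y []       ws = refl
  codeg-++ x y (z ∷ zs) ws rewrite codeg-++ x y zs ws = sym (+-assoc (bit (E H x y z)) _ _)

  deg-++ : ∀ x ys zs → deg x (ys ++ zs) ≡ deg x ys + (codegs x ys zs + deg x zs)
  deg-++ x []       zs = refl
  deg-++ x (y ∷ ys) zs rewrite codeg-++ x y ys zs | deg-++ x ys zs =
    lemma (codeg x y ys) (codeg x y zs) (deg x ys) (codegs x ys zs) (deg x zs)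
    where
    lemma : ∀ a b c d e → a + b + (c + (d + e)) ≡ a + c + (b + d + e)
    lemma = solve-∀

  cnt-++ : ∀ xs zs → cnt (xs ++ zs) ≡ cnt xs + (cross₂ xs zs + (cross₁ xs zs + cnt zs))
  cnt-++ []       zs = refl
  cnt-++ (x ∷ xs) zs rewrite deg-++ x xs zs | cnt-++ xs zs =
    lemma (deg x xs) (codegs x xs zs) (deg x zs) (cnt xs) (cross₂ xs zs) (cross₁ xs zs) (cnt zs)
    where
    lemma : ∀ a b c d e f g → a + (b + c) + (d + (e + (f + g))) ≡ a + d + (b + e + (c + f + g))
    lemma = solve-∀

  codeg-↭ : ∀ x y {zs ws} → zs ↭ ws → codeg x y zs ≡ codeg x y ws
  codeg-↭ x y refl         = refl
  codeg-↭ x y (prep z p)   = cong (bit (E H x y z) +_) (codeg-↭ x y p)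
  codeg-↭ x y (swap z w p) rewrite codeg-↭ x y p =
    x∙yz≈y∙xz (bit (E H x y z)) (bit (E H x y w)) _
    where open import Algebra.Properties.CommutativeSemigroup +-commutativeSemigroup
  codeg-↭ x y (Perm.trans p q)  rewrite codeg-↭ x y p = codeg-↭ x y q

  codeg-sym : ∀ x y zs → codeg x y zs ≡ codeg y x zs
  codeg-sym x y []       = refl
  codeg-sym x y (z ∷ zs) = cong₂ _+_ (cong bit (swap₁₂ H x y z)) (codeg-sym x y zs)

  deg-↭ : ∀ x {zs ws} → zs ↭ ws → deg x zs ≡ deg x ws
  deg-↭ x refl         = refl
  deg-↭ x (prep z p)   = cong₂ _+_ (codeg-↭ x z p) (deg-↭ x p)
  deg-↭ x (swap {ys = ws} z w p) rewrite swap₂₃ H x z w | codeg-↭ x z p | codeg-↭ x w p | deg-↭ x p =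
    lemma (bit (E H x w z)) (codeg x z ws) (codeg x w ws) (deg x ws)
    where
    lemma : ∀ a b c d → a + b + (c + d) ≡ a + c + (b + d)
    lemma = solve-∀
  deg-↭ x (Perm.trans p q)  rewrite deg-↭ x p = deg-↭ x q

  -- Every deletion argument rests on this: the vertices to be deleted may be moved to the front.
  cnt-↭ : ∀ {zs ws} → zs ↭ ws → cnt zs ≡ cnt ws
  cnt-↭ refl         = refl
  cnt-↭ (prep z p)   = cong₂ _+_ (deg-↭ z p) (cnt-↭ p)
  cnt-↭ (swap {ys = ws} z w p)
    rewrite codeg-↭ z w p | deg-↭ z p | deg-↭ w p | cnt-↭ p | codeg-sym z w ws =
    lemma (codeg w z ws) (deg z ws) (deg w ws) (cnt ws)
    where
    lemma : ∀ a b c d → a + b + (c + d) ≡ a + c + (b + d)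
    lemma = solve-∀
  cnt-↭ (Perm.trans p q)  rewrite cnt-↭ p = cnt-↭ q

  codeg≤ : ∀ x y zs → codeg x y zs ≤ length zs
  codeg≤ x y []       = z≤n
  codeg≤ x y (z ∷ zs) = +-mono-≤ (bit≤1 (E H x y z)) (codeg≤ x y zs)

  deg≤ : ∀ x ys → deg x ys ≤ c2 (length ys)
  deg≤ x []       = z≤n
  deg≤ x (y ∷ ys) = +-mono-≤ (codeg≤ x y ys) (deg≤ x ys)

  cnt≤ : ∀ xs → cnt xs ≤ c3 (length xs)
  cnt≤ []       = z≤n
  cnt≤ (x ∷ xs) = +-mono-≤ (deg≤ x xs) (cnt≤ xs)

  codeg-zero : ∀ {x y} zs → (∀ {z} → z ∈ zs → ¬ Ed H x y z) → codeg x y zs ≡ 0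
  codeg-zero []       _ = refl
  codeg-zero (z ∷ zs) f = cong₂ _+_ (bit-zero (f (here refl))) (codeg-zero zs (f ∘ there))

  deg-zero : ∀ {x} ys → (∀ {y z} → y ∈ ys → z ∈ ys → ¬ Ed H x y z) → deg x ys ≡ 0
  deg-zero []       _ = refl
  deg-zero (y ∷ ys) f = cong₂ _+_ (codeg-zero ys (λ z∈ → f (here refl) (there z∈)))
                                  (deg-zero ys (λ y∈ z∈ → f (there y∈) (there z∈)))

  cnt-zero : ∀ xs → (∀ {x y z} → x ∈ xs → y ∈ xs → z ∈ xs → ¬ Ed H x y z) → cnt xs ≡ 0
  cnt-zero []       _ = refl
  cnt-zero (x ∷ xs) f = cong₂ _+_ (deg-zero xs (λ y∈ z∈ → f (here refl) (there y∈) (there z∈)))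
                                  (cnt-zero xs (λ x∈ y∈ z∈ → f (there x∈) (there y∈) (there z∈)))

  cross₁-zero : ∀ xs zs → (∀ {x y z} → x ∈ xs → y ∈ zs → z ∈ zs → ¬ Ed H x y z) → cross₁ xs zs ≡ 0
  cross₁-zero []       zs _ = refl
  cross₁-zero (x ∷ xs) zs f = cong₂ _+_ (deg-zero zs (f (here refl))) (cross₁-zero xs zs (f ∘ there))

  codegs-zero : ∀ x ys zs → (∀ {y z} → y ∈ ys → z ∈ zs → ¬ Ed H x y z) → codegs x ys zs ≡ 0
  codegs-zero x []       zs _ = refl
  codegs-zero x (y ∷ ys) zs f = cong₂ _+_ (codeg-zero zs (f (here refl))) (codegs-zero x ys zs (f ∘ there))

  cross₂-zero : ∀ xs zs → (∀ {x y z} → x ∈ xs → y ∈ xs → z ∈ zs → ¬ Ed H x y z) → cross₂ xs zs ≡ 0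
  cross₂-zero []       zs _ = refl
  cross₂-zero (x ∷ xs) zs f = cong₂ _+_ (codegs-zero x xs zs (λ y∈ → f (here refl) (there y∈)))
                                        (cross₂-zero xs zs (λ x∈ y∈ → f (there x∈) (there y∈)))

  codegs-∷ : ∀ x ys z zs → codegs x ys (z ∷ zs) ≡ codegs x ys (z ∷ []) + codegs x ys zs
  codegs-∷ x []       z zs = refl
  codegs-∷ x (y ∷ ys) z zs rewrite codegs-∷ x ys z zs =
    lemma (bit (E H x y z)) (codeg x y zs) (codegs x ys (z ∷ [])) (codegs x ys zs)
    where
    lemma : ∀ a b c d → a + b + (c + d) ≡ a + 0 + c + (b + d)
    lemma = solve-∀

  cross₂-∷ : ∀ xs z zs → cross₂ xs (z ∷ zs) ≡ cross₂ xs (z ∷ []) + cross₂ xs zs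
  cross₂-∷ []       z zs = refl
  cross₂-∷ (x ∷ xs) z zs rewrite codegs-∷ x xs z zs | cross₂-∷ xs z zs =
    lemma (codegs x xs (z ∷ [])) (codegs x xs zs) (cross₂ xs (z ∷ [])) (cross₂ xs zs)
    where
    lemma : ∀ a b c d → a + b + (c + d) ≡ a + c + (b + d)
    lemma = solve-∀

  cross₂≤ : ∀ xs zs {k} → (∀ {z} → z ∈ zs → cross₂ xs (z ∷ []) ≤ k) → cross₂ xs zs ≤ length zs * k
  cross₂≤ xs []       f = ≤-reflexive (cross₂-zero xs [] (λ _ _ ()))
  cross₂≤ xs (z ∷ zs) f rewrite cross₂-∷ xs z zs = +-mono-≤ (f (here refl)) (cross₂≤ xs zs (f ∘ there))

open Count public

-- Forbidden configurations

PathFree : Hyp A → Set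
PathFree {A} H = ∀ {a b c d e f g : A} → Unique (a ∷ b ∷ c ∷ d ∷ e ∷ f ∷ g ∷ []) →
  Ed H a b c → Ed H c d e → Ed H e f g → ⊥

-- The `x`s are the pairwise intersections of the three edges; each `y` is the private vertex of the
-- edge that avoids the `x` of the same index.
TriangleFree : Hyp A → Set
TriangleFree {A} H = ∀ {x₁ x₂ x₃ y₁ y₂ y₃ : A} → Unique (x₁ ∷ x₂ ∷ x₃ ∷ y₁ ∷ y₂ ∷ y₃ ∷ []) →
  Ed H x₁ x₂ y₃ → Ed H x₁ x₃ y₂ → Ed H x₂ x₃ y₁ → ⊥

ChordFree : Hyp A → Set
ChordFree {A} H = ∀ {a b c d e : A} → Unique (a ∷ b ∷ c ∷ d ∷ e ∷ []) →
  Ed H a b c → Ed H a b d → Ed H c d e → ⊥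

PageFree : Hyp A → Set
PageFree {A} H = ∀ {a b c d e x : A} → Unique (a ∷ b ∷ c ∷ d ∷ e ∷ x ∷ []) →
  Ed H a b c → Ed H c d e → Ed H a b x → ⊥

CherryFree : Hyp A → Set
CherryFree {A} H = ∀ {a b c d e : A} → Unique (a ∷ b ∷ c ∷ d ∷ e ∷ []) →
  Ed H a b c → Ed H c d e → ⊥

Unique-↭ : {xs ys : List A} → xs ↭ ys → Unique xs → Unique ys
Unique-↭ refl         u                          = u
Unique-↭ (prep x p)   (a ∷ u)                    = All-resp-↭ p a ∷ Unique-↭ p u
Unique-↭ (swap x y p) ((x≢y ∷ a) ∷ (b ∷ u))      =
  ((λ y≡x → x≢y (sym y≡x)) ∷ All-resp-↭ p b) ∷ (All-resp-↭ p a ∷ Unique-↭ p u)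
Unique-↭ (Perm.trans p q) u                      = Unique-↭ q (Unique-↭ p u)

lookup-injective : {xs : List A} → Unique xs → ∀ {i j} → lookup xs i ≡ lookup xs j → i ≡ j
lookup-injective (a ∷ u) {0F}        {0F}        _  = refl
lookup-injective (a ∷ u) {0F}        {Fin.suc j} eq = ⊥-elim (All.lookup a (∈-lookup j) eq)
lookup-injective (a ∷ u) {Fin.suc i} {0F}        eq = ⊥-elim (All.lookup a (∈-lookup i) (sym eq))
lookup-injective (a ∷ u) {Fin.suc i} {Fin.suc j} eq = cong Fin.suc (lookup-injective u eq)

Unique-++ˡ : ∀ xs {ys : List A} → Unique (xs ++ ys) → Unique xs
Unique-++ˡ []       u       = []
Unique-++ˡ (x ∷ xs) (a ∷ u) = All.tabulate (λ y∈ → All.lookup a (∈-++⁺ˡ y∈)) ∷ Unique-++ˡ xs u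

Unique-++ʳ : ∀ xs {ys : List A} → Unique (xs ++ ys) → Unique ys
Unique-++ʳ []       u       = u
Unique-++ʳ (x ∷ xs) (a ∷ u) = Unique-++ʳ xs u

++-disjoint : ∀ xs {ys : List A} {v} → Unique (xs ++ ys) → v ∈ xs → v ∈ ys → ⊥
++-disjoint (x ∷ xs) (a ∷ u) (here refl) v∈ys = All.lookup a (∈-++⁺ʳ xs v∈ys) refl
++-disjoint (x ∷ xs) (a ∷ u) (there v∈)  v∈ys = ++-disjoint xs u v∈ v∈ys

Unique-restrict : ∀ xs {ys zs : List A} → Unique (xs ++ ys) → Unique zs → (∀ {z} → z ∈ zs → z ∈ ys) →
                  Unique (xs ++ zs)
Unique-restrict xs {ys} u v sub =
  Uniq.++⁺ (Unique-++ˡ xs u) v (λ { (z∈xs , z∈zs) → ++-disjoint xs u z∈xs (sub z∈zs) })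

module _ (xs : List A) {ys : List A} (u : Unique (xs ++ ys)) where

  uniq₁ : ∀ {z} → z ∈ ys → Unique (xs ++ z ∷ [])
  uniq₁ z∈ = Unique-restrict xs u ([] ∷ []) (λ { (here refl) → z∈ })

  uniq₂ : ∀ {z w} → z ∈ ys → w ∈ ys → z ≢ w → Unique (xs ++ z ∷ w ∷ [])
  uniq₂ z∈ w∈ z≢w = Unique-restrict xs u ((z≢w ∷ []) ∷ [] ∷ [])
    (λ { (here refl) → z∈ ; (there (here refl)) → w∈ })

  uniq₃ : ∀ {z w v} → z ∈ ys → w ∈ ys → v ∈ ys → z ≢ w → z ≢ v → w ≢ v → Unique (xs ++ z ∷ w ∷ v ∷ [])
  uniq₃ z∈ w∈ v∈ z≢w z≢v w≢v = Unique-restrict xs u ((z≢w ∷ z≢v ∷ []) ∷ (w≢v ∷ []) ∷ [] ∷ [])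
    (λ { (here refl) → z∈ ; (there (here refl)) → w∈ ; (there (there (here refl))) → v∈ })

pull : {x : A} {ys : List A} → x ∈ ys → ∃[ zs ] x ∷ zs ↭ ys
pull {x = x} x∈ with ∈-∃++ x∈
... | ys₁ , ys₂ , refl = ys₁ ++ ys₂ , ↭-sym (shift x ys₁ ys₂)

complement : ∀ xs {ys : List A} → Unique xs → (∀ {x} → x ∈ xs → x ∈ ys) → ∃[ zs ] xs ++ zs ↭ ys
complement []       {ys} _       _   = ys , ↭-refl
complement (x ∷ xs) {ys} (a ∷ u) sub with pull (sub (here refl))
... | ys′ , p with complement xs u (λ {y} y∈ → drop-head y∈ (∈-resp-↭ (↭-sym p) (sub (there y∈))))
  where
  drop-head : ∀ {y} → y ∈ xs → y ∈ x ∷ ys′ → y ∈ ys′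
  drop-head y∈ (here refl) = ⊥-elim (All.lookup a y∈ refl)
  drop-head y∈ (there q)   = q
... | zs , q = zs , ↭-trans (prep x q) p

record Completion {n} (xs : List (Fin n)) : Set where
  field
    rest   : List (Fin n)
    perm   : xs ++ rest ↭ allFin n
    unique : Unique (xs ++ rest)

  size-rest : length (xs ++ rest) ≡ n
  size-rest = trans (↭-length perm) (length-tabulate id)

  mem : ∀ v → v ∈ xs ++ rest
  mem v = ∈-resp-↭ (↭-sym perm) (∈-allFin v)

complete : ∀ {n} {xs : List (Fin n)} → Unique xs → Completion xs
complete {n} {xs} u with complement xs u (λ {x} _ → ∈-allFin x)
... | zs , p = record { rest = zs ; perm = p ; unique = Unique-↭ (↭-sym p) (Uniq.allFin⁺ n) }

module Local {A : Set} (H : Hyp A) where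

  -- Listing the vertices of an edge in the order of xs saves the appeals to symmetry: facts about a configuration xs
  -- are stated in that order, and the lemmas below may traverse them in any other.
  sorted : (xs : List A) (i j k : Fin (length xs)) → Set
  sorted xs i j k = T (
    if toℕ i ≤ᵇ toℕ j
    then (if toℕ j ≤ᵇ toℕ k then E H (lookup xs i) (lookup xs j) (lookup xs k)
          else if toℕ i ≤ᵇ toℕ k then E H (lookup xs i) (lookup xs k) (lookup xs j)
          else E H (lookup xs k) (lookup xs i) (lookup xs j))
    else (if toℕ i ≤ᵇ toℕ k then E H (lookup xs j) (lookup xs i) (lookup xs k)
          else if toℕ j ≤ᵇ toℕ k then E H (lookup xs j) (lookup xs k) (lookup xs i)
          else E H (lookup xs k) (lookup xs j) (lookup xs i)))

  unsort : ∀ xs i j k → sorted xs i j k → Ed H (lookup xs i) (lookup xs j) (lookup xs k)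
  unsort xs i j k e with toℕ i ≤ᵇ toℕ j | toℕ j ≤ᵇ toℕ k | toℕ i ≤ᵇ toℕ k
  ... | true  | true  | _     = e
  ... | true  | false | true  = sw₂₃ H _ _ _ e
  ... | true  | false | false = rot H _ _ _ e
  ... | false | _     | true  = sw₁₂ H _ _ _ e
  ... | false | true  | false = rot H _ _ _ (rot H _ _ _ e)
  ... | false | false | false = sw₁₂ H _ _ _ (rot H _ _ _ e)

  module _ {xs : List A} (u : Unique xs) where

    private
      V : Set
      V = Fin (length xs)

      pick : ∀ {is : List V} → True (unique? _≟_ is) → Unique (map (lookup xs) is)
      pick t = Uniq.map⁺ (lookup-injective u) (toWitness t)

    -- Vertices are given by their positions in `xs`. Their distinctness is then decided by
    -- evaluation, and the implicit argument solves itself.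
    path : PathFree H → ∀ (a b c d e f g : V) → {True (unique? _≟_ (a ∷ b ∷ c ∷ d ∷ e ∷ f ∷ g ∷ []))} →
           sorted xs a b c → sorted xs c d e → sorted xs e f g → ⊥
    path pf a b c d e f g {t} p q r = pf (pick t) (unsort xs a b c p) (unsort xs c d e q) (unsort xs e f g r)

    triangle : TriangleFree H → ∀ (a b c d e f : V) → {True (unique? _≟_ (a ∷ b ∷ c ∷ d ∷ e ∷ f ∷ []))} →
           sorted xs a b f → sorted xs a c e → sorted xs b c d → ⊥
    triangle tf a b c d e f {t} p q r = tf (pick t) (unsort xs a b f p) (unsort xs a c e q) (unsort xs b c d r)

    chord : ChordFree H → ∀ (a b c d e : V) → {True (unique? _≟_ (a ∷ b ∷ c ∷ d ∷ e ∷ []))} →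
           sorted xs a b c → sorted xs a b d → sorted xs c d e → ⊥
    chord cf a b c d e {t} p q r = cf (pick t) (unsort xs a b c p) (unsort xs a b d q) (unsort xs c d e r)

    page : PageFree H → ∀ (a b c d e x : V) → {True (unique? _≟_ (a ∷ b ∷ c ∷ d ∷ e ∷ x ∷ []))} →
           sorted xs a b c → sorted xs c d e → sorted xs a b x → ⊥
    page pf a b c d e x {t} p q r = pf (pick t) (unsort xs a b c p) (unsort xs c d e q) (unsort xs a b x r)

    cherry : CherryFree H → ∀ (a b c d e : V) → {True (unique? _≟_ (a ∷ b ∷ c ∷ d ∷ e ∷ []))} →
           sorted xs a b c → sorted xs c d e → ⊥
    cherry cf a b c d e {t} p q = cf (pick t) (unsort xs a b c p) (unsort xs c d e q)

open Local public

-- Loose triangles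

-- The orders below begin with pairs of triples that cannot both be edges and end with triples that are not edges,
-- since they would complete a path.
module Seven {A : Set} (H : Hyp A) (pf : PathFree H) {x₁ x₂ x₃ y₁ y₂ y₃ α : A}
             (u : Unique (x₁ ∷ x₂ ∷ x₃ ∷ y₁ ∷ y₂ ∷ y₃ ∷ α ∷ []))
             (e₁ : Ed H x₁ x₂ y₃) (e₂ : Ed H x₁ x₃ y₂) (e₃ : Ed H x₂ x₃ y₁) where
  open import Algebra.Solver.CommutativeMonoid +-0-commutativeMonoid using (Expr; var; _⊕_; prove) renaming (id to ε)

  private
    xs : List A
    xs = x₁ ∷ x₂ ∷ x₃ ∷ y₁ ∷ y₂ ∷ y₃ ∷ α ∷ []

    b : A → A → A → ℕ
    b x y z = bit (E H x y z)

    v : ∀ m {m<35 : True (m <? 35)} → Expr 35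
    v m {m<35} = var (#_ m {m<n = m<35})

    none : ∀ {c} → ¬ T c → bit c ≤ 0
    none ¬t = ≤-reflexive (bit-zero ¬t)

    -- The exact shape to which `cnt H xs` unfolds, with one variable for each of the C(7, 3) = 35
    -- triples. The monoid solver then justifies any regrouping.
    lexicographic : Expr 35
    lexicographic =
      ((v 0 ⊕ v 1 ⊕ v 2 ⊕ v 3 ⊕ v 4 ⊕ ε) ⊕ (v 5 ⊕ v 6 ⊕ v 7 ⊕ v 8 ⊕ ε) ⊕ (v 9 ⊕ v 10 ⊕ v 11 ⊕ ε) ⊕ (v 12 ⊕ v
      13 ⊕ ε) ⊕ (v 14 ⊕ ε) ⊕ (ε) ⊕ ε) ⊕ ((v 15 ⊕ v 16 ⊕ v 17 ⊕ v 18 ⊕ ε) ⊕ (v 19 ⊕ v 20 ⊕ v 21 ⊕ ε) ⊕ (v 22 ⊕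
      v 23 ⊕ ε) ⊕ (v 24 ⊕ ε) ⊕ (ε) ⊕ ε) ⊕ ((v 25 ⊕ v 26 ⊕ v 27 ⊕ ε) ⊕ (v 28 ⊕ v 29 ⊕ ε) ⊕ (v 30 ⊕ ε) ⊕ (ε) ⊕
      ε) ⊕ ((v 31 ⊕ v 32 ⊕ ε) ⊕ (v 33 ⊕ ε) ⊕ (ε) ⊕ ε) ⊕ ((v 34 ⊕ ε) ⊕ (ε) ⊕ ε) ⊕ ((ε) ⊕ ε) ⊕ (ε) ⊕ ε

    bits : Vec ℕ 35
    bits =
      b x₁ x₂ x₃ ∷ b x₁ x₂ y₁ ∷ b x₁ x₂ y₂ ∷ b x₁ x₂ y₃ ∷ b x₁ x₂ α ∷ b x₁ x₃ y₁ ∷ b x₁ x₃ y₂ ∷ b x₁ x₃ y₃ ∷ b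
      x₁ x₃ α ∷ b x₁ y₁ y₂ ∷ b x₁ y₁ y₃ ∷ b x₁ y₁ α ∷ b x₁ y₂ y₃ ∷ b x₁ y₂ α ∷ b x₁ y₃ α ∷ b x₂ x₃ y₁ ∷ b x₂
      x₃ y₂ ∷ b x₂ x₃ y₃ ∷ b x₂ x₃ α ∷ b x₂ y₁ y₂ ∷ b x₂ y₁ y₃ ∷ b x₂ y₁ α ∷ b x₂ y₂ y₃ ∷ b x₂ y₂ α ∷ b x₂ y₃
      α ∷ b x₃ y₁ y₂ ∷ b x₃ y₁ y₃ ∷ b x₃ y₁ α ∷ b x₃ y₂ y₃ ∷ b x₃ y₂ α ∷ b x₃ y₃ α ∷ b y₁ y₂ y₃ ∷ b y₁ y₂ α ∷
      b y₁ y₃ α ∷ b y₂ y₃ α ∷ []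

  core-order : Expr 35
  core-order =
    (v 1 ⊕ v 30) ⊕ (v 5 ⊕ v 22) ⊕ (v 7 ⊕ v 19) ⊕ (v 9 ⊕ v 18) ⊕ (v 10 ⊕ v 16) ⊕ (v 17 ⊕ v 11) ⊕ (v 25 ⊕ v 23)
    ⊕ v 3 ⊕ v 6 ⊕ v 15 ⊕ v 4 ⊕ v 0 ⊕ v 2 ⊕ v 8 ⊕ v 12 ⊕ v 13 ⊕ v 14 ⊕ v 20 ⊕ v 21 ⊕ v 24 ⊕ v 26 ⊕ v 27 ⊕ v 28
    ⊕ v 29 ⊕ v 31 ⊕ v 32 ⊕ v 33 ⊕ v 34 ⊕ ε

  -- The 35 triples fall into seven pairs with at most one edge each, seven triples without
  -- restriction, and fourteen that complete a path: 7 + 7 = 14.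
  core : Ed H x₁ x₂ α → cnt H xs ≤ 14
  core f = ≤-trans (≤-reflexive (prove 35 lexicographic core-order bits)) (
    +-mono-≤ (bit-exclusive (E H x₁ x₂ y₁) (E H x₃ y₃ α) (λ p q → path H u pf 1F 3F 0F 4F 2F 5F 6F p e₂ q)) (
    +-mono-≤ (bit-exclusive (E H x₁ x₃ y₁) (E H x₂ y₂ y₃) (λ p q → path H u pf 2F 3F 0F 6F 1F 4F 5F p f q)) (
    +-mono-≤ (bit-exclusive (E H x₁ x₃ y₃) (E H x₂ y₁ y₂) (λ p q → path H u pf 2F 5F 0F 6F 1F 3F 4F p f q)) (
    +-mono-≤ (bit-exclusive (E H x₁ y₁ y₂) (E H x₂ x₃ α) (λ p q → path H u pf 3F 4F 0F 5F 1F 2F 6F p e₁ q)) (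
    +-mono-≤ (bit-exclusive (E H x₁ y₁ y₃) (E H x₂ x₃ y₂) (λ p q → path H u pf 3F 5F 0F 6F 1F 2F 4F p f q)) (
    +-mono-≤ (bit-exclusive (E H x₂ x₃ y₃) (E H x₁ y₁ α) (λ p q → path H u pf 1F 5F 2F 4F 0F 3F 6F p e₂ q)) (
    +-mono-≤ (bit-exclusive (E H x₃ y₁ y₂) (E H x₂ y₂ α) (λ p q → path H u pf 0F 5F 1F 6F 4F 2F 3F e₁ q p)) (
    +-mono-≤ (bit≤1 (E H x₁ x₂ y₃)) (
    +-mono-≤ (bit≤1 (E H x₁ x₃ y₂)) (
    +-mono-≤ (bit≤1 (E H x₂ x₃ y₁)) (
    +-mono-≤ (bit≤1 (E H x₁ x₂ α)) (
    +-mono-≤ (bit≤1 (E H x₁ x₂ x₃)) (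
    +-mono-≤ (bit≤1 (E H x₁ x₂ y₂)) (
    +-mono-≤ (bit≤1 (E H x₁ x₃ α)) (
    +-mono-≤ (none (λ e → path H u pf 2F 3F 1F 6F 0F 4F 5F e₃ f e)) (
    +-mono-≤ (none (λ e → path H u pf 2F 3F 1F 5F 0F 4F 6F e₃ e₁ e)) (
    +-mono-≤ (none (λ e → path H u pf 1F 3F 2F 4F 0F 5F 6F e₃ e₂ e)) (
    +-mono-≤ (none (λ e → path H u pf 2F 4F 0F 6F 1F 3F 5F e₂ f e)) (
    +-mono-≤ (none (λ e → path H u pf 2F 4F 0F 5F 1F 3F 6F e₂ e₁ e)) (
    +-mono-≤ (none (λ e → path H u pf 0F 4F 2F 3F 1F 5F 6F e₂ e₃ e)) (
    +-mono-≤ (none (λ e → path H u pf 1F 6F 0F 4F 2F 3F 5F f e₂ e)) (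
    +-mono-≤ (none (λ e → path H u pf 1F 5F 0F 4F 2F 3F 6F e₁ e₂ e)) (
    +-mono-≤ (none (λ e → path H u pf 0F 6F 1F 3F 2F 4F 5F f e₃ e)) (
    +-mono-≤ (none (λ e → path H u pf 0F 5F 1F 3F 2F 4F 6F e₁ e₃ e)) (
    +-mono-≤ (none (λ e → path H u pf 1F 6F 0F 2F 4F 3F 5F f e₂ e)) (
    +-mono-≤ (none (λ e → path H u pf 1F 5F 0F 2F 4F 3F 6F e₁ e₂ e)) (
    +-mono-≤ (none (λ e → path H u pf 2F 4F 0F 1F 5F 3F 6F e₂ e₁ e)) (
    +-mono-≤ (none (λ e → path H u pf 2F 3F 1F 0F 5F 4F 6F e₃ e₁ e)) z≤n))))))))))))))))))))))))))))

  pendant-order : Expr 35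
  pendant-order =
    (v 0 ⊕ v 31) ⊕ (v 1 ⊕ v 30) ⊕ (v 2 ⊕ v 26) ⊕ (v 5 ⊕ v 23) ⊕ (v 7 ⊕ v 19) ⊕ v 3 ⊕ v 6 ⊕ v 15 ⊕ v 11 ⊕ v 4 ⊕
    v 8 ⊕ v 9 ⊕ v 10 ⊕ v 18 ⊕ v 12 ⊕ v 13 ⊕ v 14 ⊕ v 16 ⊕ v 17 ⊕ v 20 ⊕ v 21 ⊕ v 22 ⊕ v 24 ⊕ v 25 ⊕ v 27 ⊕ v
    28 ⊕ v 29 ⊕ v 32 ⊕ v 33 ⊕ v 34 ⊕ ε

  -- Here there are five exclusive pairs, nine unrestricted triples and sixteen that complete a
  -- path: 5 + 9 = 14.
  pendant : Ed H x₁ y₁ α → cnt H xs ≤ 14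
  pendant f = ≤-trans (≤-reflexive (prove 35 lexicographic pendant-order bits)) (
    +-mono-≤ (bit-exclusive (E H x₁ x₂ x₃) (E H y₁ y₂ y₃) (λ p q → path H u pf 1F 2F 0F 6F 3F 4F 5F p f q)) (
    +-mono-≤ (bit-exclusive (E H x₁ x₂ y₁) (E H x₃ y₃ α) (λ p q → path H u pf 1F 3F 0F 4F 2F 5F 6F p e₂ q)) (
    +-mono-≤ (bit-exclusive (E H x₁ x₂ y₂) (E H x₃ y₁ y₃) (λ p q → path H u pf 1F 4F 0F 6F 3F 2F 5F p f q)) (
    +-mono-≤ (bit-exclusive (E H x₁ x₃ y₁) (E H x₂ y₂ α) (λ p q → path H u pf 2F 3F 0F 5F 1F 4F 6F p e₁ q)) (
    +-mono-≤ (bit-exclusive (E H x₁ x₃ y₃) (E H x₂ y₁ y₂) (λ p q → path H u pf 2F 5F 0F 6F 3F 1F 4F p f q)) (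
    +-mono-≤ (bit≤1 (E H x₁ x₂ y₃)) (
    +-mono-≤ (bit≤1 (E H x₁ x₃ y₂)) (
    +-mono-≤ (bit≤1 (E H x₂ x₃ y₁)) (
    +-mono-≤ (bit≤1 (E H x₁ y₁ α)) (
    +-mono-≤ (bit≤1 (E H x₁ x₂ α)) (
    +-mono-≤ (bit≤1 (E H x₁ x₃ α)) (
    +-mono-≤ (bit≤1 (E H x₁ y₁ y₂)) (
    +-mono-≤ (bit≤1 (E H x₁ y₁ y₃)) (
    +-mono-≤ (bit≤1 (E H x₂ x₃ α)) (
    +-mono-≤ (none (λ e → path H u pf 1F 2F 3F 6F 0F 4F 5F e₃ f e)) (
    +-mono-≤ (none (λ e → path H u pf 2F 3F 1F 5F 0F 4F 6F e₃ e₁ e)) (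
    +-mono-≤ (none (λ e → path H u pf 1F 3F 2F 4F 0F 5F 6F e₃ e₂ e)) (
    +-mono-≤ (none (λ e → path H u pf 3F 6F 0F 5F 1F 2F 4F f e₁ e)) (
    +-mono-≤ (none (λ e → path H u pf 3F 6F 0F 4F 2F 1F 5F f e₂ e)) (
    +-mono-≤ (none (λ e → path H u pf 2F 4F 0F 6F 3F 1F 5F e₂ f e)) (
    +-mono-≤ (none (λ e → path H u pf 2F 4F 0F 5F 1F 3F 6F e₂ e₁ e)) (
    +-mono-≤ (none (λ e → path H u pf 3F 6F 0F 2F 4F 1F 5F f e₂ e)) (
    +-mono-≤ (none (λ e → path H u pf 0F 4F 2F 3F 1F 5F 6F e₂ e₃ e)) (
    +-mono-≤ (none (λ e → path H u pf 1F 5F 0F 6F 3F 2F 4F e₁ f e)) (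
    +-mono-≤ (none (λ e → path H u pf 1F 5F 0F 4F 2F 3F 6F e₁ e₂ e)) (
    +-mono-≤ (none (λ e → path H u pf 3F 6F 0F 1F 5F 2F 4F f e₁ e)) (
    +-mono-≤ (none (λ e → path H u pf 0F 5F 1F 3F 2F 4F 6F e₁ e₃ e)) (
    +-mono-≤ (none (λ e → path H u pf 1F 5F 0F 2F 4F 3F 6F e₁ e₂ e)) (
    +-mono-≤ (none (λ e → path H u pf 2F 4F 0F 1F 5F 3F 6F e₂ e₁ e)) (
    +-mono-≤ (none (λ e → path H u pf 2F 3F 1F 0F 5F 4F 6F e₃ e₁ e)) z≤n))))))))))))))))))))))))))))))

separate : {P : A → Set} → (∀ x → Dec (P x)) → ∀ xs →
           ∃[ ys ] ∃[ zs ] ys ++ zs ↭ xs × All P ys × All (λ z → ¬ P z) zs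
separate P? [] = [] , [] , ↭-refl , [] , []
separate P? (x ∷ xs) with P? x | separate P? xs
... | yes px | ys , zs , p , a , b = x ∷ ys , zs , prep x p , px ∷ a , b
... | no ¬px | ys , zs , p , a , b = ys , x ∷ zs , ↭-trans (shift x ys zs) (prep x p) , a , ¬px ∷ b

cross₂-++ : ∀ (H : Hyp A) xs ys zs → cross₂ H xs (ys ++ zs) ≡ cross₂ H xs ys + cross₂ H xs zs
cross₂-++ H xs []       zs = sym (cong (_+ cross₂ H xs zs) (cross₂-zero H xs [] (λ _ _ ())))
cross₂-++ H xs (y ∷ ys) zs rewrite cross₂-∷ H xs y (ys ++ zs) | cross₂-++ H xs ys zs | cross₂-∷ H xs y ys =
  sym (+-assoc (cross₂ H xs (y ∷ [])) _ _)

-- An edge that meets `xs` has at least two vertices there. The vertex `z` is kept together with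
-- `xs` because the bounds for `xs` with one linked outer vertex are much better than separate
-- bounds for the two.
peel : (H : Hyp A) → ∀ xs z ys → (∀ {v w y} → v ∈ xs → w ∈ z ∷ ys → y ∈ z ∷ ys → ¬ Ed H v w y) →
       cnt H (xs ++ z ∷ ys) ≡ cnt H (xs ++ z ∷ []) + cross₂ H xs ys + cnt H (z ∷ ys)
peel H xs z ys h rewrite cnt-++ H xs (z ∷ ys) | cnt-++ H xs (z ∷ []) | cross₂-∷ H xs z ys
  | cross₁-zero H xs (z ∷ ys) h
  | cross₁-zero H xs (z ∷ []) (λ { v∈ (here refl) (here refl) → h v∈ (here refl) (here refl) }) =
  lemma (cnt H xs) (cross₂ H xs (z ∷ [])) (cross₂ H xs ys) (cnt H (z ∷ ys))
  where
  lemma : ∀ a b c d → a + (b + c + d) ≡ a + (b + 0) + c + d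
  lemma = solve-∀

-- Symmetry reduces a check of all ordered pairs to the pairs in list order, fifteen for six
-- vertices.
AllPairs⇒All₂ : {R : A → A → Set} {xs : List A} → (∀ x → R x x) → (∀ {x y} → R x y → R y x) →
                AllPairs R xs → ∀ {x y} → x ∈ xs → y ∈ xs → R x y
AllPairs⇒All₂ {R = R} r s ps x∈ y∈ with ∈-AllPairs₂ ps x∈ y∈
... | inj₁ refl        = r _
... | inj₂ (inj₁ xRy)  = xRy
... | inj₂ (inj₂ yRx)  = s yRx

module TriangleCase {A : Set} (H : Hyp A) (pf : PathFree H) {x₁ x₂ x₃ y₁ y₂ y₃ : A} {rest : List A}
                    (u : Unique (x₁ ∷ x₂ ∷ x₃ ∷ y₁ ∷ y₂ ∷ y₃ ∷ rest))
                    (e₁ : Ed H x₁ x₂ y₃) (e₂ : Ed H x₁ x₃ y₂) (e₃ : Ed H x₂ x₃ y₁) where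

  U : List A
  U = x₁ ∷ x₂ ∷ x₃ ∷ y₁ ∷ y₂ ∷ y₃ ∷ []

  -- Of the fifteen pairs in `U` only these six can be completed by an outer vertex. Each of the
  -- other nine would form a path with two edges of the triangle.
  Attached : A → Set
  Attached z = Ed H x₁ x₂ z ⊎ Ed H x₁ x₃ z ⊎ Ed H x₂ x₃ z ⊎ Ed H x₁ y₁ z ⊎ Ed H x₂ y₂ z ⊎ Ed H x₃ y₃ z

  attached? : ∀ z → Dec (Attached z)
  attached? z = T? _ ⊎-dec T? _ ⊎-dec T? _ ⊎-dec T? _ ⊎-dec T? _ ⊎-dec T? _

  private
    v₁ : ∀ {z} → z ∈ rest → Unique (U ++ z ∷ [])
    v₁ = uniq₁ U u

    v₂ : ∀ {z w} → z ∈ rest → w ∈ rest → z ≢ w → Unique (U ++ z ∷ w ∷ [])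
    v₂ = uniq₂ U u

  -- Two edges of the triangle form a loose path of length two, and every vertex of `U` is a free
  -- end of such a path. An edge that meets `U` only there prolongs it.
  no-single : ∀ {v z w} → v ∈ U → z ∈ rest → w ∈ rest → ¬ Ed H v z w
  no-single (here refl) z∈ w∈ e = path H (v₂ z∈ w∈ (distinct₂₃ H e)) pf 2F 3F 1F 5F 0F 6F 7F e₃ e₁ e
  no-single (there (here refl)) z∈ w∈ e = path H (v₂ z∈ w∈ (distinct₂₃ H e)) pf 2F 4F 0F 5F 1F 6F 7F e₂ e₁ e
  no-single (there (there (here refl))) z∈ w∈ e = path H (v₂ z∈ w∈ (distinct₂₃ H e)) pf 1F 5F 0F 4F 2F 6F 7F e₁ e₂ e
  no-single (there (there (there (here refl)))) z∈ w∈ e = path H (v₂ z∈ w∈ (distinct₂₃ H e)) pf 0F 5F 1F 2F 3F 6F 7F e₁ e₃ e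
  no-single (there (there (there (there (here refl))))) z∈ w∈ e = path H (v₂ z∈ w∈ (distinct₂₃ H e)) pf 1F 5F 0F 2F 4F 6F 7F e₁ e₂ e
  no-single (there (there (there (there (there (here refl)))))) z∈ w∈ e = path H (v₂ z∈ w∈ (distinct₂₃ H e)) pf 2F 4F 0F 1F 5F 6F 7F e₂ e₁ e

  detached : ∀ {z} → z ∈ rest → ¬ Attached z → ∀ {v w} → v ∈ U → w ∈ U → ¬ Ed H v w z
  detached {z} z∈ ¬att = AllPairs⇒All₂ (λ x e → distinct₁₂ H e refl) (λ ¬e e → ¬e (sw₁₂ H _ _ _ e))
    (   ((λ e → ¬att (inj₁ e))
      ∷ (λ e → ¬att (inj₂ (inj₁ e)))
      ∷ (λ e → ¬att (inj₂ (inj₂ (inj₂ (inj₁ e)))))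
      ∷ (λ e → path H (v₁ z∈) pf 2F 3F 1F 5F 0F 4F 6F e₃ e₁ e)
      ∷ (λ e → path H (v₁ z∈) pf 1F 3F 2F 4F 0F 5F 6F e₃ e₂ e)
      ∷ [])
    ∷ ((λ e → ¬att (inj₂ (inj₂ (inj₁ e))))
      ∷ (λ e → path H (v₁ z∈) pf 2F 4F 0F 5F 1F 3F 6F e₂ e₁ e)
      ∷ (λ e → ¬att (inj₂ (inj₂ (inj₂ (inj₂ (inj₁ e))))))
      ∷ (λ e → path H (v₁ z∈) pf 0F 4F 2F 3F 1F 5F 6F e₂ e₃ e)
      ∷ [])
    ∷ ((λ e → path H (v₁ z∈) pf 1F 5F 0F 4F 2F 3F 6F e₁ e₂ e)
      ∷ (λ e → path H (v₁ z∈) pf 0F 5F 1F 3F 2F 4F 6F e₁ e₃ e)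
      ∷ (λ e → ¬att (inj₂ (inj₂ (inj₂ (inj₂ (inj₂ (e)))))))
      ∷ [])
    ∷ ((λ e → path H (v₁ z∈) pf 1F 5F 0F 2F 4F 3F 6F e₁ e₂ e)
      ∷ (λ e → path H (v₁ z∈) pf 2F 4F 0F 1F 5F 3F 6F e₂ e₁ e)
      ∷ [])
    ∷ ((λ e → path H (v₁ z∈) pf 2F 3F 1F 0F 5F 4F 6F e₃ e₁ e)
      ∷ [])
    ∷ ([])
    ∷ [])

  -- The attaching edge meets some edge of the triangle in exactly one vertex, and an edge at `z`
  -- outside `U` would prolong the two to a path.
  isolated : ∀ {z v w} → z ∈ rest → Attached z → v ∈ rest → w ∈ rest → ¬ Ed H z v w
  isolated {z} {v} {w} z∈ att v∈ w∈ e = go att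
    where
    t : Unique (U ++ z ∷ v ∷ w ∷ [])
    t = uniq₃ U u z∈ v∈ w∈ (distinct₁₂ H e) (distinct₁₃ H e) (distinct₂₃ H e)

    go : ¬ Attached z
    go (inj₁ f) = path H t pf 2F 4F 0F 1F 6F 7F 8F e₂ f e
    go (inj₂ (inj₁ f)) = path H t pf 1F 5F 0F 2F 6F 7F 8F e₁ f e
    go (inj₂ (inj₂ (inj₁ f))) = path H t pf 0F 5F 1F 2F 6F 7F 8F e₁ f e
    go (inj₂ (inj₂ (inj₂ (inj₁ f)))) = path H t pf 1F 5F 0F 3F 6F 7F 8F e₁ f e
    go (inj₂ (inj₂ (inj₂ (inj₂ (inj₁ f))))) = path H t pf 0F 5F 1F 4F 6F 7F 8F e₁ f e
    go (inj₂ (inj₂ (inj₂ (inj₂ (inj₂ f))))) = path H t pf 0F 1F 5F 2F 6F 7F 8F e₁ f e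

  cross₂-link : ∀ {z} → z ∈ rest → cross₂ H U (z ∷ []) ≡
    bit (E H x₁ x₂ z) + bit (E H x₁ x₃ z) + bit (E H x₂ x₃ z) + bit (E H x₁ y₁ z) + bit (E H x₂ y₂ z) + bit (E H x₃ y₃ z)
  cross₂-link {z} z∈
    rewrite bit-zero (λ e → path H (v₁ z∈) pf 2F 3F 1F 5F 0F 4F 6F e₃ e₁ e)
          | bit-zero (λ e → path H (v₁ z∈) pf 1F 3F 2F 4F 0F 5F 6F e₃ e₂ e)
          | bit-zero (λ e → path H (v₁ z∈) pf 2F 4F 0F 5F 1F 3F 6F e₂ e₁ e)
          | bit-zero (λ e → path H (v₁ z∈) pf 0F 4F 2F 3F 1F 5F 6F e₂ e₃ e)
          | bit-zero (λ e → path H (v₁ z∈) pf 1F 5F 0F 4F 2F 3F 6F e₁ e₂ e)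
          | bit-zero (λ e → path H (v₁ z∈) pf 0F 5F 1F 3F 2F 4F 6F e₁ e₃ e)
          | bit-zero (λ e → path H (v₁ z∈) pf 1F 5F 0F 2F 4F 3F 6F e₁ e₂ e)
          | bit-zero (λ e → path H (v₁ z∈) pf 2F 4F 0F 1F 5F 3F 6F e₂ e₁ e)
          | bit-zero (λ e → path H (v₁ z∈) pf 2F 3F 1F 0F 5F 4F 6F e₃ e₁ e)
    = lemma (bit (E H x₁ x₂ z)) (bit (E H x₁ x₃ z)) (bit (E H x₂ x₃ z)) (bit (E H x₁ y₁ z)) (bit (E H x₂ y₂ z)) (bit (E H x₃ y₃ z))
    where
    lemma : ∀ a b c d e f → a + 0 + (b + 0 + (d + 0 + 0)) + (c + 0 + (e + 0 + 0) + (f + 0 + 0 + 0)) ≡ a + b + c + d + e + f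
    lemma = solve-∀

  -- The six pairs that can be completed by an outside vertex form three disjoint pairs of pairs,
  -- and different outside vertices cannot complete disjoint pairs.
  links≤6 : ∀ {z w} → z ∈ rest → w ∈ rest → z ≢ w → cross₂ H U (z ∷ []) + cross₂ H U (w ∷ []) ≤ 6
  links≤6 {z} {w} z∈ w∈ z≢w rewrite cross₂-link z∈ | cross₂-link w∈ = ≤-trans (≤-reflexive (lemma
      (bit (E H x₁ x₂ z)) (bit (E H x₁ x₃ z)) (bit (E H x₂ x₃ z)) (bit (E H x₁ y₁ z)) (bit (E H x₂ y₂ z)) (bit (E H x₃ y₃ z))
      (bit (E H x₁ x₂ w)) (bit (E H x₁ x₃ w)) (bit (E H x₂ x₃ w)) (bit (E H x₁ y₁ w)) (bit (E H x₂ y₂ w)) (bit (E H x₃ y₃ w))))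
    (+-mono-≤ (bit-exclusive (E H x₁ x₂ z) (E H x₃ y₃ w) (λ e f → path H t pf 1F 6F 0F 4F 2F 5F 7F e e₂ f)) (
    +-mono-≤ (bit-exclusive (E H x₃ y₃ z) (E H x₁ x₂ w) (λ e f → path H t pf 5F 6F 2F 4F 0F 1F 7F e e₂ f)) (
    +-mono-≤ (bit-exclusive (E H x₁ x₃ z) (E H x₂ y₂ w) (λ e f → path H t pf 2F 6F 0F 5F 1F 4F 7F e e₁ f)) (
    +-mono-≤ (bit-exclusive (E H x₂ y₂ z) (E H x₁ x₃ w) (λ e f → path H t pf 4F 6F 1F 5F 0F 2F 7F e e₁ f)) (
    +-mono-≤ (bit-exclusive (E H x₂ x₃ z) (E H x₁ y₁ w) (λ e f → path H t pf 2F 6F 1F 5F 0F 3F 7F e e₁ f)) (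
    (bit-exclusive (E H x₁ y₁ z) (E H x₂ x₃ w) (λ e f → path H t pf 3F 6F 0F 5F 1F 2F 7F e e₁ f))))))))
    where
    t : Unique (U ++ z ∷ w ∷ [])
    t = v₂ z∈ w∈ z≢w

    lemma : ∀ a b c d e f a′ b′ c′ d′ e′ f′ → a + b + c + d + e + f + (a′ + b′ + c′ + d′ + e′ + f′) ≡
      (a + f′) + ((f + a′) + ((b + e′) + ((e + b′) + ((c + d′) + (d + c′)))))
    lemma = solve-∀

  -- Up to permutation of the indices 1, 2, 3 there are two cases: a pair of `x`s is `core`, and an
  -- `x` with its opposite `y` is `pendant`.
  seven : ∀ {z} → z ∈ rest → Attached z → cnt H (U ++ z ∷ []) ≤ 14
  seven {z} z∈ (inj₁ f) = Seven.core H pf (v₁ z∈) e₁ e₂ e₃ f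
  seven {z} z∈ (inj₂ (inj₁ f)) = subst (_≤ 14) (cnt-↭ H (↭-sym p))
    (Seven.core H pf (Unique-↭ p (v₁ z∈)) e₂ e₁ (sw₁₂ H _ _ _ e₃) f)
    where
    p : U ++ z ∷ [] ↭ x₁ ∷ x₃ ∷ x₂ ∷ y₁ ∷ y₃ ∷ y₂ ∷ z ∷ []
    p = prep _ (swap _ _ (prep _ (swap _ _ refl)))
  seven {z} z∈ (inj₂ (inj₂ (inj₁ f))) = subst (_≤ 14) (cnt-↭ H (↭-sym p))
    (Seven.core H pf (Unique-↭ p (v₁ z∈)) e₃ (sw₁₂ H _ _ _ e₁) (sw₁₂ H _ _ _ e₂) f)
    where
    p : U ++ z ∷ [] ↭ x₂ ∷ x₃ ∷ x₁ ∷ y₂ ∷ y₃ ∷ y₁ ∷ z ∷ []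
    p = ↭-trans (swap _ _ (prep _ (swap _ _ refl))) (prep _ (swap _ _ (prep _ (swap _ _ refl))))
  seven {z} z∈ (inj₂ (inj₂ (inj₂ (inj₁ f)))) = Seven.pendant H pf (v₁ z∈) e₁ e₂ e₃ f
  seven {z} z∈ (inj₂ (inj₂ (inj₂ (inj₂ (inj₁ f))))) = subst (_≤ 14) (cnt-↭ H (↭-sym p))
    (Seven.pendant H pf (Unique-↭ p (v₁ z∈)) (sw₁₂ H _ _ _ e₁) e₃ e₂ f)
    where
    p : U ++ z ∷ [] ↭ x₂ ∷ x₁ ∷ x₃ ∷ y₂ ∷ y₁ ∷ y₃ ∷ z ∷ []
    p = swap _ _ (prep _ (swap _ _ refl))
  seven {z} z∈ (inj₂ (inj₂ (inj₂ (inj₂ (inj₂ f))))) = subst (_≤ 14) (cnt-↭ H (↭-sym p))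
    (Seven.pendant H pf (Unique-↭ p (v₁ z∈)) (sw₁₂ H _ _ _ e₂) (sw₁₂ H _ _ _ e₃) e₁ f)
    where
    p : U ++ z ∷ [] ↭ x₃ ∷ x₁ ∷ x₂ ∷ y₃ ∷ y₁ ∷ y₂ ∷ z ∷ []
    p = ↭-trans (prep _ (swap _ _ (prep _ (swap _ _ refl)))) (swap _ _ (prep _ (swap _ _ refl)))

  module _ {α : A} {as bs : List A} (p : α ∷ as ++ bs ↭ rest) (att : All Attached (α ∷ as))
           (¬att : All (λ z → ¬ Attached z) bs) (few : ∀ {z} → z ∈ as → cross₂ H U (z ∷ []) ≤ 3) where

    private
      α∈ : α ∈ rest
      α∈ = ∈-resp-↭ p (here refl)

      as∈ : ∀ {z} → z ∈ as → z ∈ rest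
      as∈ z∈ = ∈-resp-↭ p (there (∈-++⁺ˡ z∈))

      bs∈ : ∀ {z} → z ∈ bs → z ∈ rest
      bs∈ z∈ = ∈-resp-↭ p (there (∈-++⁺ʳ as z∈))

      h : ∀ {z} → z ∈ α ∷ as → z ∈ rest
      h (here refl) = α∈
      h (there z∈)  = as∈ z∈

      cnt-rest : cnt H (α ∷ as ++ bs) ≡ cnt H bs
      cnt-rest rewrite cnt-++ H (α ∷ as) bs
        | cnt-zero H (α ∷ as) (λ x∈ y∈ z∈ → isolated (h x∈) (All.lookup att x∈) (h y∈) (h z∈))
        | cross₂-zero H (α ∷ as) bs (λ x∈ y∈ z∈ → isolated (h x∈) (All.lookup att x∈) (h y∈) (bs∈ z∈))
        | cross₁-zero H (α ∷ as) bs (λ x∈ y∈ z∈ → isolated (h x∈) (All.lookup att x∈) (bs∈ y∈) (bs∈ z∈)) = refl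

      links : cross₂ H U (as ++ bs) ≤ length as * 3
      links = ≤-trans (≤-reflexive (trans (cross₂-++ H U as bs) (trans (cong (cross₂ H U as +_)
        (cross₂-zero H U bs (λ x∈ y∈ z∈ → detached (bs∈ z∈) (All.lookup ¬att z∈) x∈ y∈))) (+-identityʳ _))))
        (cross₂≤ H U as few)

    -- The vertex `α` is counted with `U` in the 14, every further attached vertex costs at most 3,
    -- and by `isolated` no attached vertex lies in an edge outside `U`.
    attached-bound : cnt H (U ++ rest) ≤ 14 + length as * 3 + cnt H bs
    attached-bound = begin
      cnt H (U ++ rest)
        ≡⟨ cnt-↭ H (++⁺ˡ U (↭-sym p)) ⟩
      cnt H (U ++ α ∷ as ++ bs)
        ≡⟨ peel H U α (as ++ bs) (λ v∈ w∈ y∈ → no-single v∈ (∈-resp-↭ p w∈) (∈-resp-↭ p y∈)) ⟩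
      cnt H (U ++ α ∷ []) + cross₂ H U (as ++ bs) + cnt H (α ∷ as ++ bs)
        ≤⟨ +-mono-≤ (+-mono-≤ (seven α∈ (All.lookup att (here refl))) links) (≤-reflexive cnt-rest) ⟩
      14 + length as * 3 + cnt H bs ∎
      where open ≤-Reasoning

  data Outcome : Set where
    apart  : (∀ {z} → z ∈ rest → ¬ Attached z) → Outcome
    -- There are `suc a` attached vertices; the first is included in the 14.
    joined : ∀ a bs → Unique bs → suc a + length bs ≡ length rest →
             cnt H (U ++ rest) ≤ 14 + a * 3 + cnt H bs → Outcome

  -- By `links≤6` at most one attached vertex completes more than three pairs. If there is one, it
  -- is taken as `α`, whose links are absorbed by the 14.
  outcome : Outcome
  outcome with separate attached? rest
  ... | [] , bs , p , _ , ¬att = apart (λ z∈ → All.lookup ¬att (∈-resp-↭ (↭-sym p) z∈))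
  ... | as@(a ∷ as₀) , bs , p , att , ¬att with separate (λ z → 4 ≤? cross₂ H U (z ∷ [])) as
  ...   | big ∷ bigs , small , q , (b₁ ∷ b₂) , _ =
    joined (length (bigs ++ small)) bs (Unique-++ʳ as (Unique-↭ (↭-sym p) (Unique-++ʳ U u)))
      (trans (cong (_+ length bs) (↭-length q)) (trans (sym (length-++ as)) (↭-length p)))
      (attached-bound r (All-resp-↭ (↭-sym q) att) ¬att few)
    where
    r : big ∷ (bigs ++ small) ++ bs ↭ rest
    r = ↭-trans (++⁺ʳ bs q) p

    t : Unique (big ∷ (bigs ++ small) ++ bs)
    t = Unique-↭ (↭-sym r) (Unique-++ʳ U u)

    few : ∀ {z} → z ∈ bigs ++ small → cross₂ H U (z ∷ []) ≤ 3
    -- The vertex `big` completes at least four pairs, hence at least the three that are cancelled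
    -- from the joint bound 6.
    few {z} z∈ = +-cancelˡ-≤ 3 _ _ (≤-trans (+-monoˡ-≤ _ (≤-trans (n≤1+n 3) b₁))
      (links≤6 (∈-resp-↭ r (here refl)) (∈-resp-↭ r (there (∈-++⁺ˡ z∈)))
        (λ { refl → Unique[x∷xs]⇒x∉xs t (∈-++⁺ˡ z∈) })))
  ...   | [] , small , q , _ , ¬big =
    joined (length as₀) bs (Unique-++ʳ as (Unique-↭ (↭-sym p) (Unique-++ʳ U u)))
      (trans (sym (length-++ as)) (↭-length p))
      (attached-bound p att ¬att (λ z∈ → ≤-pred (≰⇒> (All.lookup ¬big (∈-resp-↭ (↭-sym q) (there z∈))))))

-- Bounds, shapes and induced subgraphs

at-most : ∀ {m n} → {T (m ≤ᵇ n)} → m ≤ n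
at-most {m} {n} {t} = ≤ᵇ⇒≤ m n t

-- Naming the difference turns an inequality into an identity for the ring solver.
slack : ∀ {m n} d → m + d ≡ n → m ≤ n
slack {m} d refl = m≤m+n m d

-- Writing the argument as `m + k` lets functions defined by cases on numerals, such as `cap₂`,
-- compute.
from≥ : ∀ m (Q : ℕ → Set) → (∀ k → Q (m + k)) → ∀ {n} → m ≤ n → Q n
from≥ m Q q {n} m≤n = subst Q (m+[n∸m]≡n m≤n) (q (n ∸ m))

total : ∀ {n} → Hyp (Fin n) → ℕ
total {n} H = cnt H (allFin n)

Star : Hyp A → Set
Star {A} H = ∃[ c ] (∀ {x y z : A} → Ed H x y z → c ∈ x ∷ y ∷ z ∷ [])

-- H is contained in the comet with centre c and head {c, a, b, d}.
record SubComet {A : Set} (H : Hyp A) : Set where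
  field
    {c a b d} : A
    unique    : Unique (c ∷ a ∷ b ∷ d ∷ [])
    head      : ∀ {x y z} → x ∈ a ∷ b ∷ d ∷ [] → Ed H x y z → y ∈ c ∷ a ∷ b ∷ d ∷ []
    tail      : ∀ {x y z} → Ed H x y z → All (_∉ a ∷ b ∷ d ∷ []) (x ∷ y ∷ z ∷ []) → c ∈ x ∷ y ∷ z ∷ []

-- Upper bound for the number of edges of a 3-graph without paths and loose triangles, …
cap : ℕ → ℕ
cap (suc (suc (suc (suc (suc (suc n)))))) = c2 (5 + n)
cap n = c3 n

-- … and for one that in addition is neither a star nor contained in a comet.  The values up to 12 are not sharp:
-- they are what the induction gives.
cap₂ : ℕ → ℕ
cap₂ 6  = 10
cap₂ 7  = 14
cap₂ 8  = 16
cap₂ 9  = 20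
cap₂ 10 = 23
cap₂ 11 = 28
cap₂ 12 = 32
cap₂ (suc (suc (suc (suc (suc (suc (suc (suc (suc (suc (suc (suc (suc n))))))))))))) = c2 (9 + n) + 3
cap₂ n  = c3 n

codeg-pullback : (φ : A → B) (H : Hyp B) → ∀ x y zs → codeg (pullback φ H) x y zs ≡ codeg H (φ x) (φ y) (map φ zs)
codeg-pullback φ H x y []       = refl
codeg-pullback φ H x y (z ∷ zs) = cong (bit (E H (φ x) (φ y) (φ z)) +_) (codeg-pullback φ H x y zs)

deg-pullback : (φ : A → B) (H : Hyp B) → ∀ x ys → deg (pullback φ H) x ys ≡ deg H (φ x) (map φ ys)
deg-pullback φ H x []       = refl
deg-pullback φ H x (y ∷ ys) = cong₂ _+_ (codeg-pullback φ H x y ys) (deg-pullback φ H x ys)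

cnt-pullback : (φ : A → B) (H : Hyp B) → ∀ xs → cnt (pullback φ H) xs ≡ cnt H (map φ xs)
cnt-pullback φ H []       = refl
cnt-pullback φ H (x ∷ xs) = cong₂ _+_ (deg-pullback φ H x xs) (cnt-pullback φ H xs)

-- Vertices are renamed by their positions in `xs`, since the classification, and hence its
-- induction hypothesis, is stated over `Fin n`.
induced : Hyp A → (xs : List A) → Hyp (Fin (length xs))
induced H xs = pullback (lookup xs) H

total-induced : (H : Hyp A) (xs : List A) → total (induced H xs) ≡ cnt H xs
total-induced H xs = trans (cnt-pullback (lookup xs) H (allFin (length xs)))
  (cong (cnt H) (trans (map-tabulate id (lookup xs)) (tabulate-lookup xs)))

module _ {A : Set} {H : Hyp A} {xs : List A} (u : Unique xs) where

  induced-unique : ∀ {is} → Unique is → Unique (map (lookup xs) is)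
  induced-unique = Uniq.map⁺ (lookup-injective u)

  induced-pathFree : PathFree H → PathFree (induced H xs)
  induced-pathFree pf v = pf (induced-unique v)

  induced-triangleFree : TriangleFree H → TriangleFree (induced H xs)
  induced-triangleFree tf v = tf (induced-unique v)

induced-edge : (H : Hyp A) (xs : List A) → ∀ {x y z} (x∈ : x ∈ xs) (y∈ : y ∈ xs) (z∈ : z ∈ xs) →
               Ed H x y z → Ed (induced H xs) (Any.index x∈) (Any.index y∈) (Any.index z∈)
induced-edge H xs {x} {y} {z} x∈ y∈ z∈ e
  rewrite sym (lookup-index x∈) | sym (lookup-index y∈) | sym (lookup-index z∈) = e

star-induced : (H : Hyp A) (xs : List A) → Star (induced H xs) →
               ∃[ c ] c ∈ xs × (∀ {x y z} → x ∈ xs → y ∈ xs → z ∈ xs → Ed H x y z → c ∈ x ∷ y ∷ z ∷ [])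
star-induced H xs (i , st) = lookup xs i , ∈-lookup i , go
  where
  go : ∀ {x y z} → x ∈ xs → y ∈ xs → z ∈ xs → Ed H x y z → lookup xs i ∈ x ∷ y ∷ z ∷ []
  go x∈ y∈ z∈ e with st (induced-edge H xs x∈ y∈ z∈ e)
  ... | here refl                 = here (sym (lookup-index x∈))
  ... | there (here refl)         = there (here (sym (lookup-index y∈)))
  ... | there (there (here refl)) = there (there (here (sym (lookup-index z∈))))

find-codeg : (H : Hyp A) → ∀ x y zs → codeg H x y zs ≡ 0 ⊎ (∃[ z ] z ∈ zs × Ed H x y z)
find-codeg H x y []       = inj₁ refl
find-codeg H x y (z ∷ zs) with E H x y z in eq
... | true  = inj₂ (z , here refl , subst T (sym eq) tt)
... | false with find-codeg H x y zs
...   | inj₁ none         = inj₁ none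
...   | inj₂ (w , w∈ , e) = inj₂ (w , there w∈ , e)

find-deg : (H : Hyp A) → ∀ x ys → deg H x ys ≡ 0 ⊎ (∃[ y ] ∃[ z ] y ∈ ys × z ∈ ys × Ed H x y z)
find-deg H x []       = inj₁ refl
find-deg H x (y ∷ ys) with find-codeg H x y ys | find-deg H x ys
... | inj₂ (z , z∈ , e) | _                           = inj₂ (y , z , here refl , there z∈ , e)
... | inj₁ _            | inj₂ (v , w , v∈ , w∈ , e)  = inj₂ (v , w , there v∈ , there w∈ , e)
... | inj₁ p            | inj₁ q                      = inj₁ (cong₂ _+_ p q)

find-edge : (H : Hyp A) → ∀ xs → cnt H xs ≡ 0 ⊎ (∃[ x ] ∃[ y ] ∃[ z ] x ∈ xs × y ∈ xs × z ∈ xs × Ed H x y z)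
find-edge H []       = inj₁ refl
find-edge H (x ∷ xs) with find-deg H x xs | find-edge H xs
... | inj₂ (y , z , y∈ , z∈ , e) | _ = inj₂ (x , y , z , here refl , there y∈ , there z∈ , e)
... | inj₁ _ | inj₂ (v , w , z , v∈ , w∈ , z∈ , e) = inj₂ (v , w , z , there v∈ , there w∈ , there z∈ , e)
... | inj₁ p | inj₁ q = inj₁ (cong₂ _+_ p q)

edge-unique : (H : Hyp A) → ∀ {x y z} → Ed H x y z → Unique (x ∷ y ∷ z ∷ [])
edge-unique H e = (distinct₁₂ H e ∷ distinct₁₃ H e ∷ []) ∷ (distinct₂₃ H e ∷ []) ∷ [] ∷ []

-- Edges never meeting in exactly one vertex

-- The recursion deletes an edge. The summand 1 is that edge, and 3 ⊔ n bounds the edges that share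
-- two vertices with it, where n is the number of remaining vertices.
capᶜ : ℕ → ℕ
capᶜ (suc (suc (suc n))) = 1 + (3 ⊔ⁿ n) + capᶜ n
capᶜ _ = 0

capᶜ≤cap₂ : ∀ n → 6 ≤ n → capᶜ n ≤ cap₂ n
capᶜ≤cap₂ _ = from≥ 6 (λ n → capᶜ n ≤ cap₂ n) go
  where
  lemma : ∀ m q → 14 + m + (q + 3) + (16 + m + m) ≡ 11 + m + (10 + m + (9 + m + q)) + 3
  lemma = solve-∀

  go : ∀ k → capᶜ (6 + k) ≤ cap₂ (6 + k)
  go 0 = at-most
  go 1 = at-most
  go 2 = at-most
  go 3 = at-most
  go 4 = at-most
  go 5 = at-most
  go 6 = at-most
  go 7 = at-most
  go 8 = at-most
  go 9 = at-most
  -- The recursion goes down by three vertices and has to land where `cap₂` follows its formula,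
  -- that is, at 13 or more; hence ten base cases.
  go (suc (suc (suc k@(suc (suc (suc (suc (suc (suc (suc m)))))))))) =
    ≤-trans (+-monoʳ-≤ (14 + m) (go k)) (slack (16 + m + m) (lemma m (c2 (9 + m))))

module Cherryless {A : Set} (H : Hyp A) (mf : CherryFree H) where

  module _ {a b c : A} (e : Ed H a b c) where

    -- If different pairs of `abc` were completed by different vertices, the two edges would meet in
    -- one vertex only. So either one vertex completes all the pairs that occur, giving at most 3,
    -- or only one pair occurs.
    trio≤ : ∀ zs → Unique (a ∷ b ∷ c ∷ zs) → codeg H a b zs + (codeg H a c zs + codeg H b c zs) ≤ 3 ⊔ⁿ length zs
    trio≤ []       _ = z≤n
    trio≤ (z ∷ zs) u@((ab ∷ ac ∷ az ∷ as) ∷ (bc ∷ bz ∷ bs) ∷ (cz ∷ cs) ∷ zz ∷ us)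
      with E H a b z in p | E H a c z in q | E H b c z in r
         | trio≤ zs ((ab ∷ ac ∷ as) ∷ (bc ∷ bs) ∷ cs ∷ us)
    ... | x | y | w | ih = go x y w p q r ih
      where
      t : ∀ {w} → w ∈ zs → Unique (a ∷ b ∷ c ∷ z ∷ w ∷ [])
      t w∈ = uniq₁ (a ∷ b ∷ c ∷ z ∷ []) u w∈

      T⁺ : ∀ {b} → b ≡ true → T b
      T⁺ refl = tt

      ab⇒ac : E H a b z ≡ true → codeg H a c zs ≡ 0
      ab⇒ac p = codeg-zero H zs (λ w∈ f → cherry H (t w∈) mf 1F 3F 0F 2F 4F (T⁺ p) f)

      ab⇒bc : E H a b z ≡ true → codeg H b c zs ≡ 0
      ab⇒bc p = codeg-zero H zs (λ w∈ f → cherry H (t w∈) mf 0F 3F 1F 2F 4F (T⁺ p) f)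

      ac⇒ab : E H a c z ≡ true → codeg H a b zs ≡ 0
      ac⇒ab p = codeg-zero H zs (λ w∈ f → cherry H (t w∈) mf 2F 3F 0F 1F 4F (T⁺ p) f)

      ac⇒bc : E H a c z ≡ true → codeg H b c zs ≡ 0
      ac⇒bc p = codeg-zero H zs (λ w∈ f → cherry H (t w∈) mf 0F 3F 2F 1F 4F (T⁺ p) f)

      bc⇒ab : E H b c z ≡ true → codeg H a b zs ≡ 0
      bc⇒ab p = codeg-zero H zs (λ w∈ f → cherry H (t w∈) mf 2F 3F 1F 0F 4F (T⁺ p) f)

      bc⇒ac : E H b c z ≡ true → codeg H a c zs ≡ 0
      bc⇒ac p = codeg-zero H zs (λ w∈ f → cherry H (t w∈) mf 1F 3F 2F 0F 4F (T⁺ p) f)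

      three : ∀ {k} → k ≤ 3 → k ≤ 3 ⊔ⁿ suc (length zs)
      three k≤3 = ≤-trans k≤3 (m≤m⊔n 3 (suc (length zs)))

      one : ∀ {k} → k ≤ length zs → suc k ≤ 3 ⊔ⁿ suc (length zs)
      one k≤ = ≤-trans (s≤s k≤) (m≤n⊔m 3 (suc (length zs)))

      go : ∀ x y w → E H a b z ≡ x → E H a c z ≡ y → E H b c z ≡ w →
           codeg H a b zs + (codeg H a c zs + codeg H b c zs) ≤ 3 ⊔ⁿ length zs →
           bit x + codeg H a b zs + (bit y + codeg H a c zs + (bit w + codeg H b c zs)) ≤ 3 ⊔ⁿ suc (length zs)
      go true true w p q _ _ rewrite ab⇒ac p | ab⇒bc p | ac⇒ab q = three (s≤s (s≤s (≤-trans (≤-reflexive (+-identityʳ _)) (bit≤1 w))))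
      go true false true p _ r _ rewrite ab⇒ac p | ab⇒bc p | bc⇒ab r = three at-most
      go true false false p _ _ _ rewrite ab⇒ac p | ab⇒bc p = one (≤-trans (≤-reflexive (+-identityʳ _)) (codeg≤ H a b zs))
      go false true true _ q r _ rewrite ac⇒ab q | ac⇒bc q | bc⇒ac r = three at-most
      go false true false _ q _ _ rewrite ac⇒ab q | ac⇒bc q = one (≤-trans (≤-reflexive (+-identityʳ _)) (codeg≤ H a c zs))
      go false false true _ _ r _ rewrite bc⇒ab r | bc⇒ac r = one (codeg≤ H b c zs)
      go false false false _ _ _ ih = ≤-trans ih (⊔-monoʳ-≤ 3 (n≤1+n (length zs)))

  -- Any edge may be deleted together with its vertices, as no edge meets it in exactly one vertex.
  -- The bound `k` on the length makes the recursion structural.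
  cnt≤capᶜ : ∀ k xs → length xs ≤ k → Unique xs → cnt H xs ≤ capᶜ (length xs)
  cnt≤capᶜ k xs l u with find-edge H xs
  ... | inj₁ none rewrite none = z≤n
  ... | inj₂ (a , b , c , a∈ , b∈ , c∈ , e) with complement (a ∷ b ∷ c ∷ []) {xs} (edge-unique H e)
          (λ { (here refl) → a∈ ; (there (here refl)) → b∈ ; (there (there (here refl))) → c∈ })
  ...   | zs , p with k | subst (_≤ k) (sym (↭-length p)) l
  ...     | suc k′ | s≤s l′ =
    subst₂ _≤_ (cnt-↭ H p) (cong capᶜ (↭-length p)) (begin
      cnt H (a ∷ b ∷ c ∷ zs)
        ≡⟨ cnt-++ H (a ∷ b ∷ c ∷ []) zs ⟩
      bit (E H a b c) + 0 + 0 + 0 + (codeg H a b zs + (codeg H a c zs + 0) + (codeg H b c zs + 0 + 0)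
        + (cross₁ H (a ∷ b ∷ c ∷ []) zs + cnt H zs))
        ≡⟨ cong (λ k → bit (E H a b c) + 0 + 0 + 0 + (codeg H a b zs + (codeg H a c zs + 0) + (codeg H b c zs + 0 + 0)
                         + (k + cnt H zs))) outside ⟩
      bit (E H a b c) + 0 + 0 + 0 + (codeg H a b zs + (codeg H a c zs + 0) + (codeg H b c zs + 0 + 0)
        + (0 + cnt H zs))
        ≡⟨ lemma (bit (E H a b c)) (codeg H a b zs) (codeg H a c zs) (codeg H b c zs) (cnt H zs) ⟩
      bit (E H a b c) + (codeg H a b zs + (codeg H a c zs + codeg H b c zs)) + cnt H zs
        ≤⟨ +-mono-≤ (+-mono-≤ (bit≤1 (E H a b c)) (trio≤ e zs v))
                    (cnt≤capᶜ k′ zs (≤-trans (≤-trans (n≤1+n _) (n≤1+n _)) l′) (Unique-++ʳ (a ∷ b ∷ c ∷ []) v)) ⟩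
      capᶜ (length (a ∷ b ∷ c ∷ zs)) ∎)
    where
    open ≤-Reasoning

    v : Unique (a ∷ b ∷ c ∷ zs)
    v = Unique-↭ (↭-sym p) u

    t : ∀ {z w} → z ∈ zs → w ∈ zs → z ≢ w → Unique (a ∷ b ∷ c ∷ z ∷ w ∷ [])
    t = uniq₂ (a ∷ b ∷ c ∷ []) v

    outside : cross₁ H (a ∷ b ∷ c ∷ []) zs ≡ 0
    outside = cross₁-zero H (a ∷ b ∷ c ∷ []) zs (λ
      { (here refl) z∈ w∈ f                 → cherry H (t z∈ w∈ (distinct₂₃ H f)) mf 1F 2F 0F 3F 4F e f
      ; (there (here refl)) z∈ w∈ f         → cherry H (t z∈ w∈ (distinct₂₃ H f)) mf 0F 2F 1F 3F 4F e f
      ; (there (there (here refl))) z∈ w∈ f → cherry H (t z∈ w∈ (distinct₂₃ H f)) mf 0F 1F 2F 3F 4F e f })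

    lemma : ∀ e ab ac bc r → e + 0 + 0 + 0 + (ab + (ac + 0) + (bc + 0 + 0) + (0 + r)) ≡ e + (ab + (ac + bc)) + r
    lemma = solve-∀

-- Chords

bit-exclusive₃ : ∀ a b c → (T a → T b → T c → ⊥) → bit a + (bit b + bit c) ≤ 2
bit-exclusive₃ false b     c     _ = +-mono-≤ (bit≤1 b) (bit≤1 c)
bit-exclusive₃ true  false c     _ = s≤s (bit≤1 c)
bit-exclusive₃ true  true  false _ = at-most
bit-exclusive₃ true  true  true  f = ⊥-elim (f tt tt tt)

module Six {A : Set} (H : Hyp A) (tf : TriangleFree H) {a b c d e z : A}
           (u : Unique (a ∷ b ∷ c ∷ d ∷ e ∷ z ∷ []))
           (e₁ : Ed H a b c) (e₂ : Ed H a b d) (e₃ : Ed H c d e) where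
  open import Algebra.Solver.CommutativeMonoid +-0-commutativeMonoid using (Expr; var; _⊕_; prove) renaming (id to ε)

  private
    xs : List A
    xs = a ∷ b ∷ c ∷ d ∷ e ∷ z ∷ []

    v : ∀ m {m<20 : True (m <? 20)} → Expr 20
    v m {m<20} = var (#_ m {m<n = m<20})

    none : ∀ {c} → ¬ T c → bit c ≤ 0
    none ¬t = ≤-reflexive (bit-zero ¬t)

    lexicographic : Expr 20
    lexicographic =
      ((v 0 ⊕ v 1 ⊕ v 2 ⊕ v 3 ⊕ ε) ⊕ (v 4 ⊕ v 5 ⊕ v 6 ⊕ ε) ⊕ (v 7 ⊕ v 8 ⊕ ε) ⊕ (v 9 ⊕ ε) ⊕ (ε) ⊕ ε) ⊕ ((v 10 ⊕
      v 11 ⊕ v 12 ⊕ ε) ⊕ (v 13 ⊕ v 14 ⊕ ε) ⊕ (v 15 ⊕ ε) ⊕ (ε) ⊕ ε) ⊕ ((v 16 ⊕ v 17 ⊕ ε) ⊕ (v 18 ⊕ ε) ⊕ (ε) ⊕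
      ε) ⊕ ((v 19 ⊕ ε) ⊕ (ε) ⊕ ε) ⊕ ((ε) ⊕ ε) ⊕ (ε) ⊕ ε

    bits : Vec ℕ 20
    bits =
      bit (E H a b c) ∷ bit (E H a b d) ∷ bit (E H a b e) ∷ bit (E H a b z) ∷ bit (E H a c d) ∷ bit (E H a c
      e) ∷ bit (E H a c z) ∷ bit (E H a d e) ∷ bit (E H a d z) ∷ bit (E H a e z) ∷ bit (E H b c d) ∷ bit (E H
      b c e) ∷ bit (E H b c z) ∷ bit (E H b d e) ∷ bit (E H b d z) ∷ bit (E H b e z) ∷ bit (E H c d e) ∷ bit
      (E H c d z) ∷ bit (E H c e z) ∷ bit (E H d e z) ∷ []

  book-order : Expr 20
  book-order =
    (v 4 ⊕ v 11) ⊕ (v 5 ⊕ v 13) ⊕ (v 7 ⊕ v 10) ⊕ v 0 ⊕ v 1 ⊕ v 16 ⊕ v 3 ⊕ v 2 ⊕ v 6 ⊕ v 8 ⊕ v 9 ⊕ v 12 ⊕ v 14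
    ⊕ v 15 ⊕ v 17 ⊕ v 18 ⊕ v 19 ⊕ ε

  -- The twenty triples are three exclusive pairs, five unrestricted triples and nine that are no
  -- edges, three of these by hypothesis and six because they close a loose triangle: 3 + 5 = 8.
  book : ¬ Ed H c d z → ¬ Ed H c e z → ¬ Ed H d e z → Ed H a b z → cnt H xs ≤ 8
  book ¬p ¬q ¬r f = ≤-trans (≤-reflexive (prove 20 lexicographic book-order bits)) (
    +-mono-≤ (bit-exclusive (E H a c d) (E H b c e) (λ p q → triangle H u tf 0F 1F 2F 4F 3F 5F f p q)) (
    +-mono-≤ (bit-exclusive (E H a c e) (E H b d e) (λ p q → triangle H u tf 0F 1F 4F 3F 2F 5F f p q)) (
    +-mono-≤ (bit-exclusive (E H a d e) (E H b c d) (λ p q → triangle H u tf 0F 1F 3F 2F 4F 5F f p q)) (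
    +-mono-≤ (bit≤1 (E H a b c)) (
    +-mono-≤ (bit≤1 (E H a b d)) (
    +-mono-≤ (bit≤1 (E H c d e)) (
    +-mono-≤ (bit≤1 (E H a b z)) (
    +-mono-≤ (bit≤1 (E H a b e)) (
    +-mono-≤ (none (λ e → triangle H u tf 3F 0F 2F 5F 4F 1F e₂ e₃ e)) (
    +-mono-≤ (none (λ e → triangle H u tf 2F 0F 3F 5F 4F 1F e₁ e₃ e)) (
    +-mono-≤ (none (λ e → triangle H u tf 2F 0F 4F 5F 3F 1F e₁ e₃ e)) (
    +-mono-≤ (none (λ e → triangle H u tf 3F 1F 2F 5F 4F 0F e₂ e₃ e)) (
    +-mono-≤ (none (λ e → triangle H u tf 2F 1F 3F 5F 4F 0F e₁ e₃ e)) (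
    +-mono-≤ (none (λ e → triangle H u tf 2F 1F 4F 5F 3F 0F e₁ e₃ e)) (
    +-mono-≤ (none ¬p) (
    +-mono-≤ (none ¬q) (
    +-mono-≤ (none ¬r) z≤n)))))))))))))))))

  chord-cd-order : Expr 20
  chord-cd-order =
    (v 2 ⊕ v 4 ⊕ v 18) ⊕ (v 3 ⊕ v 10 ⊕ v 19) ⊕ v 0 ⊕ v 1 ⊕ v 16 ⊕ v 17 ⊕ v 5 ⊕ v 6 ⊕ v 7 ⊕ v 8 ⊕ v 9 ⊕ v 11 ⊕
    v 12 ⊕ v 13 ⊕ v 14 ⊕ v 15 ⊕ ε

  -- Two groups of three triples contain at most two edges each, since all three would form a loose
  -- triangle. Four triples are given, and the other ten close a triangle: 2 + 2 + 4 = 8.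
  chord-cd : Ed H c d z → cnt H xs ≤ 8
  chord-cd f = ≤-trans (≤-reflexive (prove 20 lexicographic chord-cd-order bits)) (
    +-mono-≤ (bit-exclusive₃ (E H a b e) (E H a c d) (E H c e z) (λ p q r → triangle H u tf 0F 4F 2F 5F 3F 1F p q r)) (
    +-mono-≤ (bit-exclusive₃ (E H a b z) (E H b c d) (E H d e z) (λ p q r → triangle H u tf 1F 5F 3F 4F 2F 0F p q r)) (
    +-mono-≤ (bit≤1 (E H a b c)) (
    +-mono-≤ (bit≤1 (E H a b d)) (
    +-mono-≤ (bit≤1 (E H c d e)) (
    +-mono-≤ (bit≤1 (E H c d z)) (
    +-mono-≤ (none (λ e → triangle H u tf 3F 0F 2F 4F 5F 1F e₂ f e)) (
    +-mono-≤ (none (λ e → triangle H u tf 3F 0F 2F 5F 4F 1F e₂ e₃ e)) (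
    +-mono-≤ (none (λ e → triangle H u tf 2F 0F 3F 4F 5F 1F e₁ f e)) (
    +-mono-≤ (none (λ e → triangle H u tf 2F 0F 3F 5F 4F 1F e₁ e₃ e)) (
    +-mono-≤ (none (λ e → triangle H u tf 2F 0F 4F 5F 3F 1F e₁ e₃ e)) (
    +-mono-≤ (none (λ e → triangle H u tf 3F 1F 2F 4F 5F 0F e₂ f e)) (
    +-mono-≤ (none (λ e → triangle H u tf 3F 1F 2F 5F 4F 0F e₂ e₃ e)) (
    +-mono-≤ (none (λ e → triangle H u tf 2F 1F 3F 4F 5F 0F e₁ f e)) (
    +-mono-≤ (none (λ e → triangle H u tf 2F 1F 3F 5F 4F 0F e₁ e₃ e)) (
    +-mono-≤ (none (λ e → triangle H u tf 2F 1F 4F 5F 3F 0F e₁ e₃ e)) z≤n))))))))))))))))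

  chord-ce-order : Expr 20
  chord-ce-order =
    (v 2 ⊕ v 4) ⊕ (v 3 ⊕ v 10) ⊕ (v 5 ⊕ v 17) ⊕ (v 11 ⊕ v 19) ⊕ v 0 ⊕ v 1 ⊕ v 16 ⊕ v 18 ⊕ v 6 ⊕ v 7 ⊕ v 8 ⊕ v
    9 ⊕ v 12 ⊕ v 13 ⊕ v 14 ⊕ v 15 ⊕ ε

  chord-ce : Ed H c e z → cnt H xs ≤ 8
  chord-ce f = ≤-trans (≤-reflexive (prove 20 lexicographic chord-ce-order bits)) (
    +-mono-≤ (bit-exclusive (E H a b e) (E H a c d) (λ p q → triangle H u tf 4F 2F 0F 3F 1F 5F f p q)) (
    +-mono-≤ (bit-exclusive (E H a b z) (E H b c d) (λ p q → triangle H u tf 5F 2F 1F 3F 0F 4F f p q)) (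
    +-mono-≤ (bit-exclusive (E H a c e) (E H c d z) (λ p q → triangle H u tf 0F 3F 2F 5F 4F 1F e₂ p q)) (
    +-mono-≤ (bit-exclusive (E H b c e) (E H d e z) (λ p q → triangle H u tf 1F 3F 4F 5F 2F 0F e₂ p q)) (
    +-mono-≤ (bit≤1 (E H a b c)) (
    +-mono-≤ (bit≤1 (E H a b d)) (
    +-mono-≤ (bit≤1 (E H c d e)) (
    +-mono-≤ (bit≤1 (E H c e z)) (
    +-mono-≤ (none (λ e → triangle H u tf 3F 0F 2F 5F 4F 1F e₂ e₃ e)) (
    +-mono-≤ (none (λ e → triangle H u tf 2F 0F 4F 3F 5F 1F e₁ f e)) (
    +-mono-≤ (none (λ e → triangle H u tf 2F 0F 3F 5F 4F 1F e₁ e₃ e)) (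
    +-mono-≤ (none (λ e → triangle H u tf 2F 0F 4F 5F 3F 1F e₁ e₃ e)) (
    +-mono-≤ (none (λ e → triangle H u tf 3F 1F 2F 5F 4F 0F e₂ e₃ e)) (
    +-mono-≤ (none (λ e → triangle H u tf 2F 1F 4F 3F 5F 0F e₁ f e)) (
    +-mono-≤ (none (λ e → triangle H u tf 2F 1F 3F 5F 4F 0F e₁ e₃ e)) (
    +-mono-≤ (none (λ e → triangle H u tf 2F 1F 4F 5F 3F 0F e₁ e₃ e)) z≤n))))))))))))))))

  chord-de-order : Expr 20
  chord-de-order =
    (v 2 ⊕ v 4) ⊕ (v 3 ⊕ v 10) ⊕ (v 7 ⊕ v 17) ⊕ (v 13 ⊕ v 18) ⊕ v 0 ⊕ v 1 ⊕ v 16 ⊕ v 19 ⊕ v 5 ⊕ v 6 ⊕ v 8 ⊕ v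
    9 ⊕ v 11 ⊕ v 12 ⊕ v 14 ⊕ v 15 ⊕ ε

  chord-de : Ed H d e z → cnt H xs ≤ 8
  chord-de f = ≤-trans (≤-reflexive (prove 20 lexicographic chord-de-order bits)) (
    +-mono-≤ (bit-exclusive (E H a b e) (E H a c d) (λ p q → triangle H u tf 4F 3F 0F 2F 1F 5F f p q)) (
    +-mono-≤ (bit-exclusive (E H a b z) (E H b c d) (λ p q → triangle H u tf 5F 3F 1F 2F 0F 4F f p q)) (
    +-mono-≤ (bit-exclusive (E H a d e) (E H c d z) (λ p q → triangle H u tf 0F 2F 3F 5F 4F 1F e₁ p q)) (
    +-mono-≤ (bit-exclusive (E H b d e) (E H c e z) (λ p q → triangle H u tf 1F 2F 4F 5F 3F 0F e₁ p q)) (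
    +-mono-≤ (bit≤1 (E H a b c)) (
    +-mono-≤ (bit≤1 (E H a b d)) (
    +-mono-≤ (bit≤1 (E H c d e)) (
    +-mono-≤ (bit≤1 (E H d e z)) (
    +-mono-≤ (none (λ e → triangle H u tf 3F 0F 4F 2F 5F 1F e₂ f e)) (
    +-mono-≤ (none (λ e → triangle H u tf 3F 0F 2F 5F 4F 1F e₂ e₃ e)) (
    +-mono-≤ (none (λ e → triangle H u tf 2F 0F 3F 5F 4F 1F e₁ e₃ e)) (
    +-mono-≤ (none (λ e → triangle H u tf 2F 0F 4F 5F 3F 1F e₁ e₃ e)) (
    +-mono-≤ (none (λ e → triangle H u tf 3F 1F 4F 2F 5F 0F e₂ f e)) (
    +-mono-≤ (none (λ e → triangle H u tf 3F 1F 2F 5F 4F 0F e₂ e₃ e)) (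
    +-mono-≤ (none (λ e → triangle H u tf 2F 1F 3F 5F 4F 0F e₁ e₃ e)) (
    +-mono-≤ (none (λ e → triangle H u tf 2F 1F 4F 5F 3F 0F e₁ e₃ e)) z≤n))))))))))))))))

module ChordCase {A : Set} (H : Hyp A) (pf : PathFree H) (tf : TriangleFree H) {a b c d e : A} {rest : List A}
                 (u : Unique (a ∷ b ∷ c ∷ d ∷ e ∷ rest))
                 (e₁ : Ed H a b c) (e₂ : Ed H a b d) (e₃ : Ed H c d e) where

  X : List A
  X = a ∷ b ∷ c ∷ d ∷ e ∷ []

  Side : A → Set
  Side z = Ed H c d z ⊎ Ed H c e z ⊎ Ed H d e z

  side? : ∀ z → Dec (Side z)
  side? z = T? _ ⊎-dec T? _ ⊎-dec T? _

  private
    v₁ : ∀ {z} → z ∈ rest → Unique (X ++ z ∷ [])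
    v₁ = uniq₁ X u

    v₂ : ∀ {z w} → z ∈ rest → w ∈ rest → z ≢ w → Unique (X ++ z ∷ w ∷ [])
    v₂ = uniq₂ X u

  -- Together with `cde`, both `abc` and `abd` form loose paths of length two. The free ends of
  -- these two paths are all of `X`; the chord contributes `c`.
  no-single : ∀ {v z w} → v ∈ X → z ∈ rest → w ∈ rest → ¬ Ed H v z w
  no-single (here refl) z∈ w∈ e = path H (v₂ z∈ w∈ (distinct₂₃ H e)) pf 3F 4F 2F 1F 0F 5F 6F e₃ e₁ e
  no-single (there (here refl)) z∈ w∈ e = path H (v₂ z∈ w∈ (distinct₂₃ H e)) pf 3F 4F 2F 0F 1F 5F 6F e₃ e₁ e
  no-single (there (there (here refl))) z∈ w∈ e = path H (v₂ z∈ w∈ (distinct₂₃ H e)) pf 0F 1F 3F 4F 2F 5F 6F e₂ e₃ e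
  no-single (there (there (there (here refl)))) z∈ w∈ e = path H (v₂ z∈ w∈ (distinct₂₃ H e)) pf 0F 1F 2F 4F 3F 5F 6F e₁ e₃ e
  no-single (there (there (there (there (here refl))))) z∈ w∈ e = path H (v₂ z∈ w∈ (distinct₂₃ H e)) pf 0F 1F 2F 3F 4F 5F 6F e₁ e₃ e

  -- An outer vertex that completes one of `a`, `b` with one of `c`, `d`, `e` closes a loose
  -- triangle. Of the ten pairs in `X`, this leaves `ab` and the three sides of `cde`.
  links : ∀ {z} → z ∈ rest → cross₂ H X (z ∷ []) ≡ bit (E H a b z) + bit (E H c d z) + bit (E H c e z) + bit (E H d e z)
  links {z} z∈
    rewrite bit-zero (λ e → triangle H (v₁ z∈) tf 3F 0F 2F 5F 4F 1F e₂ e₃ e)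
          | bit-zero (λ e → triangle H (v₁ z∈) tf 2F 0F 3F 5F 4F 1F e₁ e₃ e)
          | bit-zero (λ e → triangle H (v₁ z∈) tf 2F 0F 4F 5F 3F 1F e₁ e₃ e)
          | bit-zero (λ e → triangle H (v₁ z∈) tf 3F 1F 2F 5F 4F 0F e₂ e₃ e)
          | bit-zero (λ e → triangle H (v₁ z∈) tf 2F 1F 3F 5F 4F 0F e₁ e₃ e)
          | bit-zero (λ e → triangle H (v₁ z∈) tf 2F 1F 4F 5F 3F 0F e₁ e₃ e)
    = lemma (bit (E H a b z)) (bit (E H c d z)) (bit (E H c e z)) (bit (E H d e z))
    where
    lemma : ∀ p q r s → p + 0 + 0 + (q + 0 + (r + 0 + 0) + (s + 0 + 0 + 0)) ≡ p + q + r + s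
    lemma = solve-∀

  no-links : ∀ {z} → z ∈ rest → ¬ Ed H a b z → ¬ Side z → cross₂ H X (z ∷ []) ≡ 0
  no-links z∈ ¬ab ¬side rewrite links z∈ | bit-zero ¬ab | bit-zero (λ e → ¬side (inj₁ e))
    | bit-zero (λ e → ¬side (inj₂ (inj₁ e))) | bit-zero (λ e → ¬side (inj₂ (inj₂ e))) = refl

  links≤1 : ∀ {z} → z ∈ rest → ¬ Side z → cross₂ H X (z ∷ []) ≤ 1
  links≤1 {z} z∈ ¬side rewrite links z∈ | bit-zero (λ e → ¬side (inj₁ e))
    | bit-zero (λ e → ¬side (inj₂ (inj₁ e))) | bit-zero (λ e → ¬side (inj₂ (inj₂ e)))
    | +-identityʳ (bit (E H a b z)) | +-identityʳ (bit (E H a b z)) | +-identityʳ (bit (E H a b z)) = bit≤1 (E H a b z)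

  -- Different outer vertices cannot complete different sides of `cde`. Hence `w` completes at most
  -- the side that `z` completes, and `ab`.
  links≤2 : ∀ {z w} → z ∈ rest → w ∈ rest → z ≢ w → Side z → cross₂ H X (w ∷ []) ≤ 2
  links≤2 {z} {w} z∈ w∈ z≢w (inj₁ f) = ≤-trans (≤-reflexive (links w∈)) (+-mono-≤ (+-mono-≤ (+-mono-≤ (bit≤1 (E H a b w)) 
    (bit≤1 (E H c d w)))
    (≤-reflexive (bit-zero (λ g → path H (v₂ z∈ w∈ z≢w) pf 0F 1F 3F 5F 2F 4F 6F e₂ f g))))
    (≤-reflexive (bit-zero (λ g → path H (v₂ z∈ w∈ z≢w) pf 0F 1F 2F 5F 3F 4F 6F e₁ f g))))
  links≤2 {z} {w} z∈ w∈ z≢w (inj₂ (inj₁ f)) = ≤-trans (≤-reflexive (links w∈)) (+-mono-≤ (+-mono-≤ (+-mono-≤ (bit≤1 (E H a b w)) 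
    (≤-reflexive (bit-zero (λ g → path H (v₂ z∈ w∈ z≢w) pf 0F 1F 3F 6F 2F 4F 5F e₂ g f))))
    (bit≤1 (E H c e w)))
    (≤-reflexive (bit-zero (λ g → path H (v₂ z∈ w∈ z≢w) pf 0F 1F 2F 5F 4F 3F 6F e₁ f g))))
  links≤2 {z} {w} z∈ w∈ z≢w (inj₂ (inj₂ f)) = ≤-trans (≤-reflexive (links w∈)) (+-mono-≤ (+-mono-≤ (+-mono-≤ (bit≤1 (E H a b w)) 
    (≤-reflexive (bit-zero (λ g → path H (v₂ z∈ w∈ z≢w) pf 0F 1F 2F 6F 3F 4F 5F e₁ g f))))
    (≤-reflexive (bit-zero (λ g → path H (v₂ z∈ w∈ z≢w) pf 0F 1F 2F 6F 4F 3F 5F e₁ g f))))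
    (bit≤1 (E H d e w)))

  isolated : ∀ {z v w} → z ∈ rest → Side z → v ∈ rest → w ∈ rest → ¬ Ed H z v w
  isolated {z} {v} {w} z∈ side v∈ w∈ e = go side
    where
    t : Unique (X ++ z ∷ v ∷ w ∷ [])
    t = uniq₃ X u z∈ v∈ w∈ (distinct₁₂ H e) (distinct₁₃ H e) (distinct₂₃ H e)

    go : ¬ Side z
    go (inj₁ f) = path H t pf 0F 1F 2F 3F 5F 6F 7F e₁ f e
    go (inj₂ (inj₁ f)) = path H t pf 0F 1F 2F 4F 5F 6F 7F e₁ f e
    go (inj₂ (inj₂ f)) = path H t pf 0F 1F 3F 4F 5F 6F 7F e₂ f e

  six : ∀ {z} → z ∈ rest → Side z → cnt H (X ++ z ∷ []) ≤ 8
  six z∈ (inj₁ f)        = Six.chord-cd H tf (v₁ z∈) e₁ e₂ e₃ f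
  six z∈ (inj₂ (inj₁ f)) = Six.chord-ce H tf (v₁ z∈) e₁ e₂ e₃ f
  six z∈ (inj₂ (inj₂ f)) = Six.chord-de H tf (v₁ z∈) e₁ e₂ e₃ f

  -- The 10 is the trivial C(5, 3) for `X` alone. The 8 is the bound for `X` with one linked vertex:
  -- in `sided` every other outer vertex adds at most 2, in `booked` at most 1.
  data Outcome : Set where
    apart  : cnt H (X ++ rest) ≤ 10 + cnt H rest → Outcome
    sided  : ∀ ys → Unique ys → suc (length ys) ≡ length rest →
             cnt H (X ++ rest) ≤ 8 + length ys * 2 + cnt H ys → Outcome
    booked : ∀ k → suc k ≡ length rest → cnt H (X ++ rest) ≤ 8 + k + cnt H rest → Outcome

  private
    peel-rest : ∀ {z ys k} → z ∷ ys ↭ rest → cnt H (X ++ z ∷ []) ≤ 8 → (∀ {y} → y ∈ ys → cross₂ H X (y ∷ []) ≤ k) →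
                cnt H (X ++ rest) ≤ 8 + length ys * k + cnt H (z ∷ ys)
    peel-rest {z} {ys} {k} p z≤8 h = begin
      cnt H (X ++ rest)
        ≡⟨ cnt-↭ H (++⁺ˡ X (↭-sym p)) ⟩
      cnt H (X ++ z ∷ ys)
        ≡⟨ peel H X z ys (λ v∈ w∈ y∈ → no-single v∈ (∈-resp-↭ p w∈) (∈-resp-↭ p y∈)) ⟩
      cnt H (X ++ z ∷ []) + cross₂ H X ys + cnt H (z ∷ ys)
        ≤⟨ +-monoˡ-≤ (cnt H (z ∷ ys)) (+-mono-≤ z≤8 (cross₂≤ H X ys h)) ⟩
      8 + length ys * k + cnt H (z ∷ ys) ∎
      where open ≤-Reasoning

  outcome : Outcome
  outcome with separate side? rest
  ... | z ∷ zs , ws , p , side ∷ _ , _ =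
    sided ys (Unique-++ʳ (z ∷ []) t) (↭-length p)
      -- A vertex that completes a side lies in no edge outside `X`, so it drops out of the
      -- remainder as well.
      (subst (λ k → cnt H (X ++ rest) ≤ 8 + length ys * 2 + k) (cong (_+ cnt H ys) (deg-zero H ys iso))
        (peel-rest p (six z∈ side) few))
    where
    ys : List A
    ys = zs ++ ws

    z∈ : z ∈ rest
    z∈ = ∈-resp-↭ p (here refl)

    t : Unique (z ∷ ys)
    t = Unique-↭ (↭-sym p) (Unique-++ʳ X u)

    few : ∀ {y} → y ∈ ys → cross₂ H X (y ∷ []) ≤ 2
    few y∈ = links≤2 z∈ (∈-resp-↭ p (there y∈)) (λ { refl → Unique[x∷xs]⇒x∉xs t y∈ }) side

    iso : ∀ {v w} → v ∈ ys → w ∈ ys → ¬ Ed H z v w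
    iso v∈ w∈ = isolated z∈ side (∈-resp-↭ p (there v∈)) (∈-resp-↭ p (there w∈))
  ... | [] , _ , p , _ , ¬side with separate (λ z → T? (E H a b z)) rest
  ...   | [] , _ , q , _ , ¬ab = apart (begin
    cnt H (X ++ rest)
      ≡⟨ cnt-++ H X rest ⟩
    cnt H X + (cross₂ H X rest + (cross₁ H X rest + cnt H rest))
      ≤⟨ +-mono-≤ (cnt≤ H X) (+-mono-≤ (cross₂≤ H X rest few)
           (+-monoˡ-≤ (cnt H rest) (≤-reflexive (cross₁-zero H X rest no-single)))) ⟩
    10 + (length rest * 0 + cnt H rest)
      ≡⟨ cong (λ k → 10 + (k + cnt H rest)) (*-zeroʳ (length rest)) ⟩
    10 + cnt H rest ∎)
    where
    open ≤-Reasoning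

    few : ∀ {y} → y ∈ rest → cross₂ H X (y ∷ []) ≤ 0
    few y∈ = ≤-reflexive (no-links y∈ (All.lookup ¬ab (∈-resp-↭ (↭-sym q) y∈)) (All.lookup ¬side (∈-resp-↭ (↭-sym p) y∈)))
  ...   | z ∷ zs , ws , q , ab ∷ _ , _ =
    booked (length (zs ++ ws)) (↭-length q)
      (subst₂ (λ k l → cnt H (X ++ rest) ≤ 8 + k + l) (*-identityʳ (length (zs ++ ws))) (cnt-↭ H q)
        (peel-rest q (Six.book H tf (v₁ z∈) e₁ e₂ e₃ (λ f → ¬z (inj₁ f)) (λ f → ¬z (inj₂ (inj₁ f))) (λ f → ¬z (inj₂ (inj₂ f))) ab)
          (λ y∈ → links≤1 (∈-resp-↭ q (there y∈)) (sideless (∈-resp-↭ q (there y∈))))))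
    where
    sideless : ∀ {y} → y ∈ rest → ¬ Side y
    sideless y∈ = All.lookup ¬side (∈-resp-↭ (↭-sym p) y∈)

    z∈ : z ∈ rest
    z∈ = ∈-resp-↭ q (here refl)

    ¬z : ¬ Side z
    ¬z = sideless z∈

-- Pages

-- The configuration is symmetric in `a` and `b`. What concerns `a` alone is proved here, and
-- `PageState` instantiates it for both.
module PageSide {A : Set} (H : Hyp A) (pf : PathFree H) (tf : TriangleFree H) (cf : ChordFree H)
                 {a b c d e x : A} {rest : List A} (u : Unique (a ∷ b ∷ c ∷ d ∷ e ∷ x ∷ rest))
                 (e₁ : Ed H a b c) (e₂ : Ed H c d e) (e₃ : Ed H a b x) where

  private
    t₆ : Unique (a ∷ b ∷ c ∷ d ∷ e ∷ x ∷ [])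
    t₆ = Unique-++ˡ (a ∷ b ∷ c ∷ d ∷ e ∷ x ∷ []) u

    t₇ : ∀ {y} → y ∈ rest → Unique (a ∷ b ∷ c ∷ d ∷ e ∷ x ∷ y ∷ [])
    t₇ = uniq₁ (a ∷ b ∷ c ∷ d ∷ e ∷ x ∷ []) u

    t₈ : ∀ {y z} → y ∈ rest → z ∈ rest → y ≢ z → Unique (a ∷ b ∷ c ∷ d ∷ e ∷ x ∷ y ∷ z ∷ [])
    t₈ = uniq₂ (a ∷ b ∷ c ∷ d ∷ e ∷ x ∷ []) u

    s₆ : ∀ {y} → y ∈ x ∷ rest → Unique (a ∷ b ∷ c ∷ d ∷ e ∷ y ∷ [])
    s₆ = uniq₁ (a ∷ b ∷ c ∷ d ∷ e ∷ []) u

    s₇ : ∀ {y z} → y ∈ x ∷ rest → z ∈ x ∷ rest → y ≢ z → Unique (a ∷ b ∷ c ∷ d ∷ e ∷ y ∷ z ∷ [])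
    s₇ = uniq₂ (a ∷ b ∷ c ∷ d ∷ e ∷ []) u

  -- The triple `ade` would be a chord on `de`. One vertex of `d`, `e` and one outside give a loose
  -- triangle with `abc` and `cde`, and two outside give a path.
  no-a : ∀ {p q} → p ∈ d ∷ e ∷ x ∷ rest → q ∈ d ∷ e ∷ x ∷ rest → ¬ Ed H a p q
  no-a (here refl) (here refl) f = distinct₂₃ H f refl
  no-a (here refl) (there (here refl)) f = chord H t₆ cf 3F 4F 2F 0F 1F e₂ f e₁
  no-a (here refl) (there (there z∈)) f = triangle H (s₆ z∈) tf 2F 0F 3F 5F 4F 1F e₁ e₂ f
  no-a (there (here refl)) (here refl) f = chord H t₆ cf 3F 4F 2F 0F 1F e₂ (sw₂₃ H _ _ _ f) e₁
  no-a (there (here refl)) (there (here refl)) f = distinct₂₃ H f refl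
  no-a (there (here refl)) (there (there z∈)) f = triangle H (s₆ z∈) tf 2F 0F 4F 5F 3F 1F e₁ e₂ f
  no-a (there (there z∈)) (here refl) f = triangle H (s₆ z∈) tf 2F 0F 3F 5F 4F 1F e₁ e₂ (sw₂₃ H _ _ _ f)
  no-a (there (there z∈)) (there (here refl)) f = triangle H (s₆ z∈) tf 2F 0F 4F 5F 3F 1F e₁ e₂ (sw₂₃ H _ _ _ f)
  no-a (there (there y∈)) (there (there z∈)) f = path H (s₇ y∈ z∈ (distinct₂₃ H f)) pf 3F 4F 2F 1F 0F 5F 6F e₂ e₁ f

  no-ac : ∀ {y} → y ∈ rest → ¬ Ed H a c y
  no-ac y∈ f = path H (t₇ y∈) pf 3F 4F 2F 6F 0F 1F 5F e₂ f e₃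

  -- If `acx` is an edge, a page `aby` other than `abx` yields the path `dec`, `cxa`, `aby`.
  acx⇒single : Ed H a c x → ∀ {y} → y ∈ rest → ¬ Ed H a b y
  acx⇒single f y∈ g = path H (t₇ y∈) pf 3F 4F 2F 5F 0F 1F 6F e₂ f g

  deg-a : deg H a (c ∷ d ∷ e ∷ x ∷ rest) ≡ bit (E H a c d) + (bit (E H a c e) + bit (E H a c x))
  deg-a rewrite deg-zero H (d ∷ e ∷ x ∷ rest) no-a | codeg-zero H rest no-ac =
    lemma (bit (E H a c d)) (bit (E H a c e)) (bit (E H a c x))
    where
    lemma : ∀ p q r → p + (q + (r + 0)) + 0 ≡ p + (q + r)
    lemma = solve-∀

  ¬cdx : Ed H c d x → ⊥
  ¬cdx f = chord H t₆ cf 0F 1F 2F 5F 3F e₁ e₃ f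

  ¬cex : Ed H c e x → ⊥
  ¬cex f = chord H t₆ cf 0F 1F 2F 5F 4F e₁ e₃ f

  ¬cxy : ∀ {y} → y ∈ rest → ¬ Ed H c x y
  ¬cxy y∈ f = path H (t₇ y∈) pf 3F 4F 2F 6F 5F 0F 1F e₂ f e₃

  -- The edges `bxa` and `adc` lead to `c`, so an edge at `c` away from `d` would usually complete a
  -- path; the exceptions, with `x`, are forbidden already. A star at `c` therefore has all its
  -- edges through `cd`.
  crossing : Ed H a c d → ∀ {y z} → y ∈ e ∷ x ∷ rest → z ∈ e ∷ x ∷ rest → ¬ Ed H c y z
  crossing f (here refl) (here refl) g = distinct₂₃ H g refl
  crossing f (here refl) (there (here refl)) g = ¬cex g
  crossing f (here refl) (there (there z∈)) g = path H (t₇ z∈) pf 1F 5F 0F 3F 2F 4F 6F e₃ f g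
  crossing f (there (here refl)) (here refl) g = ¬cex (sw₂₃ H _ _ _ g)
  crossing f (there (here refl)) (there (here refl)) g = distinct₂₃ H g refl
  crossing f (there (here refl)) (there (there z∈)) g = ¬cxy z∈ g
  crossing f (there (there z∈)) (here refl) g = path H (t₇ z∈) pf 1F 5F 0F 3F 2F 4F 6F e₃ f (sw₂₃ H _ _ _ g)
  crossing f (there (there z∈)) (there (here refl)) g = ¬cxy z∈ (sw₂₃ H _ _ _ g)
  crossing f (there (there y∈)) (there (there z∈)) g = path H (t₈ y∈ z∈ (distinct₂₃ H g)) pf 1F 5F 0F 3F 2F 6F 7F e₃ f g

module PageState {A : Set} (H : Hyp A) (pf : PathFree H) (tf : TriangleFree H) (cf : ChordFree H)
                 {a b c d e x : A} {rest : List A} (u : Unique (a ∷ b ∷ c ∷ d ∷ e ∷ x ∷ rest))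
                 (e₁ : Ed H a b c) (e₂ : Ed H c d e) (e₃ : Ed H a b x) where

  private
    t₆ : Unique (a ∷ b ∷ c ∷ d ∷ e ∷ x ∷ [])
    t₆ = Unique-++ˡ (a ∷ b ∷ c ∷ d ∷ e ∷ x ∷ []) u

    u-de : Unique (a ∷ b ∷ c ∷ e ∷ d ∷ x ∷ rest)
    u-de = Unique-↭ (++⁺ˡ (a ∷ b ∷ c ∷ []) (swap d e ↭-refl)) u

  module a-side = PageSide H pf tf cf u e₁ e₂ e₃
  module b-side = PageSide H pf tf cf (Unique-↭ (swap a b ↭-refl) u) (sw₁₂ H _ _ _ e₁) e₂ (sw₁₂ H _ _ _ e₃)

  open a-side public using (no-a; no-ac; acx⇒single; deg-a; ¬cdx; ¬cex; ¬cxy)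
  open b-side public using () renaming (no-a to no-b; no-ac to no-bc; deg-a to deg-b)

  bcx⇒single : Ed H b c x → ∀ {y} → y ∈ rest → ¬ Ed H a b y
  bcx⇒single f y∈ g = b-side.acx⇒single f y∈ (sw₁₂ H _ _ _ g)

  ¬abd : Ed H a b d → ⊥
  ¬abd f = chord H t₆ cf 0F 1F 2F 3F 4F e₁ f e₂

  ¬abe : Ed H a b e → ⊥
  ¬abe f = chord H t₆ cf 0F 1F 2F 4F 3F e₁ f e₂

  acd-bce : Ed H a c d → Ed H b c e → ⊥
  acd-bce f g = triangle H t₆ tf 0F 1F 2F 4F 3F 5F e₃ f g

  ace-bcd : Ed H a c e → Ed H b c d → ⊥
  ace-bcd f g = triangle H t₆ tf 0F 1F 2F 3F 4F 5F e₃ f g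

  acd-bcd : Ed H a c d → Ed H b c d → ⊥
  acd-bcd f g = chord H t₆ cf 2F 3F 0F 1F 5F f g e₃

  ace-bce : Ed H a c e → Ed H b c e → ⊥
  ace-bce f g = chord H t₆ cf 2F 4F 0F 1F 5F f g e₃

  acd-bcx : Ed H a c d → Ed H b c x → ⊥
  acd-bcx f g = chord H t₆ cf 1F 5F 0F 2F 3F e₃ g f

  acx-bcd : Ed H a c x → Ed H b c d → ⊥
  acx-bcd f g = chord H t₆ cf 0F 5F 1F 2F 3F e₃ f g

  O : List A
  O = c ∷ d ∷ e ∷ x ∷ rest

  codeg-ab : codeg H a b O ≤ 2 + codeg H a b rest
  codeg-ab rewrite bit-zero ¬abd | bit-zero ¬abe =
    +-mono-≤ (bit≤1 (E H a b c)) (+-monoˡ-≤ (codeg H a b rest) (bit≤1 (E H a b x)))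

  private
    a-sum b-sum : ℕ
    a-sum = bit (E H a c d) + (bit (E H a c e) + bit (E H a c x))
    b-sum = bit (E H b c d) + (bit (E H b c e) + bit (E H b c x))

    cnt-ab : cnt H (a ∷ b ∷ O) ≡ codeg H a b O + (a-sum + b-sum) + cnt H O
    cnt-ab rewrite deg-a | deg-b = lemma (codeg H a b O) a-sum b-sum (cnt H O)
      where
      lemma : ∀ p q r s → p + q + (r + s) ≡ p + (q + r) + s
      lemma = solve-∀

  -- The 5 consists of `abc`, `abx` and at most three of the six triples `acd`, `ace`, `acx`, `bcd`,
  -- `bce`, `bcx`, which form three exclusive pairs.
  single-bound : (∀ {y} → y ∈ rest → ¬ Ed H a b y) → cnt H (a ∷ b ∷ O) ≤ 5 + cnt H O
  single-bound single = ≤-trans (≤-reflexive cnt-ab) (+-monoˡ-≤ (cnt H O) (+-mono-≤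
    (≤-trans codeg-ab (≤-reflexive (cong (2 +_) (codeg-zero H rest single))))
    (≤-trans (≤-reflexive (lemma (bit (E H a c d)) (bit (E H a c e)) (bit (E H a c x)) (bit (E H b c d)) (bit (E H b c e)) (bit (E H b c x))))
      (+-mono-≤ (bit-exclusive (E H a c d) (E H b c x) acd-bcx) (
       +-mono-≤ (bit-exclusive (E H a c e) (E H b c e) ace-bce)
                (bit-exclusive (E H a c x) (E H b c d) acx-bcd))))))
    where
    lemma : ∀ p q r p′ q′ r′ → p + (q + r) + (p′ + (q′ + r′)) ≡ (p + r′) + ((q + q′) + (r + p′))
    lemma = solve-∀

  -- A second page rules out `acx` and `bcx`. With the two hypotheses, at most one of `acd`, `ace`,
  -- `bcd`, `bce` is left besides the edges through `ab`.
  multi-bound : (∃[ y ] y ∈ rest × Ed H a b y) → ¬ (Ed H a c d × Ed H a c e) → ¬ (Ed H b c d × Ed H b c e) →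
                cnt H (a ∷ b ∷ O) ≤ 3 + length rest + cnt H O
  multi-bound (y , y∈ , f) ¬a ¬b = ≤-trans (≤-reflexive cnt-ab) (+-monoˡ-≤ (cnt H O) (begin
    codeg H a b O + (a-sum + b-sum)
      ≤⟨ +-mono-≤ codeg-ab sides ⟩
    2 + codeg H a b rest + 1
      ≤⟨ +-monoˡ-≤ 1 (+-monoʳ-≤ 2 (codeg≤ H a b rest)) ⟩
    2 + length rest + 1
      ≡⟨ +-comm (2 + length rest) 1 ⟩
    3 + length rest ∎))
    where
    open ≤-Reasoning
    sides : a-sum + b-sum ≤ 1
    sides with T? (E H a c d)
    ... | yes acd rewrite bit-zero (λ g → acx⇒single g y∈ f) | bit-zero (λ g → bcx⇒single g y∈ f)
          | bit-zero (λ g → ¬a (acd , g)) | bit-zero (acd-bcd acd) | bit-zero (acd-bce acd) =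
      ≤-trans (≤-reflexive (trans (+-identityʳ _) (+-identityʳ _))) (bit≤1 (E H a c d))
    ... | no ¬acd rewrite bit-zero (λ g → acx⇒single g y∈ f) | bit-zero (λ g → bcx⇒single g y∈ f) | bit-zero ¬acd
      with T? (E H a c e)
    ...   | yes ace rewrite bit-zero (ace-bcd ace) | bit-zero (ace-bce ace) =
      ≤-trans (≤-reflexive (trans (+-identityʳ _) (+-identityʳ _))) (bit≤1 (E H a c e))
    ...   | no ¬ace rewrite bit-zero ¬ace | +-identityʳ (bit (E H b c e)) =
      bit-exclusive (E H b c d) (E H b c e) (λ p q → ¬b (p , q))

  -- This is for n = 7: the trivial 10 would overshoot `cap₂ 7` by one, and the missing edge `cdx`
  -- saves it.
  five≤9 : ∀ {y} → cnt H (c ∷ d ∷ e ∷ x ∷ y ∷ []) ≤ 9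
  five≤9 {y} rewrite bit-zero ¬cdx =
    +-mono-≤ (+-mono-≤ (+-mono-≤ (bit≤1 (E H c d e)) (+-monoˡ-≤ 0 (bit≤1 (E H c d y)))) (deg≤ H c (e ∷ x ∷ y ∷ [])))
             (cnt≤ H (d ∷ e ∷ x ∷ y ∷ []))

  private
    avoid : ∀ {p q r} → p ∈ d ∷ e ∷ x ∷ rest → q ∈ d ∷ e ∷ x ∷ rest → r ∈ d ∷ e ∷ x ∷ rest → c ∉ p ∷ q ∷ r ∷ []
    avoid p∈ q∈ r∈ (here refl)                 = ++-disjoint (a ∷ b ∷ c ∷ []) u (there (there (here refl))) p∈
    avoid p∈ q∈ r∈ (there (here refl))         = ++-disjoint (a ∷ b ∷ c ∷ []) u (there (there (here refl))) q∈
    avoid p∈ q∈ r∈ (there (there (here refl))) = ++-disjoint (a ∷ b ∷ c ∷ []) u (there (there (here refl))) r∈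

  module CentreC (st : ∀ {p q r} → p ∈ O → q ∈ O → r ∈ O → Ed H p q r → c ∈ p ∷ q ∷ r ∷ []) where

    cnt-O : cnt H O ≡ deg H c (d ∷ e ∷ x ∷ rest)
    cnt-O = trans (cong (deg H c (d ∷ e ∷ x ∷ rest) +_)
      (cnt-zero H (d ∷ e ∷ x ∷ rest) (λ p∈ q∈ r∈ f → avoid p∈ q∈ r∈ (st (there p∈) (there q∈) (there r∈) f))))
      (+-identityʳ _)

    -- The pages x and y lie in no edge of the star at c.
    multi-star : ∀ {y ys} → y ∷ ys ↭ rest → Ed H a b y → (∀ {z} → z ∈ d ∷ e ∷ ys → ¬ Ed H c y z) →
                 cnt H O ≤ c2 (2 + length ys)
    multi-star {y} {ys} p f ¬cy = begin
      cnt H O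
        ≡⟨ trans cnt-O (deg-↭ H c q) ⟩
      codeg H c x (y ∷ d ∷ e ∷ ys) + (codeg H c y (d ∷ e ∷ ys) + deg H c (d ∷ e ∷ ys))
        ≡⟨ cong₂ (λ k l → k + (l + deg H c (d ∷ e ∷ ys))) (codeg-zero H (y ∷ d ∷ e ∷ ys) ¬cx) (codeg-zero H (d ∷ e ∷ ys) ¬cy) ⟩
      deg H c (d ∷ e ∷ ys)
        ≤⟨ deg≤ H c (d ∷ e ∷ ys) ⟩
      c2 (2 + length ys) ∎
      where
      open ≤-Reasoning

      q : d ∷ e ∷ x ∷ rest ↭ x ∷ y ∷ d ∷ e ∷ ys
      q = ↭-trans (shift x (d ∷ e ∷ []) rest) (prep x (↭-trans (++⁺ˡ (d ∷ e ∷ []) (↭-sym p)) (shift y (d ∷ e ∷ []) ys)))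

      ¬cx : ∀ {z} → z ∈ y ∷ d ∷ e ∷ ys → ¬ Ed H c x z
      ¬cx (here refl)                 = ¬cxy (∈-resp-↭ p (here refl))
      ¬cx (there (here refl))         g = ¬cdx (sw₂₃ H _ _ _ g)
      ¬cx (there (there (here refl))) g = ¬cex (sw₂₃ H _ _ _ g)
      ¬cx (there (there (there z∈)))  = ¬cxy (∈-resp-↭ p (there z∈))

  pages-isolated : ∀ {z} → z ∈ d ∷ e ∷ rest → ¬ Ed H c x z
  pages-isolated (here refl)         g = ¬cdx (sw₂₃ H _ _ _ g)
  pages-isolated (there (here refl)) g = ¬cex (sw₂₃ H _ _ _ g)
  pages-isolated (there (there z∈))    = ¬cxy z∈

  -- By `crossing`, all edges of the star at `c` contain `d`, or all contain `e`, so they number at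
  -- most the vertices that remain.
  crossing-star : (∀ {p q r} → p ∈ O → q ∈ O → r ∈ O → Ed H p q r → c ∈ p ∷ q ∷ r ∷ []) →
                  Ed H a c d ⊎ Ed H a c e ⊎ Ed H b c d ⊎ Ed H b c e → cnt H O ≤ 2 + length rest
  crossing-star st cross = ≤-trans (≤-reflexive cnt-O) (go cross)
    where
    open CentreC st

    via-d : (∀ {y z} → y ∈ e ∷ x ∷ rest → z ∈ e ∷ x ∷ rest → ¬ Ed H c y z) → deg H c (d ∷ e ∷ x ∷ rest) ≤ 2 + length rest
    via-d h rewrite deg-zero H (e ∷ x ∷ rest) h | +-identityʳ (codeg H c d (e ∷ x ∷ rest)) = codeg≤ H c d (e ∷ x ∷ rest)

    via-e : (∀ {y z} → y ∈ d ∷ x ∷ rest → z ∈ d ∷ x ∷ rest → ¬ Ed H c y z) → deg H c (d ∷ e ∷ x ∷ rest) ≤ 2 + length rest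
    via-e h rewrite deg-↭ H c (swap d e (↭-refl {x = x ∷ rest})) | deg-zero H (d ∷ x ∷ rest) h
      | +-identityʳ (codeg H c e (d ∷ x ∷ rest)) = codeg≤ H c e (d ∷ x ∷ rest)

    go : Ed H a c d ⊎ Ed H a c e ⊎ Ed H b c d ⊎ Ed H b c e → deg H c (d ∷ e ∷ x ∷ rest) ≤ 2 + length rest
    go (inj₁ f)               = via-d (a-side.crossing f)
    go (inj₂ (inj₁ f))        = via-e (PageSide.crossing H pf tf cf u-de e₁ (sw₂₃ H _ _ _ e₂) e₃ f)
    go (inj₂ (inj₂ (inj₁ f))) = via-d (b-side.crossing f)
    go (inj₂ (inj₂ (inj₂ f))) = via-e (PageSide.crossing H pf tf cf (Unique-↭ (swap a b ↭-refl) u-de)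
      (sw₁₂ H _ _ _ e₁) (sw₂₃ H _ _ _ e₂) (sw₁₂ H _ _ _ e₃) f)

  -- An edge at `d` without `c` and `e` would prolong `abc` and `cde` to a path. Hence every edge
  -- contains `dc` or `de`, which gives a linear bound.
  centre-d : (∀ {p q r} → p ∈ O → q ∈ O → r ∈ O → Ed H p q r → d ∈ p ∷ q ∷ r ∷ []) → cnt H O ≤ 3 + length rest * 2
  centre-d st = begin
    cnt H O
      ≡⟨ cnt-↭ H (swap c d (↭-refl {x = e ∷ x ∷ rest})) ⟩
    cnt H (d ∷ c ∷ e ∷ x ∷ rest)
      ≡⟨ cong₂ (λ k l → codeg H d c (e ∷ x ∷ rest) + (codeg H d e (x ∷ rest) + k) + l) outer
           (cnt-zero H (c ∷ e ∷ x ∷ rest) (λ p∈ q∈ r∈ f → away p∈ q∈ r∈ (st (emb p∈) (emb q∈) (emb r∈) f))) ⟩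
    codeg H d c (e ∷ x ∷ rest) + (codeg H d e (x ∷ rest) + 0) + 0
      ≤⟨ +-monoˡ-≤ 0 (+-mono-≤ (codeg≤ H d c (e ∷ x ∷ rest)) (+-monoˡ-≤ 0 (codeg≤ H d e (x ∷ rest)))) ⟩
    2 + length rest + (1 + length rest + 0) + 0
      ≡⟨ lemma (length rest) ⟩
    3 + length rest * 2 ∎
    where
    open ≤-Reasoning

    lemma : ∀ r → 2 + r + (1 + r + 0) + 0 ≡ 3 + r * 2
    lemma = solve-∀

    outer : deg H d (x ∷ rest) ≡ 0
    outer = deg-zero H (x ∷ rest) (λ y∈ z∈ f → path H (uniq₂ (a ∷ b ∷ c ∷ d ∷ e ∷ []) u y∈ z∈ (distinct₂₃ H f)) pf 0F 1F 2F 4F 3F 5F 6F e₁ e₂ f)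

    emb : ∀ {p} → p ∈ c ∷ e ∷ x ∷ rest → p ∈ O
    emb (here refl) = here refl
    emb (there p∈)  = there (there p∈)

    d∉ : d ∉ c ∷ e ∷ x ∷ rest
    d∉ (here refl) = distinct₁₂ H e₂ refl
    d∉ (there d∈)  = ++-disjoint (a ∷ b ∷ c ∷ d ∷ []) u (there (there (there (here refl)))) d∈

    away : ∀ {p q r} → p ∈ c ∷ e ∷ x ∷ rest → q ∈ c ∷ e ∷ x ∷ rest → r ∈ c ∷ e ∷ x ∷ rest → d ∉ p ∷ q ∷ r ∷ []
    away p∈ q∈ r∈ (here refl)                 = d∉ p∈
    away p∈ q∈ r∈ (there (here refl))         = d∉ q∈
    away p∈ q∈ r∈ (there (there (here refl))) = d∉ r∈

-- Inequalities for the induction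

c2-mono : ∀ {m n} → m ≤ n → c2 m ≤ c2 n
c2-mono z≤n       = z≤n
c2-mono (s≤s m≤n) = +-mono-≤ m≤n (c2-mono m≤n)

c2-+ : ∀ m n → c2 (m + n) ≡ c2 m + c2 n + m * n
c2-+ zero    n = sym (+-identityʳ (c2 n))
c2-+ (suc m) n rewrite c2-+ m n = lemma m n (c2 m) (c2 n) (m * n)
  where
  lemma : ∀ m n p q r → m + n + (p + q + r) ≡ m + p + q + (n + r)
  lemma = solve-∀

-- In this and the next two inequalities n = 6 + m: five vertices of the chord configuration and 1 +
-- m others.
chord-apart≤ : ∀ m → 10 + cap (1 + m) ≤ cap₂ (6 + m)
chord-apart≤ 0 = at-most
chord-apart≤ 1 = at-most
chord-apart≤ 2 = at-most
chord-apart≤ 3 = at-most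
chord-apart≤ 4 = at-most
chord-apart≤ 5 = at-most
chord-apart≤ 6 = at-most
chord-apart≤ (suc (suc (suc (suc (suc (suc (suc k))))))) = slack (8 + k + k) (lemma k (c2 (7 + k)))
  where
  lemma : ∀ k q → 10 + q + (8 + k + k) ≡ 8 + k + (7 + k + q) + 3
  lemma = solve-∀

chord-sided≤ : ∀ m → 8 + m * 2 + cap m ≤ cap₂ (6 + m)
chord-sided≤ 0 = at-most
chord-sided≤ 1 = at-most
chord-sided≤ 2 = at-most
chord-sided≤ 3 = at-most
chord-sided≤ 4 = at-most
chord-sided≤ 5 = at-most
chord-sided≤ 6 = at-most
chord-sided≤ (suc (suc (suc (suc (suc (suc (suc k))))))) = slack (2 + k) (lemma k (c2 (6 + k)))
  where
  lemma : ∀ k q → 8 + (7 + k) * 2 + q + (2 + k) ≡ 8 + k + (7 + k + (6 + k + q)) + 3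
  lemma = solve-∀

chord-booked≤ : ∀ m → 8 + m + cap (1 + m) ≤ cap₂ (6 + m)
chord-booked≤ 0 = at-most
chord-booked≤ 1 = at-most
chord-booked≤ 2 = at-most
chord-booked≤ 3 = at-most
chord-booked≤ 4 = at-most
chord-booked≤ 5 = at-most
chord-booked≤ 6 = at-most
chord-booked≤ (suc (suc (suc (suc (suc (suc (suc k))))))) = slack (3 + k) (lemma k (c2 (7 + k)))
  where
  lemma : ∀ k q → 8 + (7 + k) + q + (3 + k) ≡ 8 + k + (7 + k + q) + 3
  lemma = solve-∀

-- In the page inequalities n = 8 + r, the deletion of `a` and `b` costs at most 5 + r, and 6 + r
-- vertices remain.
page-small≤ : ∀ r → 5 + r + cap₂ (6 + r) ≤ cap₂ (8 + r)
page-small≤ 0 = at-most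
page-small≤ 1 = at-most
page-small≤ 2 = at-most
page-small≤ 3 = at-most
page-small≤ 4 = at-most
page-small≤ 5 = at-most
page-small≤ 6 = at-most
page-small≤ (suc (suc (suc (suc (suc (suc (suc k))))))) = slack (7 + k) (lemma k (c2 (9 + k)))
  where
  lemma : ∀ k q → 5 + (7 + k) + (q + 3) + (7 + k) ≡ 10 + k + (9 + k + q) + 3
  lemma = solve-∀

page-comet≤ : ∀ r → 5 + r + (4 + c2 (2 + r)) ≤ cap₂ (8 + r)
page-comet≤ 0 = at-most
page-comet≤ 1 = at-most
page-comet≤ 2 = at-most
page-comet≤ 3 = at-most
page-comet≤ 4 = at-most
page-comet≤ (suc (suc (suc (suc (suc k))))) = slack (4 + k) (lemma k (c2 (7 + k)))
  where
  lemma : ∀ k q → 5 + (5 + k) + (4 + q) + (4 + k) ≡ 8 + k + (7 + k + q) + 3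
  lemma = solve-∀

-- Nearly tight: 5 + r + C(3 + r, 2) = C(4 + r, 2) + 2, one below `cap₂` for r ≥ 5. Two vertices
-- must therefore drop out of the remaining star, which is why both pages have to be isolated in it.
page-multi≤ : ∀ r → 5 + r + c2 (3 + r) ≤ cap₂ (8 + r)
page-multi≤ 0 = at-most
page-multi≤ 1 = at-most
page-multi≤ 2 = at-most
page-multi≤ 3 = at-most
page-multi≤ 4 = at-most
page-multi≤ (suc (suc (suc (suc (suc k))))) = slack (1) (lemma k (c2 (8 + k)))
  where
  lemma : ∀ k q → 5 + (5 + k) + q + (1) ≡ 8 + k + q + 3
  lemma = solve-∀

page-leaf≤ : ∀ r → 5 + r + (7 + r * 2) ≤ cap₂ (8 + r)
page-leaf≤ 0 = at-most
page-leaf≤ 1 = at-most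
page-leaf≤ 2 = at-most
page-leaf≤ 3 = at-most
page-leaf≤ 4 = at-most
page-leaf≤ (suc (suc (suc (suc (suc k))))) = slack (2 + k + c2 (5 + k)) (lemma k (c2 (5 + k)))
  where
  lemma : ∀ k q → 5 + (5 + k) + (7 + (5 + k) * 2) + (2 + k + q) ≡ 8 + k + (7 + k + (6 + k + (5 + k + q))) + 3
  lemma = solve-∀

page-crossing≤ : ∀ r → 9 + r ≤ cap₂ (8 + r)
page-crossing≤ r = ≤-trans (slack (3 + r * 2) (lemma r)) (page-leaf≤ r)
  where
  lemma : ∀ r → 9 + r + (3 + r * 2) ≡ 5 + r + (7 + r * 2)
  lemma = solve-∀

isolated-star₃≤ : ∀ i → c2 (4 + i) + 1 ≤ cap₂ (8 + i)
isolated-star₃≤ 0 = at-most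
isolated-star₃≤ 1 = at-most
isolated-star₃≤ 2 = at-most
isolated-star₃≤ 3 = at-most
isolated-star₃≤ 4 = at-most
isolated-star₃≤ (suc (suc (suc (suc (suc k))))) = slack (2) (lemma k (c2 (9 + k)))
  where
  lemma : ∀ k q → q + 1 + (2) ≡ q + 3
  lemma = solve-∀

isolated-star₄≤ : ∀ i → c2 (4 + i) + 4 ≤ cap₂ (9 + i)
isolated-star₄≤ 0 = at-most
isolated-star₄≤ 1 = at-most
isolated-star₄≤ 2 = at-most
isolated-star₄≤ 3 = at-most
isolated-star₄≤ (suc (suc (suc (suc k)))) = slack (7 + k) (lemma k (c2 (8 + k)))
  where
  lemma : ∀ k q → q + 4 + (7 + k) ≡ 8 + k + q + 3
  lemma = solve-∀

isolated-star₅≤ : ∀ i → c2 (4 + i) + 10 ≤ cap₂ (10 + i)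
isolated-star₅≤ 0 = at-most
isolated-star₅≤ 1 = at-most
isolated-star₅≤ 2 = at-most
isolated-star₅≤ (suc (suc (suc k))) = slack (8 + k + k) (lemma k (c2 (7 + k)))
  where
  lemma : ∀ k q → q + 10 + (8 + k + k) ≡ 8 + k + (7 + k + q) + 3
  lemma = solve-∀

-- By `c2-+` two separate stars lose the product of their leaf-set sizes against a single star. With
-- factors at least 4 and 5, the product outweighs the 19 + 2k edges that C(11 + k, 2) exceeds C(9 +
-- k, 2) by.
isolated-star₆≤ : ∀ i j → c2 (4 + i) + c2 (5 + j) ≤ cap₂ (11 + (i + j))
isolated-star₆≤ i j with i + j in eq
... | 0 = ≤-trans (+-mono-≤ (c2-mono (+-monoʳ-≤ 4 (m+n≤o⇒m≤o i (≤-reflexive eq)))) (c2-mono (+-monoʳ-≤ 5 (m+n≤o⇒n≤o i (≤-reflexive eq))))) at-most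
... | 1 = ≤-trans (+-mono-≤ (c2-mono (+-monoʳ-≤ 4 (m+n≤o⇒m≤o i (≤-reflexive eq)))) (c2-mono (+-monoʳ-≤ 5 (m+n≤o⇒n≤o i (≤-reflexive eq))))) at-most
... | suc (suc k) = ≤-trans (+-cancelʳ-≤ (19 + k + k) _ _ (begin
    c2 (4 + i) + c2 (5 + j) + (19 + k + k)
      ≤⟨ +-monoʳ-≤ (c2 (4 + i) + c2 (5 + j)) product ⟩
    c2 (4 + i) + c2 (5 + j) + (4 + i) * (5 + j)
      ≡⟨ sym (c2-+ (4 + i) (5 + j)) ⟩
    c2 (4 + i + (5 + j))
      ≡⟨ cong c2 (trans (lemma₁ i j) (cong (9 +_) eq)) ⟩
    c2 (11 + k)
      ≡⟨ lemma₂ k (c2 (9 + k)) ⟩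
    c2 (9 + k) + (19 + k + k) ∎)) (m≤m+n (c2 (9 + k)) 3)
  where
  open ≤-Reasoning

  lemma₁ : ∀ i j → 4 + i + (5 + j) ≡ 9 + (i + j)
  lemma₁ = solve-∀

  lemma₂ : ∀ k q → 10 + k + (9 + k + q) ≡ q + (19 + k + k)
  lemma₂ = solve-∀

  lemma₃ : ∀ i j → 15 + 2 * (i + j) + (5 + (3 * i + 2 * j + i * j)) ≡ (4 + i) * (5 + j)
  lemma₃ = solve-∀

  lemma₄ : ∀ k → 19 + k + k ≡ 15 + 2 * (2 + k)
  lemma₄ = solve-∀

  product : 19 + k + k ≤ (4 + i) * (5 + j)
  product = ≤-trans (≤-reflexive (trans (lemma₄ k) (cong (λ s → 15 + 2 * s) (sym eq))))
    (slack (5 + (3 * i + 2 * j + i * j)) (lemma₃ i j))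

-- Up to t = 5 the bound `cap t` is C(t, 3), which grows differently from the later C(t - 1, 2).
-- Hence 3, 4 and 5 are separate cases.
isolated-star≤ : ∀ w t → 4 ≤ w → 3 ≤ t → c2 w + cap t ≤ cap₂ (suc (w + t))
isolated-star≤ _ t 4≤w 3≤t =
  from≥ 4 (λ w → c2 w + cap t ≤ cap₂ (suc (w + t))) (λ i → from≥ 3 (λ t → c2 (4 + i) + cap t ≤ cap₂ (5 + i + t)) (go i) 3≤t) 4≤w
  where
  shift≤ : ∀ {k} i s → k ≤ cap₂ (5 + s + i) → k ≤ cap₂ (5 + i + s)
  shift≤ {k} i s = subst (λ n → k ≤ cap₂ (5 + n)) (+-comm s i)

  go : ∀ i j → c2 (4 + i) + cap (3 + j) ≤ cap₂ (5 + i + (3 + j))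
  go i 0 = shift≤ i 3 (isolated-star₃≤ i)
  go i 1 = shift≤ i 4 (isolated-star₄≤ i)
  go i 2 = shift≤ i 5 (isolated-star₅≤ i)
  go i (suc (suc (suc j))) = subst (λ n → c2 (4 + i) + c2 (5 + j) ≤ cap₂ n) (lemma i j) (isolated-star₆≤ i j)
    where
    lemma : ∀ i j → 11 + (i + j) ≡ 5 + i + (6 + j)
    lemma = solve-∀

cap₂≤cap : ∀ n → 6 ≤ n → cap₂ n ≤ cap n
cap₂≤cap _ = from≥ 6 (λ n → cap₂ n ≤ cap n) go
  where
  lemma : ∀ k q → q + 3 + (27 + k * 3) ≡ 11 + k + (10 + k + (9 + k + q))
  lemma = solve-∀

  go : ∀ k → cap₂ (6 + k) ≤ cap (6 + k)
  go 0 = at-most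
  go 1 = at-most
  go 2 = at-most
  go 3 = at-most
  go 4 = at-most
  go 5 = at-most
  go 6 = at-most
  go (suc (suc (suc (suc (suc (suc (suc k))))))) = slack (27 + k * 3) (lemma k (c2 (9 + k)))

comet≤cap : ∀ n → 6 ≤ n → 4 + c2 (n ∸ 4) ≤ cap n
comet≤cap _ = from≥ 6 (λ n → 4 + c2 (n ∸ 4) ≤ cap n) (λ k → slack (5 + k * 3) (lemma k (c2 (2 + k))))
  where
  lemma : ∀ k q → 4 + q + (5 + k * 3) ≡ 4 + k + (3 + k + (2 + k + q))
  lemma = solve-∀

-- Isolated stars

infix 4 _∈?_

_∈?_ : ∀ {n} (x : Fin n) xs → Dec (x ∈ xs)
x ∈? xs = Any.any? (x ≟_) xs

unique-⊆⇒length≤ : ∀ {xs ys : List A} → Unique xs → (∀ {x} → x ∈ xs → x ∈ ys) → length xs ≤ length ys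
unique-⊆⇒length≤ {xs = xs} u sub with complement xs u sub
... | zs , p = ≤-trans (m≤m+n (length xs) (length zs)) (≤-reflexive (trans (sym (length-++ xs)) (↭-length p)))

total-complete : ∀ {n} (H : Hyp (Fin n)) {xs} (C : Completion xs) → total H ≡ cnt H (xs ++ Completion.rest C)
total-complete H C = cnt-↭ H (↭-sym (Completion.perm C))

star-bound : ∀ {n} (H : Hyp (Fin n)) → Star H → total H ≤ c2 (n ∸ 1)
star-bound {n} H (c , st) = begin
  total H
    ≡⟨ total-complete H C ⟩
  deg H c rest + cnt H rest
    ≡⟨ cong (deg H c rest +_) (cnt-zero H rest (λ x∈ y∈ z∈ e → avoid x∈ y∈ z∈ (st e))) ⟩
  deg H c rest + 0
    ≡⟨ +-identityʳ (deg H c rest) ⟩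
  deg H c rest
    ≤⟨ deg≤ H c rest ⟩
  c2 (length rest)
    ≡⟨ cong (λ k → c2 (k ∸ 1)) size-rest ⟩
  c2 (n ∸ 1) ∎
  where
  open ≤-Reasoning

  C : Completion (c ∷ [])
  C = complete ([] ∷ [])

  open Completion C

  avoid : ∀ {x y z} → x ∈ rest → y ∈ rest → z ∈ rest → c ∉ x ∷ y ∷ z ∷ []
  avoid x∈ y∈ z∈ (here refl)                 = Unique[x∷xs]⇒x∉xs unique x∈
  avoid x∈ y∈ z∈ (there (here refl))         = Unique[x∷xs]⇒x∉xs unique y∈
  avoid x∈ y∈ z∈ (there (there (here refl))) = Unique[x∷xs]⇒x∉xs unique z∈

comet-bound : ∀ {n} (H : Hyp (Fin n)) → SubComet H → total H ≤ 4 + c2 (n ∸ 4)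
comet-bound {n} H K = begin
  total H
    ≡⟨ total-complete H C ⟩
  cnt H (X ++ rest)
    ≡⟨ cnt-++ H X rest ⟩
  cnt H X + (cross₂ H X rest + (deg H c rest + cross₁ H (a ∷ b ∷ d ∷ []) rest + cnt H rest))
    ≡⟨ cong (cnt H X +_) (cong₂ _+_ (cross₂-zero H X rest pairs) (cong₂ _+_ (cong (deg H c rest +_) (cross₁-zero H (a ∷ b ∷ d ∷ []) rest singles))
         (cnt-zero H rest (λ x∈ y∈ z∈ e → avoid x∈ y∈ z∈ (tail e (tails x∈ ∷ tails y∈ ∷ tails z∈ ∷ [])))))) ⟩
  cnt H X + (deg H c rest + 0 + 0)
    ≤⟨ +-mono-≤ (cnt≤ H X) (≤-trans (≤-reflexive (trans (+-identityʳ _) (+-identityʳ _))) (deg≤ H c rest)) ⟩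
  4 + c2 (length rest)
    ≡⟨ cong (λ k → 4 + c2 (k ∸ 4)) size-rest ⟩
  4 + c2 (n ∸ 4) ∎
  where
  open ≤-Reasoning
  open SubComet K renaming (unique to uniq)

  X : List (Fin n)
  X = c ∷ a ∷ b ∷ d ∷ []

  C : Completion X
  C = complete uniq

  open Completion C

  tails : ∀ {x} → x ∈ rest → x ∉ a ∷ b ∷ d ∷ []
  tails x∈ x∈′ = ++-disjoint X unique (there x∈′) x∈

  pairs : ∀ {x y z} → x ∈ X → y ∈ X → z ∈ rest → ¬ Ed H x y z
  pairs (here refl) (here refl) z∈ e = distinct₁₂ H e refl
  pairs (there x∈)  y∈          z∈ e = ++-disjoint X unique (head x∈ (sw₂₃ H _ _ _ e)) z∈
  pairs x∈          (there y∈)  z∈ e = ++-disjoint X unique (head y∈ (rot H _ _ _ e)) z∈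

  singles : ∀ {x y z} → x ∈ a ∷ b ∷ d ∷ [] → y ∈ rest → z ∈ rest → ¬ Ed H x y z
  singles x∈ y∈ z∈ e = ++-disjoint X unique (head x∈ e) y∈

  avoid : ∀ {x y z} → x ∈ rest → y ∈ rest → z ∈ rest → c ∉ x ∷ y ∷ z ∷ []
  avoid x∈ y∈ z∈ (here refl)                 = ++-disjoint X unique (here refl) x∈
  avoid x∈ y∈ z∈ (there (here refl))         = ++-disjoint X unique (here refl) y∈
  avoid x∈ y∈ z∈ (there (there (here refl))) = ++-disjoint X unique (here refl) z∈

module IsolatedStar {n : ℕ} (H : Hyp (Fin n)) (pf : PathFree H) (tf : TriangleFree H) (cf : ChordFree H) (gf : PageFree H) where

  private
    V : Set
    V = Fin n

  module _ {p q c u v : V} (t : Unique (p ∷ q ∷ c ∷ u ∷ v ∷ [])) (e₁ : Ed H p q c) (e₂ : Ed H c u v) where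

    private
      X : List V
      X = p ∷ q ∷ c ∷ u ∷ v ∷ []

      snoc : ∀ {s} → s ∉ q ∷ u ∷ v ∷ [] → p ≢ s → c ≢ s → Unique (X ++ s ∷ [])
      snoc s∉ p≢s c≢s = Uniq.++⁺ t ([] ∷ []) λ
        { (here refl , here eq)                                 → p≢s eq
        ; (there (here refl) , here eq)                         → s∉ (here (sym eq))
        ; (there (there (here refl)) , here eq)                 → c≢s eq
        ; (there (there (there (here refl))) , here eq)         → s∉ (there (here (sym eq)))
        ; (there (there (there (there (here refl)))) , here eq) → s∉ (there (there (here (sym eq)))) }

      meets : ∀ {r s} → r ∈ q ∷ u ∷ v ∷ [] → c ≢ s → ¬ Ed H p r s
      meets {s = s} r∈ c≢s f with s ∈? (q ∷ u ∷ v ∷ [])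
      meets (here refl) c≢s f | yes (here refl) = distinct₂₃ H f refl
      meets (here refl) c≢s f | yes (there (here refl)) = chord H t cf 0F 1F 2F 3F 4F e₁ f e₂
      meets (here refl) c≢s f | yes (there (there (here refl))) = chord H t cf 0F 1F 2F 4F 3F e₁ f e₂
      meets (there (here refl)) c≢s f | yes (here refl) = chord H t cf 0F 1F 2F 3F 4F e₁ (sw₂₃ H _ _ _ f) e₂
      meets (there (here refl)) c≢s f | yes (there (here refl)) = distinct₂₃ H f refl
      meets (there (here refl)) c≢s f | yes (there (there (here refl))) = chord H t cf 3F 4F 2F 0F 1F e₂ f e₁
      meets (there (there (here refl))) c≢s f | yes (here refl) = chord H t cf 0F 1F 2F 4F 3F e₁ (sw₂₃ H _ _ _ f) e₂
      meets (there (there (here refl))) c≢s f | yes (there (here refl)) = chord H t cf 3F 4F 2F 0F 1F e₂ (sw₂₃ H _ _ _ f) e₁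
      meets (there (there (here refl))) c≢s f | yes (there (there (here refl))) = distinct₂₃ H f refl
      meets (here refl) c≢s f | no s∉ = page H (snoc s∉ (distinct₁₃ H f) c≢s) gf 0F 1F 2F 3F 4F 5F e₁ e₂ f
      meets (there (here refl)) c≢s f | no s∉ = triangle H (snoc s∉ (distinct₁₃ H f) c≢s) tf 2F 0F 3F 5F 4F 1F e₁ e₂ f
      meets (there (there (here refl))) c≢s f | no s∉ = triangle H (snoc s∉ (distinct₁₃ H f) c≢s) tf 2F 0F 4F 5F 3F 1F e₁ e₂ f

    -- An edge at `p` without `c` completes a path if it avoids `q`, `u`, `v`. If it meets them, it
    -- is a chord or a page, or it closes a loose triangle.
    covered : ∀ {r s} → Ed H p r s → c ∈ r ∷ s ∷ []
    covered {r} {s} f with c ≟ r | c ≟ s | r ∈? (q ∷ u ∷ v ∷ []) | s ∈? (q ∷ u ∷ v ∷ [])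
    ... | yes refl | _        | _      | _      = here refl
    ... | no _     | yes refl | _      | _      = there (here refl)
    ... | no _     | no c≢s   | yes r∈ | _      = ⊥-elim (meets r∈ c≢s f)
    ... | no c≢r   | no _     | no _   | yes s∈ = ⊥-elim (meets s∈ c≢r (sw₂₃ H _ _ _ f))
    ... | no c≢r   | no c≢s   | no r∉  | no s∉  = ⊥-elim (path H (uniq₂ X {r ∷ s ∷ []} w (here refl) (there (here refl)) (distinct₂₃ H f)) pf 3F 4F 2F 1F 0F 5F 6F e₂ e₁ f)
      where
      w : Unique (X ++ r ∷ s ∷ [])
      w = Uniq.++⁺ t ((distinct₂₃ H f ∷ []) ∷ [] ∷ []) λ
        { (x∈ , here refl)         → ++-disjoint X (snoc r∉ (distinct₁₂ H f) c≢r) x∈ (here refl)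
        ; (x∈ , there (here refl)) → ++-disjoint X (snoc s∉ (distinct₁₃ H f) c≢s) x∈ (here refl) }

  module _ {a b c d e : V} (t : Unique (a ∷ b ∷ c ∷ d ∷ e ∷ [])) (e₁ : Ed H a b c) (e₂ : Ed H c d e) where

    private
      to-d : a ∷ b ∷ c ∷ d ∷ e ∷ [] ↭ d ∷ e ∷ c ∷ a ∷ b ∷ []
      to-d = ↭-trans (++-comm (a ∷ b ∷ c ∷ []) (d ∷ e ∷ [])) (prep d (prep e (shift c (a ∷ b ∷ []) [])))

    -- An edge cpq with p outside {a, b, d, e} meets abc or cde in c only.
    link-covered : ∀ {p q r s} → Ed H c p q → Ed H p r s → c ∈ r ∷ s ∷ []
    link-covered {p} {q} f g with p ∈? (a ∷ b ∷ d ∷ e ∷ [])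
    ... | yes (here refl) = covered t e₁ e₂ g
    ... | yes (there (here refl)) = covered (Unique-↭ (swap a b refl) t) (sw₁₂ H _ _ _ e₁) e₂ g
    ... | yes (there (there (here refl))) =
      covered (Unique-↭ to-d t) (rot H _ _ _ e₂) (rot H _ _ _ (rot H _ _ _ e₁)) g
    ... | yes (there (there (there (here refl)))) =
      covered (Unique-↭ (↭-trans to-d (swap d e refl)) t) (sw₁₂ H _ _ _ (rot H _ _ _ e₂)) (rot H _ _ _ (rot H _ _ _ e₁)) g
    ... | no p∉ with q ∈? (a ∷ b ∷ [])
    ...   | no q∉ = covered
      (((distinct₂₃ H f ∷ (λ eq → distinct₁₂ H f (sym eq)) ∷ (λ eq → p∉ (here eq)) ∷ (λ eq → p∉ (there (here eq))) ∷ [])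
       ∷ ((λ eq → distinct₁₃ H f (sym eq)) ∷ (λ eq → q∉ (here eq)) ∷ (λ eq → q∉ (there (here eq))) ∷ [])
       ∷ ((λ eq → distinct₁₃ H e₁ (sym eq)) ∷ (λ eq → distinct₂₃ H e₁ (sym eq)) ∷ []) ∷ (distinct₁₂ H e₁ ∷ []) ∷ [] ∷ []))
      (rot H _ _ _ f) (rot H _ _ _ (rot H _ _ _ e₁)) g
    ...   | yes q∈ = covered
      ((distinct₂₃ H f ∷ (λ eq → distinct₁₂ H f (sym eq))
         ∷ (λ eq → p∉ (there (there (here eq)))) ∷ (λ eq → p∉ (there (there (there (here eq))))) ∷ [])
       ∷ ((λ eq → distinct₁₃ H f (sym eq)) ∷ (λ eq → q∉ (here eq)) ∷ (λ eq → q∉ (there (here eq))) ∷ [])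
       ∷ (distinct₁₂ H e₂ ∷ distinct₁₃ H e₂ ∷ []) ∷ (distinct₂₃ H e₂ ∷ []) ∷ [] ∷ [])
      (rot H _ _ _ f) e₂ g
      where
      q∉ : q ∉ d ∷ e ∷ []
      q∉ q∈′ = ++-disjoint (a ∷ b ∷ []) t q∈ (there q∈′)

  private
    links : V → V → Set
    links c p = ∃[ q ] Ed H c p q

    links? : ∀ c p → Dec (links c p)
    links? c p = any? (λ q → T? (E H c p q))

  -- Let `ws` be the neighbours of `c` and `ts` the other vertices besides `c`. Edges that meet `ws`
  -- contain `c` by `link-covered`, and edges at `c` stay in `ws`, so no edge joins the star to
  -- `ts`. If `H` is no star, an edge avoiding `c` lies in `ts`; this is why `ts` has at least three
  -- vertices.
  outcome : ∀ {a b c d e : V} → Unique (a ∷ b ∷ c ∷ d ∷ e ∷ []) → Ed H a b c → Ed H c d e →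
            Star H ⊎ (∃[ w ] ∃[ ts ] 4 ≤ w × 3 ≤ length ts × Unique {A = V} ts × suc (w + length ts) ≡ n
                                      × total H ≤ c2 w + cnt H ts)
  outcome {a} {b} {c} {d} {e} t e₁ e₂ = go (any? (λ x → any? (λ y → any? (λ z → ¬? (c ∈? (x ∷ y ∷ z ∷ [])) ×-dec T? (E H x y z)))))
    where
    C : Completion (c ∷ [])
    C = complete ([] ∷ [])

    open Completion C

    parts : ∃[ ws ] ∃[ ts ] ws ++ ts ↭ rest × All (links c) ws × All (λ p → ¬ links c p) ts
    parts = separate (links? c) rest

    ws ts : List V
    ws = proj₁ parts
    ts = proj₁ (proj₂ parts)

    perm′ : ws ++ ts ↭ rest
    perm′ = proj₁ (proj₂ (proj₂ parts))

    linked : All (links c) ws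
    linked = proj₁ (proj₂ (proj₂ (proj₂ parts)))

    unlinked : All (λ p → ¬ links c p) ts
    unlinked = proj₂ (proj₂ (proj₂ (proj₂ parts)))

    c∉ : c ∉ ws ++ ts
    c∉ c∈ = Unique[x∷xs]⇒x∉xs unique (∈-resp-↭ perm′ c∈)

    u : Unique (ws ++ ts)
    u = Unique-↭ (↭-sym perm′) (Unique-++ʳ (c ∷ []) unique)

    split : ∀ {p} → p ≢ c → p ∈ ws ⊎ p ∈ ts
    split {p} p≢c with mem p
    ... | here p≡c = ⊥-elim (p≢c p≡c)
    ... | there p∈ = ∈-++⁻ ws (∈-resp-↭ (↭-sym perm′) p∈)

    in-ws : ∀ {p q} → Ed H c p q → p ∈ ws
    in-ws f with split (λ eq → distinct₁₂ H f (sym eq))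
    ... | inj₁ p∈ = p∈
    ... | inj₂ p∈ = ⊥-elim (All.lookup unlinked p∈ (_ , f))

    blocked : ∀ {p r s} → p ∈ ws → r ∈ ws ++ ts → s ∈ ws ++ ts → ¬ Ed H p r s
    blocked p∈ r∈ s∈ f with link-covered t e₁ e₂ (proj₂ (All.lookup linked p∈)) f
    ... | here refl         = c∉ r∈
    ... | there (here refl) = c∉ s∈

    unlinked-zero : ∀ {p q} → p ∈ ts → ¬ Ed H c p q
    unlinked-zero p∈ f = All.lookup unlinked p∈ (_ , f)

    order : suc (length ws + length ts) ≡ n
    order = trans (cong suc (trans (sym (length-++ ws)) (↭-length perm′))) size-rest

    4≤w : 4 ≤ length ws
    4≤w = unique-⊆⇒length≤ {xs = a ∷ b ∷ d ∷ e ∷ []} (Unique-++ʳ (c ∷ []) (Unique-↭ (shift c (a ∷ b ∷ []) (d ∷ e ∷ [])) t)) λ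
      { (here refl) → in-ws (rot H _ _ _ (rot H _ _ _ e₁))
      ; (there (here refl)) → in-ws (sw₂₃ H _ _ _ (rot H _ _ _ (rot H _ _ _ e₁)))
      ; (there (there (here refl))) → in-ws e₂
      ; (there (there (there (here refl)))) → in-ws (sw₂₃ H _ _ _ e₂) }

    bound : total H ≤ c2 (length ws) + cnt H ts
    bound = begin
      total H
        ≡⟨ trans (total-complete H C) (cnt-↭ H (prep c (↭-sym perm′))) ⟩
      deg H c (ws ++ ts) + cnt H (ws ++ ts)
        ≡⟨ cong₂ _+_ (deg-++ H c ws ts) (cnt-++ H ws ts) ⟩
      deg H c ws + (codegs H c ws ts + deg H c ts) + (cnt H ws + (cross₂ H ws ts + (cross₁ H ws ts + cnt H ts)))
        ≡⟨ cong₂ _+_ (cong (deg H c ws +_) (cong₂ _+_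
               (codegs-zero H c ws ts (λ _ z∈ f → unlinked-zero z∈ (sw₂₃ H _ _ _ f)))
               (deg-zero H ts (λ y∈ _ → unlinked-zero y∈))))
             (cong₂ _+_ (cnt-zero H ws (λ x∈ y∈ z∈ → blocked x∈ (∈-++⁺ˡ y∈) (∈-++⁺ˡ z∈)))
               (cong₂ _+_ (cross₂-zero H ws ts (λ x∈ y∈ z∈ → blocked x∈ (∈-++⁺ˡ y∈) (∈-++⁺ʳ ws z∈)))
                 (cong (_+ cnt H ts) (cross₁-zero H ws ts (λ x∈ y∈ z∈ → blocked x∈ (∈-++⁺ʳ ws y∈) (∈-++⁺ʳ ws z∈)))))) ⟩
      deg H c ws + 0 + cnt H ts
        ≤⟨ +-monoˡ-≤ (cnt H ts) (≤-trans (≤-reflexive (+-identityʳ _)) (deg≤ H c ws)) ⟩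
      c2 (length ws) + cnt H ts ∎
      where open ≤-Reasoning

    go : Dec (∃[ x ] ∃[ y ] ∃[ z ] c ∉ x ∷ y ∷ z ∷ [] × Ed H x y z) →
         Star H ⊎ (∃[ w ] ∃[ ts ] 4 ≤ w × 3 ≤ length ts × Unique {A = V} ts × suc (w + length ts) ≡ n
                                      × total H ≤ c2 w + cnt H ts)
    go (no ¬out) = inj₁ (c , λ {x} {y} {z} f → decidable-stable (c ∈? (x ∷ y ∷ z ∷ [])) (λ c∉ → ¬out (x , y , z , c∉ , f)))
    go (yes (x , y , z , c∉xyz , f)) = inj₂ (length ws , ts , 4≤w ,
      unique-⊆⇒length≤ (edge-unique H f) outside , Unique-++ʳ ws u , order , bound)
      where
      x≢ : x ≢ c
      x≢ eq = c∉xyz (here (sym eq))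

      y≢ : y ≢ c
      y≢ eq = c∉xyz (there (here (sym eq)))

      z≢ : z ≢ c
      z≢ eq = c∉xyz (there (there (here (sym eq))))

      any-ts : ∀ {p q r} → p ≢ c → q ≢ c → r ≢ c → Ed H p q r → p ∈ ts
      any-ts p≢ q≢ r≢ g with split p≢
      ... | inj₂ p∈ = p∈
      ... | inj₁ p∈ with link-covered t e₁ e₂ (proj₂ (All.lookup linked p∈)) g
      ...   | here eq         = ⊥-elim (q≢ (sym eq))
      ...   | there (here eq) = ⊥-elim (r≢ (sym eq))

      outside : ∀ {p} → p ∈ x ∷ y ∷ z ∷ [] → p ∈ ts
      outside (here refl)                 = any-ts x≢ y≢ z≢ f
      outside (there (here refl))         = any-ts y≢ x≢ z≢ (sw₁₂ H _ _ _ f)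
      outside (there (there (here refl))) = any-ts z≢ x≢ y≢ (rot H _ _ _ (rot H _ _ _ f))

-- Classification without loose triangles

data Shape {n} (H : Hyp (Fin n)) : Set where
  star  : Star H → Shape H
  comet : SubComet H → Shape H
  small : total H ≤ cap₂ n → Shape H

Classified : ℕ → Set
Classified n = 6 ≤ n → (H : Hyp (Fin n)) → PathFree H → TriangleFree H → Shape H

star≡cap : ∀ n → 6 ≤ n → c2 (n ∸ 1) ≡ cap n
star≡cap _ = from≥ 6 (λ n → c2 (n ∸ 1) ≡ cap n) (λ _ → refl)

shape⇒cap : ∀ {n} (H : Hyp (Fin n)) → 6 ≤ n → Shape H → total H ≤ cap n
shape⇒cap H 6≤n (star st) = ≤-trans (star-bound H st) (≤-reflexive (star≡cap _ 6≤n))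
shape⇒cap H 6≤n (comet K) = ≤-trans (comet-bound H K) (comet≤cap _ 6≤n)
shape⇒cap H 6≤n (small s) = ≤-trans s (cap₂≤cap _ 6≤n)

c3≤cap : ∀ n → ¬ 6 ≤ n → c3 n ≤ cap n
c3≤cap 0 _ = at-most
c3≤cap 1 _ = at-most
c3≤cap 2 _ = at-most
c3≤cap 3 _ = at-most
c3≤cap 4 _ = at-most
c3≤cap 5 _ = at-most
c3≤cap (suc (suc (suc (suc (suc (suc n)))))) ¬6≤ = ⊥-elim (¬6≤ (m≤m+n 6 n))

cnt≤cap : {H : Hyp A} → PathFree H → TriangleFree H → ∀ {xs} → Unique xs → Classified (length xs) →
          cnt H xs ≤ cap (length xs)
cnt≤cap {H = H} pf tf {xs} u classify with 6 ≤? length xs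
... | yes 6≤ = subst (_≤ cap (length xs)) (total-induced H xs) (shape⇒cap (induced H xs) 6≤
                 (classify 6≤ (induced H xs) (induced-pathFree {H = H} u pf) (induced-triangleFree {H = H} u tf)))
... | no ¬6≤ = ≤-trans (cnt≤ H xs) (c3≤cap (length xs) ¬6≤)

module PageCase {n : ℕ} (H : Hyp (Fin n)) (pf : PathFree H) (tf : TriangleFree H) (cf : ChordFree H)
                (classify : ∀ {m} → m < n → Classified m) where

  private
    V : Set
    V = Fin n

  module Finish {a b c d e x : V} {rest : List V} (p : a ∷ b ∷ c ∷ d ∷ e ∷ x ∷ rest ↭ allFin n)
                (e₁ : Ed H a b c) (e₂ : Ed H c d e) (e₃ : Ed H a b x) where

    u : Unique (a ∷ b ∷ c ∷ d ∷ e ∷ x ∷ rest)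
    u = Unique-↭ (↭-sym p) (Uniq.allFin⁺ n)

    open PageState H pf tf cf u e₁ e₂ e₃

    -- The pair `ab` has one outer page or several. The case of several pages with both `acd` and
    -- `ace`, or both `bcd` and `bce`, is missing here: `page-case` turns it into `single` with `cd`
    -- in the role of `ab`.
    data Mode : Set where
      single : (∀ {y} → y ∈ rest → ¬ Ed H a b y) → Mode
      multi  : (∃[ y ] y ∈ rest × Ed H a b y) → ¬ (Ed H a c d × Ed H a c e) → ¬ (Ed H b c d × Ed H b c e) → Mode

    order : 6 + length rest ≡ n
    order = trans (↭-length p) (length-tabulate id)

    -- A common bound for both modes, so that most later estimates need not distinguish them.
    loss : Mode → ∀ k → 5 ≤ k → 3 + length rest ≤ k → total H ≤ k + cnt H O
    loss (single s)    k 5≤k _    = ≤-trans (≤-reflexive (cnt-↭ H (↭-sym p)))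
      (≤-trans (single-bound s) (+-monoˡ-≤ (cnt H O) 5≤k))
    loss (multi m ¬a ¬b) k _ r≤k = ≤-trans (≤-reflexive (cnt-↭ H (↭-sym p)))
      (≤-trans (multi-bound m ¬a ¬b) (+-monoˡ-≤ (cnt H O) r≤k))

    fits : ∀ {r} → length rest ≡ r → total H ≤ cap₂ (6 + r) → Shape H
    fits refl = small ∘ subst (λ k → total H ≤ cap₂ k) order

    unique-O : Unique O
    unique-O = Unique-++ʳ (a ∷ b ∷ []) u

    mem : ∀ v → v ∈ a ∷ b ∷ O
    mem v = ∈-resp-↭ (↭-sym p) (∈-allFin v)

    StarAt : V → Set
    StarAt v = ∀ {x y z} → x ∈ O → y ∈ O → z ∈ O → Ed H x y z → v ∈ x ∷ y ∷ z ∷ []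

    centre : ∀ {v} → StarAt v → v ∈ c ∷ d ∷ e ∷ []
    centre st = st (here refl) (there (here refl)) (there (there (here refl))) e₂

    -- The head is `c`, `a`, `b`, `x`. By `no-a`, `no-b` and the missing crossings, `a` and `b` lie
    -- in no edge that leaves it, and `x` has none because the edges on `O` contain `c` and by
    -- `pages-isolated` none of these contains `x`.
    sub-comet : StarAt c → (∀ {y} → y ∈ rest → ¬ Ed H a b y) →
                ¬ (Ed H a c d ⊎ Ed H a c e ⊎ Ed H b c d ⊎ Ed H b c e) → SubComet H
    sub-comet st one ¬cross = record
      { unique = Unique-↭ (shift c (a ∷ b ∷ []) (x ∷ [])) (Unique-++ˡ (a ∷ b ∷ c ∷ x ∷ [])
          (Unique-↭ (++⁺ˡ (a ∷ b ∷ c ∷ []) (shift x (d ∷ e ∷ []) rest)) u))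
      ; head = head
      ; tail = λ { f (x∉ ∷ y∉ ∷ z∉ ∷ []) → st (in-O x∉) (in-O y∉) (in-O z∉) f }
      }
      where
      in-O : ∀ {v} → v ∉ a ∷ b ∷ x ∷ [] → v ∈ O
      in-O {v} v∉ with mem v
      ... | here eq          = ⊥-elim (v∉ (here eq))
      ... | there (here eq)  = ⊥-elim (v∉ (there (here eq)))
      ... | there (there v∈) = v∈

      D : List V
      D = d ∷ e ∷ rest

      widen : ∀ {v} → v ∈ D → v ∈ d ∷ e ∷ x ∷ rest
      widen (here eq)          = here eq
      widen (there (here eq))  = there (here eq)
      widen (there (there v∈)) = there (there (there v∈))

      kinds : ∀ v → v ∈ c ∷ a ∷ b ∷ x ∷ [] ⊎ v ∈ D
      kinds v with mem v
      ... | here eq                                           = inj₁ (there (here eq))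
      ... | there (here eq)                                   = inj₁ (there (there (here eq)))
      ... | there (there (here eq))                           = inj₁ (here eq)
      ... | there (there (there (here eq)))                   = inj₂ (here eq)
      ... | there (there (there (there (here eq))))           = inj₂ (there (here eq))
      ... | there (there (there (there (there (here eq)))))   = inj₁ (there (there (there (here eq))))
      ... | there (there (there (there (there (there v∈))))) = inj₂ (there (there v∈))

      ¬aby : ∀ {y} → y ∈ D → ¬ Ed H a b y
      ¬aby (here refl)         = ¬abd
      ¬aby (there (here refl)) = ¬abe
      ¬aby (there (there y∈))  = one y∈

      ¬acy : ∀ {y} → y ∈ D → ¬ Ed H a c y
      ¬acy (here refl)         f = ¬cross (inj₁ f)
      ¬acy (there (here refl)) f = ¬cross (inj₂ (inj₁ f))
      ¬acy (there (there y∈))    = no-ac y∈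

      ¬bcy : ∀ {y} → y ∈ D → ¬ Ed H b c y
      ¬bcy (here refl)         f = ¬cross (inj₂ (inj₂ (inj₁ f)))
      ¬bcy (there (here refl)) f = ¬cross (inj₂ (inj₂ (inj₂ f)))
      ¬bcy (there (there y∈))    = no-bc y∈

      c∉ : c ∉ d ∷ e ∷ x ∷ rest
      c∉ = ++-disjoint (a ∷ b ∷ c ∷ []) u (there (there (here refl)))

      ¬head : ∀ {v y z} → v ∈ a ∷ b ∷ x ∷ [] → y ∈ D → z ∈ a ∷ b ∷ O → ¬ Ed H v y z
      ¬head (here refl) y∈ (here refl)                     f = distinct₁₃ H f refl
      ¬head (here refl) y∈ (there (here refl))             f = ¬aby y∈ (sw₂₃ H _ _ _ f)
      ¬head (here refl) y∈ (there (there (here refl)))     f = ¬acy y∈ (sw₂₃ H _ _ _ f)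
      ¬head (here refl) y∈ (there (there (there z∈)))      f = no-a (widen y∈) z∈ f
      ¬head (there (here refl)) y∈ (here refl)                 f = ¬aby y∈ (sw₁₂ H _ _ _ (sw₂₃ H _ _ _ f))
      ¬head (there (here refl)) y∈ (there (here refl))         f = distinct₁₃ H f refl
      ¬head (there (here refl)) y∈ (there (there (here refl))) f = ¬bcy y∈ (sw₂₃ H _ _ _ f)
      ¬head (there (here refl)) y∈ (there (there (there z∈)))  f = no-b (widen y∈) z∈ f
      ¬head (there (there (here refl))) y∈ (here refl) f =
        no-a (there (there (here refl))) (widen y∈) (rot H _ _ _ (rot H _ _ _ f))
      ¬head (there (there (here refl))) y∈ (there (here refl)) f =
        no-b (there (there (here refl))) (widen y∈) (rot H _ _ _ (rot H _ _ _ f))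
      ¬head (there (there (here refl))) y∈ (there (there (here refl))) f =
        pages-isolated y∈ (rot H _ _ _ (rot H _ _ _ f))
      ¬head (there (there (here refl))) y∈ (there (there (there z∈))) f
        with st (there (there (there (here refl)))) (there (widen y∈)) (there z∈) f
      ... | here refl                 = c∉ (there (there (here refl)))
      ... | there (here refl)         = c∉ (widen y∈)
      ... | there (there (here refl)) = c∉ z∈

      head : ∀ {v y z} → v ∈ a ∷ b ∷ x ∷ [] → Ed H v y z → y ∈ c ∷ a ∷ b ∷ x ∷ []
      head {y = y} {z} v∈ f with kinds y
      ... | inj₁ y∈ = y∈
      ... | inj₂ y∈ = ⊥-elim (¬head v∈ y∈ (mem z) f)

    star-c : Mode → StarAt c → ∀ r → length rest ≡ 2 + r → Shape H
    star-c m@(multi (y , y∈ , f) _ _) st r len with pull y∈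
    ... | ys , q = fits len (≤-trans (loss m (5 + r) (m≤m+n 5 r) (≤-reflexive (cong (3 +_) len)))
          (≤-trans (+-monoʳ-≤ (5 + r) (subst (λ k → cnt H O ≤ c2 (2 + k)) (suc-injective (trans (↭-length q) len))
             (CentreC.multi-star st q f ¬cy))) (page-multi≤ r)))
      where
      -- The pages `x` and `y` are interchangeable. With their roles exchanged, `pages-isolated`
      -- applies to `y`.
      u′ : Unique (a ∷ b ∷ c ∷ d ∷ e ∷ y ∷ x ∷ ys)
      u′ = Unique-↭ (++⁺ˡ (a ∷ b ∷ c ∷ d ∷ e ∷ []) (↭-trans (prep x (↭-sym q)) (swap x y ↭-refl))) u

      ¬cy : ∀ {z} → z ∈ d ∷ e ∷ ys → ¬ Ed H c y z
      ¬cy (here eq)          = PageState.pages-isolated H pf tf cf u′ e₁ e₂ f (here eq)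
      ¬cy (there (here eq))  = PageState.pages-isolated H pf tf cf u′ e₁ e₂ f (there (here eq))
      ¬cy (there (there z∈)) = PageState.pages-isolated H pf tf cf u′ e₁ e₂ f (there (there (there z∈)))
    star-c m@(single one) st r len with T? (E H a c d) ⊎-dec T? (E H a c e) ⊎-dec T? (E H b c d) ⊎-dec T? (E H b c e)
    ... | no ¬cross = comet (sub-comet st one ¬cross)
    ... | yes cross = fits len (begin
      total H
        ≡⟨ cnt-↭ H (↭-sym p) ⟩
      cnt H (a ∷ b ∷ O)
        ≤⟨ single-bound one ⟩
      5 + cnt H O
        ≤⟨ +-monoʳ-≤ 5 (crossing-star st cross) ⟩
      7 + length rest
        ≡⟨ cong (7 +_) len ⟩
      9 + r
        ≤⟨ page-crossing≤ r ⟩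
      cap₂ (8 + r) ∎)
      where open ≤-Reasoning

    leaf : Mode → ∀ r → length rest ≡ 2 + r → cnt H O ≤ 3 + length rest * 2 → Shape H
    leaf m r len h = fits len (≤-trans (loss m (5 + r) (m≤m+n 5 r) (≤-reflexive (cong (3 +_) len)))
      (≤-trans (+-monoʳ-≤ (5 + r) (≤-trans h (≤-reflexive (cong (λ k → 3 + k * 2) len)))) (page-leaf≤ r)))

    swap-de : O ↭ c ∷ e ∷ d ∷ x ∷ rest
    swap-de = prep c (swap d e ↭-refl)

    u-de : Unique (a ∷ b ∷ c ∷ e ∷ d ∷ x ∷ rest)
    u-de = Unique-↭ (prep a (prep b swap-de)) u

    -- Here `O` has at least six vertices, so the induction hypothesis applies. If it yields a star,
    -- the centre lies in `cde`, since that is an edge; a centre other than `c` leaves only linearly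
    -- many edges.
    big : Mode → ∀ r → length rest ≡ 2 + r → Shape H
    big m r len with classify (subst (length O <_) order (s≤s (n≤1+n (length O))))
                       (subst (6 ≤_) (cong (4 +_) (sym len)) (m≤m+n 6 r))
                       (induced H O) (induced-pathFree {H = H} unique-O pf) (induced-triangleFree {H = H} unique-O tf)
    ... | small s = fits len (≤-trans (loss m (5 + r) (m≤m+n 5 r) (≤-reflexive (cong (3 +_) len)))
          (≤-trans (+-monoʳ-≤ (5 + r) (subst₂ (λ k l → k ≤ cap₂ (4 + l)) (total-induced H O) len s)) (page-small≤ r)))
    ... | comet K = fits len (≤-trans (loss m (5 + r) (m≤m+n 5 r) (≤-reflexive (cong (3 +_) len)))
          (≤-trans (+-monoʳ-≤ (5 + r) (subst₂ (λ k l → k ≤ 4 + c2 l) (total-induced H O) len (comet-bound (induced H O) K)))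
            (page-comet≤ r)))
    ... | star st with star-induced H O st
    ...   | v , _ , st′ with centre st′
    ...     | here refl                 = star-c m st′ r len
    ...     | there (here refl)         = leaf m r len (centre-d st′)
    ...     | there (there (here refl)) = leaf m r len (≤-trans (≤-reflexive (cnt-↭ H swap-de))
                (PageState.centre-d H pf tf cf u-de e₁ (sw₂₃ H _ _ _ e₂) e₃ (λ x∈ y∈ z∈ → st′ (back x∈) (back y∈) (back z∈))))
      where
      back : ∀ {v} → v ∈ c ∷ e ∷ d ∷ x ∷ rest → v ∈ O
      back = ∈-resp-↭ (↭-sym swap-de)

    finish : Mode → ∀ rs → rest ≡ rs → Shape H
    -- For n = 6 four vertices remain, and 5 + C(4, 3) = 9 is below `cap₂ 6`.
    finish m [] refl = fits refl (≤-trans (loss m 5 at-most at-most) (≤-trans (+-monoʳ-≤ 5 (cnt≤ H O)) at-most))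
    finish m (y ∷ []) refl = fits refl (≤-trans (loss m 5 at-most at-most) (+-monoʳ-≤ 5 five≤9))
    finish m (y ∷ z ∷ rs) refl = big m (length rs) refl

  page-case : ∀ {a b c d e x : V} → Unique (a ∷ b ∷ c ∷ d ∷ e ∷ x ∷ []) → Ed H a b c → Ed H c d e → Ed H a b x → Shape H
  page-case {a} {b} {c} {d} {e} {x} t e₁ e₂ e₃ = go (separate (λ y → T? (E H a b y)) rest)
    where
    open Completion (complete t)
    open Finish perm e₁ e₂ e₃ using (single; multi; finish)

    turn : ∀ {a b : V} → c ∷ d ∷ a ∷ b ∷ x ∷ e ∷ rest ↭ a ∷ b ∷ c ∷ d ∷ e ∷ x ∷ rest
    turn {a} {b} = ↭-trans (++⁺ʳ (x ∷ e ∷ rest) (++-comm (c ∷ d ∷ []) (a ∷ b ∷ [])))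
                           (++⁺ˡ (a ∷ b ∷ c ∷ d ∷ []) (swap x e ↭-refl))

    go : (∃[ ys ] ∃[ zs ] ys ++ zs ↭ rest × All (λ y → Ed H a b y) ys × All (λ y → ¬ Ed H a b y) zs) → Shape H
    go ([] , zs , q , _ , ¬page) = finish (single (λ y∈ → All.lookup ¬page (∈-resp-↭ (↭-sym q) y∈))) rest refl
    go (y ∷ ys , zs , q , f ∷ _ , _) with T? (E H a c d) ×-dec T? (E H a c e) | T? (E H b c d) ×-dec T? (E H b c e)
    ... | no ¬a | no ¬b = finish (multi (y , ∈-resp-↭ q (here refl) , f) ¬a ¬b) rest refl
    -- The configuration is rooted anew at `cd`, with edges `cda` and `abx` meeting in `a` and page
    -- `cde`. In this reading `ace` plays the part of `acx`, so `cd` has no further page.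
    ... | yes (acd , ace) | _ = Finish.finish π e₁′ e₃ e₂
          (Finish.single (PageState.acx⇒single H pf tf cf (Finish.u π e₁′ e₃ e₂) e₁′ e₃ e₂ (sw₁₂ H _ _ _ ace))) rest refl
      where
      π : c ∷ d ∷ a ∷ b ∷ x ∷ e ∷ rest ↭ allFin n
      π = ↭-trans turn perm

      e₁′ : Ed H c d a
      e₁′ = rot H _ _ _ acd
    ... | no _ | yes (bcd , bce) = Finish.finish π e₁′ e₃′ e₂
          (Finish.single (PageState.acx⇒single H pf tf cf (Finish.u π e₁′ e₃′ e₂) e₁′ e₃′ e₂ (sw₁₂ H _ _ _ bce))) rest refl
      where
      π : c ∷ d ∷ b ∷ a ∷ x ∷ e ∷ rest ↭ allFin n
      π = ↭-trans turn (↭-trans (swap b a ↭-refl) perm)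

      e₁′ : Ed H c d b
      e₁′ = rot H _ _ _ bcd

      e₃′ : Ed H b a x
      e₃′ = sw₁₂ H _ _ _ e₃

any₅? : ∀ {n} {P : Fin n → Fin n → Fin n → Fin n → Fin n → Set} → (∀ a b c d e → Dec (P a b c d e)) →
        Dec (∃[ a ] ∃[ b ] ∃[ c ] ∃[ d ] ∃[ e ] P a b c d e)
any₅? P? = any? λ a → any? λ b → any? λ c → any? λ d → any? λ e → P? a b c d e

classify-step : ∀ n → (∀ {m} → m < n → Classified m) → Classified n
classify-step n rec 6≤n H pf tf
  with any₅? (λ a b c d e → unique? _≟_ (a ∷ b ∷ c ∷ d ∷ e ∷ []) ×-dec T? (E H a b c) ×-dec T? (E H a b d) ×-dec T? (E H c d e))
... | yes (a , b , c , d , e , t , e₁ , e₂ , e₃) = small (from outcome)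
  where
  open Completion (complete t)
  open ChordCase H pf tf unique e₁ e₂ e₃ using (X; Outcome; apart; sided; booked; outcome)

  fits : ∀ k → 5 + k ≡ n → total H ≤ cap₂ (5 + k) → total H ≤ cap₂ n
  fits k eq = subst (λ n → total H ≤ cap₂ n) eq

  total≡ : total H ≡ cnt H (X ++ rest)
  total≡ = total-complete H (complete t)

  u : Unique rest
  u = Unique-++ʳ X unique

  rest<n : length rest < n
  rest<n = subst (length rest <_) size-rest (m≤n+m (suc (length rest)) 4)

  from : Outcome → total H ≤ cap₂ n
  from (apart h) with length rest in eq | size-rest
  ... | zero  | 5≡n  = ⊥-elim (<-irrefl 5≡n 6≤n)
  ... | suc m | s≡n = fits (suc m) s≡n (begin
    total H               ≡⟨ total≡ ⟩
    cnt H (X ++ rest)     ≤⟨ h ⟩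
    10 + cnt H rest       ≤⟨ +-monoʳ-≤ 10 (cnt≤cap {H = H} pf tf u (rec rest<n)) ⟩
    10 + cap (length rest) ≡⟨ cong (λ k → 10 + cap k) eq ⟩
    10 + cap (1 + m)      ≤⟨ chord-apart≤ m ⟩
    cap₂ (6 + m)          ∎)
    where open ≤-Reasoning
  from (sided ys v eq h) = fits (suc (length ys)) (trans (cong (5 +_) eq) size-rest) (begin
    total H                                ≡⟨ total≡ ⟩
    cnt H (X ++ rest)                      ≤⟨ h ⟩
    8 + length ys * 2 + cnt H ys           ≤⟨ +-monoʳ-≤ (8 + length ys * 2) (cnt≤cap {H = H} pf tf v (rec ys<n)) ⟩
    8 + length ys * 2 + cap (length ys)    ≤⟨ chord-sided≤ (length ys) ⟩
    cap₂ (6 + length ys)                   ∎)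
    where
    open ≤-Reasoning

    ys<n : length ys < n
    ys<n = ≤-trans (≤-reflexive eq) (≤-trans (n≤1+n _) rest<n)
  from (booked k eq h) = fits (suc k) (trans (cong (5 +_) eq) size-rest) (begin
    total H                       ≡⟨ total≡ ⟩
    cnt H (X ++ rest)             ≤⟨ h ⟩
    8 + k + cnt H rest            ≤⟨ +-monoʳ-≤ (8 + k) (cnt≤cap {H = H} pf tf u (rec rest<n)) ⟩
    8 + k + cap (length rest)     ≡⟨ cong (λ l → 8 + k + cap l) (sym eq) ⟩
    8 + k + cap (1 + k)           ≤⟨ chord-booked≤ k ⟩
    cap₂ (6 + k)                  ∎)
    where open ≤-Reasoning
... | no ¬chord
  with any? (λ x → any₅? (λ a b c d e → unique? _≟_ (a ∷ b ∷ c ∷ d ∷ e ∷ x ∷ []) ×-dec T? (E H a b c) ×-dec T? (E H c d e) ×-dec T? (E H a b x)))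
... | yes (x , a , b , c , d , e , t , e₁ , e₂ , e₃) = PageCase.page-case H pf tf cf rec t e₁ e₂ e₃
  where
  cf : ChordFree H
  cf t e₁ e₂ e₃ = ¬chord (_ , _ , _ , _ , _ , t , e₁ , e₂ , e₃)
... | no ¬page with any₅? (λ a b c d e → unique? _≟_ (a ∷ b ∷ c ∷ d ∷ e ∷ []) ×-dec T? (E H a b c) ×-dec T? (E H c d e))
-- No two edges meet in exactly one vertex; the recursion of `capᶜ` is applied to the list of all
-- vertices.
... | no ¬cherry = small (≤-trans
    (subst (λ k → total H ≤ capᶜ k) length-n (Cherryless.cnt≤capᶜ H mf _ (allFin n) ≤-refl (Uniq.allFin⁺ n)))
    (capᶜ≤cap₂ n 6≤n))
  where
  length-n : length (allFin n) ≡ n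
  length-n = length-tabulate id

  mf : CherryFree H
  mf t e₁ e₂ = ¬cherry (_ , _ , _ , _ , _ , t , e₁ , e₂)
... | yes (a , b , c , d , e , t , e₁ , e₂) with IsolatedStar.outcome H pf tf
  (λ t e₁ e₂ e₃ → ¬chord (_ , _ , _ , _ , _ , t , e₁ , e₂ , e₃))
  (λ t e₁ e₂ e₃ → ¬page (_ , _ , _ , _ , _ , _ , t , e₁ , e₂ , e₃)) t e₁ e₂
...   | inj₁ st = star st
...   | inj₂ (w , ts , 4≤w , 3≤t , u , eq , h) = small (begin
    total H                    ≤⟨ h ⟩
    c2 w + cnt H ts            ≤⟨ +-monoʳ-≤ (c2 w) (cnt≤cap {H = H} pf tf u (rec (subst (length ts <_) eq (s≤s (m≤n+m _ w))))) ⟩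
    c2 w + cap (length ts)     ≤⟨ isolated-star≤ w (length ts) 4≤w 3≤t ⟩
    cap₂ (suc (w + length ts)) ≡⟨ cong cap₂ eq ⟩
    cap₂ n                     ∎)
    where open ≤-Reasoning

classify : ∀ n → Classified n
classify = <-rec Classified classify-step

-- Path-free three-graphs

-- The number of edges of a path-free 3-graph is at most capᴾ, …
capᴾ : ℕ → ℕ
capᴾ 7 = 20
capᴾ (suc (suc (suc (suc (suc (suc (suc (suc n)))))))) = c2 (7 + n)
capᴾ n = c3 n

-- … and at most capᴾ₂ unless it is a star, is contained in a comet, or splits.
capᴾ₂ : ℕ → ℕ
capᴾ₂ 7  = 14
capᴾ₂ 8  = 19
capᴾ₂ 9  = 20
capᴾ₂ 10 = 23
capᴾ₂ 11 = 29
capᴾ₂ 12 = 39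
capᴾ₂ (suc (suc (suc (suc (suc (suc (suc (suc (suc (suc (suc (suc (suc n))))))))))))) = c2 (9 + n) + 3
capᴾ₂ n = c3 n

c2-growth₀ : ∀ a → a * 3 ≤ c2 (2 + a)
c2-growth₀ 0 = at-most
c2-growth₀ 1 = at-most
c2-growth₀ (suc (suc a)) = ≤-trans (+-mono-≤ (m≤m+n 3 a) (c2-growth₀ (suc a))) ≤-refl

-- For fixed a + b, exchanging an attached vertex, worth 3, for an unattached one raises C(1 + b, 2)
-- by 1 + b, which is at least 3 as soon as b ≥ 2. The constant 6 absorbs smaller values of b.
c2-growth : ∀ a b → 3 + a * 3 + c2 (1 + b) ≤ 6 + c2 (suc a + b)
c2-growth zero    b = +-monoˡ-≤ (c2 (1 + b)) (m≤m+n 3 3)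
c2-growth (suc a) zero rewrite +-identityʳ a | +-identityʳ (a * 3) = +-monoʳ-≤ 6 (c2-growth₀ a)
c2-growth (suc a) (suc zero) rewrite +-comm a 1 | +-comm (a * 3) 1 =
  +-monoʳ-≤ 6 (+-mono-≤ {1} {2 + a} (s≤s z≤n) (c2-growth₀ a))
c2-growth (suc a) (suc (suc b)) = begin
  3 + (3 + a * 3) + c2 (3 + b)
    ≤⟨ slack b (lemma a b (c2 (3 + b))) ⟩
  3 + a * 3 + c2 (4 + b)
    ≤⟨ c2-growth a (3 + b) ⟩
  6 + c2 (suc a + (3 + b))
    ≡⟨ cong (λ k → 6 + c2 (suc k)) (+-suc a (2 + b)) ⟩
  6 + c2 (suc (suc a) + (2 + b)) ∎
  where
  open ≤-Reasoning

  lemma : ∀ a b q → 3 + (3 + a * 3) + q + b ≡ 3 + a * 3 + (3 + b + q)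
  lemma = solve-∀

-- A uniform, generous bound that swallows the exceptional small values such as 20 at 7.
capᴾ≤c2 : ∀ b → capᴾ b ≤ c2 (1 + b)
capᴾ≤c2 0 = at-most
capᴾ≤c2 1 = at-most
capᴾ≤c2 2 = at-most
capᴾ≤c2 3 = at-most
capᴾ≤c2 4 = at-most
capᴾ≤c2 5 = at-most
capᴾ≤c2 6 = at-most
capᴾ≤c2 7 = at-most
capᴾ≤c2 (suc (suc (suc (suc (suc (suc (suc (suc b)))))))) = ≤-trans (m≤n+m _ (7 + b)) (m≤n+m _ (8 + b))

-- For n ≥ 13 the worst split of a + b is governed by `c2-growth`. For smaller n the bound is
-- tabulated and finitely many pairs remain.
joined≤ : ∀ a b → 14 + a * 3 + capᴾ b ≤ capᴾ₂ (7 + (a + b))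
joined≤ a b with 6 ≤? a + b
... | no small-sum = subst₂ (λ a b → 14 + a * 3 + capᴾ b ≤ capᴾ₂ (7 + (a + b)))
    (toℕ-fromℕ< a<6) (toℕ-fromℕ< b<6) (checked (Fin.fromℕ< a<6) (Fin.fromℕ< b<6))
  where
  a<6 : a < 6
  a<6 = ≤-trans (s≤s (m≤m+n a b)) (≰⇒> small-sum)

  b<6 : b < 6
  b<6 = ≤-trans (s≤s (m≤n+m b a)) (≰⇒> small-sum)

  -- All 36 pairs are evaluated, more than those with sum at most 5 that are needed.
  checked : ∀ (i j : Fin 6) → 14 + toℕ i * 3 + capᴾ (toℕ j) ≤ capᴾ₂ (7 + (toℕ i + toℕ j))
  checked = toWitness {a? = all? λ i → all? λ j → 14 + toℕ i * 3 + capᴾ (toℕ j) ≤? capᴾ₂ (7 + (toℕ i + toℕ j))} tt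
... | yes 6≤a+b = begin
  14 + a * 3 + capᴾ b
    ≤⟨ +-monoʳ-≤ (14 + a * 3) (capᴾ≤c2 b) ⟩
  11 + (3 + a * 3 + c2 (1 + b))
    ≤⟨ +-monoʳ-≤ 11 (c2-growth a b) ⟩
  17 + c2 (suc (a + b))
    ≡⟨ cong (λ s → 17 + c2 (suc s)) (sym sum) ⟩
  17 + c2 (7 + k)
    ≤⟨ slack (1 + k * 2) (lemma k (c2 (7 + k))) ⟩
  capᴾ₂ (13 + k)
    ≡⟨ cong (λ s → capᴾ₂ (7 + s)) sum ⟩
  capᴾ₂ (7 + (a + b)) ∎
  where
  open ≤-Reasoning

  k : ℕ
  k = a + b ∸ 6

  sum : 6 + k ≡ a + b
  sum = m+[n∸m]≡n 6≤a+b

  lemma : ∀ k q → 17 + q + (1 + k * 2) ≡ 8 + k + (7 + k + q) + 3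
  lemma = solve-∀

cap₂≤capᴾ₂ : ∀ n → 7 ≤ n → cap₂ n ≤ capᴾ₂ n
cap₂≤capᴾ₂ _ = from≥ 7 (λ n → cap₂ n ≤ capᴾ₂ n) go
  where
  go : ∀ n → cap₂ (7 + n) ≤ capᴾ₂ (7 + n)
  go 0 = at-most
  go 1 = at-most
  go 2 = at-most
  go 3 = at-most
  go 4 = at-most
  go 5 = at-most
  go (suc (suc (suc (suc (suc (suc n)))))) = ≤-refl

-- Six vertices that no edge leaves. They need not form a clique; equality in the edge count forces
-- that later.
record Split {A : Set} (H : Hyp A) : Set where
  field
    {u₁ u₂ u₃ u₄ u₅ u₆} : A
    unique : Unique (u₁ ∷ u₂ ∷ u₃ ∷ u₄ ∷ u₅ ∷ u₆ ∷ [])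

  U : List A
  U = u₁ ∷ u₂ ∷ u₃ ∷ u₄ ∷ u₅ ∷ u₆ ∷ []

  field
    closed : ∀ {x y z} → x ∈ U → Ed H x y z → y ∈ U

data Shapeᴾ {n} (H : Hyp (Fin n)) : Set where
  star  : Star H → Shapeᴾ H
  comet : SubComet H → Shapeᴾ H
  split : Split H → Shapeᴾ H
  small : total H ≤ capᴾ₂ n → Shapeᴾ H

Bounded : ℕ → Set
Bounded n = (H : Hyp (Fin n)) → PathFree H → total H ≤ capᴾ n

cnt≤capᴾ : {H : Hyp A} → PathFree H → ∀ {xs} → Unique xs → Bounded (length xs) → cnt H xs ≤ capᴾ (length xs)
cnt≤capᴾ {H = H} pf {xs} u bounded =
  subst (_≤ capᴾ (length xs)) (total-induced H xs) (bounded (induced H xs) (induced-pathFree {H = H} u pf))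

-- The `joined` case needs the first-order bound for fewer vertices, and that bound follows from the
-- shapes. It is therefore a hypothesis here, discharged by the induction in `bounded`.
shapeᴾ : ∀ n → (∀ {m} → m < n → Bounded m) → 7 ≤ n → (H : Hyp (Fin n)) → PathFree H → Shapeᴾ H
shapeᴾ n rec 7≤n H pf
  with any? (λ x₁ → any₅? (λ x₂ x₃ y₁ y₂ y₃ → unique? _≟_ (x₁ ∷ x₂ ∷ x₃ ∷ y₁ ∷ y₂ ∷ y₃ ∷ []) ×-dec
               T? (E H x₁ x₂ y₃) ×-dec T? (E H x₁ x₃ y₂) ×-dec T? (E H x₂ x₃ y₁)))
... | no ¬triangle = from (classify n (≤-trans (n≤1+n 6) 7≤n) H pf
        (λ t e₁ e₂ e₃ → ¬triangle (_ , _ , _ , _ , _ , _ , t , e₁ , e₂ , e₃)))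
  where
  from : Shape H → Shapeᴾ H
  from (star st) = star st
  from (comet K) = comet K
  from (small h) = small (≤-trans h (cap₂≤capᴾ₂ n 7≤n))
... | yes (x₁ , x₂ , x₃ , y₁ , y₂ , y₃ , t , e₁ , e₂ , e₃) = from outcome
  where
  open Completion (complete t)
  open TriangleCase H pf unique e₁ e₂ e₃ using (U; Outcome; apart; joined; outcome; detached; no-single)

  from : Outcome → Shapeᴾ H
  from (apart ¬att) = split (record { unique = t ; closed = closed })
    where
    closed : ∀ {x y z} → x ∈ U → Ed H x y z → y ∈ U
    closed {x} {y} {z} x∈ e with ∈-++⁻ U (mem y) | ∈-++⁻ U (mem z)
    ... | inj₁ y∈ | _       = y∈
    ... | inj₂ y∈ | inj₁ z∈ = ⊥-elim (detached y∈ (¬att y∈) x∈ z∈ (sw₂₃ H _ _ _ e))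
    ... | inj₂ y∈ | inj₂ z∈ = ⊥-elim (no-single x∈ y∈ z∈ e)
  from (joined a bs u eq h) = small (begin
    total H                     ≡⟨ total-complete H (complete t) ⟩
    cnt H (U ++ rest)           ≤⟨ h ⟩
    14 + a * 3 + cnt H bs       ≤⟨ +-monoʳ-≤ (14 + a * 3) (cnt≤capᴾ {H = H} pf u (rec bs<n)) ⟩
    14 + a * 3 + capᴾ (length bs) ≤⟨ joined≤ a (length bs) ⟩
    capᴾ₂ (7 + (a + length bs)) ≡⟨ cong capᴾ₂ order ⟩
    capᴾ₂ n                     ∎)
    where
    open ≤-Reasoning

    order : 7 + (a + length bs) ≡ n
    order = trans (cong (6 +_) eq) size-rest

    bs<n : length bs < n
    bs<n = subst (length bs <_) order (s≤s (≤-trans (m≤n+m (length bs) a) (m≤n+m _ 6)))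

module _ {n : ℕ} {H : Hyp (Fin n)} (S : Split H) where
  open Split S

  completion : Completion U
  completion = complete unique

  split-total : total H ≡ cnt H U + cnt H (Completion.rest completion)
  split-total rewrite total-complete H completion | cnt-++ H U (Completion.rest completion)
    | cross₂-zero H U (Completion.rest completion) (λ x∈ _ z∈ e → ++-disjoint U (Completion.unique completion) (closed x∈ (sw₂₃ H _ _ _ e)) z∈)
    | cross₁-zero H U (Completion.rest completion) (λ x∈ y∈ _ e → ++-disjoint U (Completion.unique completion) (closed x∈ e) y∈) = refl

split-cap : ∀ m → 1 ≤ m → 20 + capᴾ m ≤ capᴾ (6 + m)
split-cap (suc m) _ = go m
  where
  go : ∀ m → 20 + capᴾ (1 + m) ≤ capᴾ (7 + m)
  go 0 = at-most
  go 1 = at-most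
  go 2 = at-most
  go 3 = at-most
  go 4 = at-most
  go 5 = at-most
  go 6 = at-most
  go (suc (suc (suc (suc (suc (suc (suc k))))))) = slack (37 + k * 6) (lemma k (c2 (7 + k)))
    where
    lemma : ∀ k q → 20 + q + (37 + k * 6) ≡ 12 + k + (11 + k + (10 + k + (9 + k + (8 + k + (7 + k + q)))))
    lemma = solve-∀

star≤capᴾ : ∀ n → 7 ≤ n → c2 (n ∸ 1) ≤ capᴾ n
star≤capᴾ _ = from≥ 7 (λ n → c2 (n ∸ 1) ≤ capᴾ n) λ { zero → at-most ; (suc _) → ≤-refl }

capᴾ₂≤capᴾ : ∀ n → capᴾ₂ n ≤ capᴾ n
capᴾ₂≤capᴾ 0  = at-most
capᴾ₂≤capᴾ 1  = at-most
capᴾ₂≤capᴾ 2  = at-most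
capᴾ₂≤capᴾ 3  = at-most
capᴾ₂≤capᴾ 4  = at-most
capᴾ₂≤capᴾ 5  = at-most
capᴾ₂≤capᴾ 6  = at-most
capᴾ₂≤capᴾ 7  = at-most
capᴾ₂≤capᴾ 8  = at-most
capᴾ₂≤capᴾ 9  = at-most
capᴾ₂≤capᴾ 10 = at-most
capᴾ₂≤capᴾ 11 = at-most
capᴾ₂≤capᴾ 12 = at-most
capᴾ₂≤capᴾ n@(suc (suc (suc (suc (suc (suc (suc (suc (suc (suc (suc (suc (suc _))))))))))))) = cap₂≤cap n (m≤m+n 6 _)

bounded : ∀ n → Bounded n
bounded = <-rec Bounded step
  where
  step : ∀ n → (∀ {m} → m < n → Bounded m) → Bounded n
  step n rec H pf with 7 ≤? n
  ... | no ¬7≤ = ≤-trans (cnt≤ H (allFin n)) (subst (λ k → c3 k ≤ capᴾ n) (sym length-n) (tiny n (≰⇒> ¬7≤)))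
    where
    length-n : length (allFin n) ≡ n
    length-n = length-tabulate id

    tiny : ∀ n → n < 7 → c3 n ≤ capᴾ n
    tiny 0 _ = at-most
    tiny 1 _ = at-most
    tiny 2 _ = at-most
    tiny 3 _ = at-most
    tiny 4 _ = at-most
    tiny 5 _ = at-most
    tiny 6 _ = at-most
    tiny (suc (suc (suc (suc (suc (suc (suc n))))))) (s≤s (s≤s (s≤s (s≤s (s≤s (s≤s (s≤s ())))))))
  ... | yes 7≤n with shapeᴾ n rec 7≤n H pf
  ...   | star st = ≤-trans (star-bound H st) (star≤capᴾ n 7≤n)
  ...   | comet K = ≤-trans (comet-bound H K) (≤-trans (comet≤cap n (≤-trans (n≤1+n 6) 7≤n)) (cap≤capᴾ n 7≤n))
    where
    cap≤capᴾ : ∀ n → 7 ≤ n → cap n ≤ capᴾ n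
    cap≤capᴾ n 7≤n = ≤-trans (≤-reflexive (sym (star≡cap n (≤-trans (n≤1+n 6) 7≤n)))) (star≤capᴾ n 7≤n)
  ...   | small h = ≤-trans h (capᴾ₂≤capᴾ n)
  ...   | split S = begin
    total H                    ≡⟨ split-total S ⟩
    cnt H (Split.U S) + cnt H rest ≤⟨ +-mono-≤ (cnt≤ H (Split.U S)) (cnt≤capᴾ {H = H} pf (Unique-++ʳ (Split.U S) unique) (rec rest<n)) ⟩
    20 + capᴾ (length rest)    ≤⟨ split-cap (length rest) (+-cancelˡ-≤ 6 1 _ (≤-trans 7≤n (≤-reflexive (sym size-rest)))) ⟩
    capᴾ (6 + length rest)     ≡⟨ cong capᴾ size-rest ⟩
    capᴾ n                     ∎
    where
    open ≤-Reasoning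
    open Completion (completion S)

    rest<n : length rest < n
    rest<n = subst (length rest <_) size-rest (m≤n+m (suc (length rest)) 5)

shape : ∀ {n} → 7 ≤ n → (H : Hyp (Fin n)) → PathFree H → Shapeᴾ H
shape {n} = shapeᴾ n (λ {m} _ → bounded m)

-- From edge sets to relations

infix 4 _∈ₛ_

_∈ₛ_ : ∀ {n} → Fin n → Subset n → Set
_∈ₛ_ = Subset._∈_

triple : ∀ {n} → Fin n → Fin n → Fin n → Subset n
triple i j k = ⁅ i ⁆ ∪ ⁅ j ⁆ ∪ ⁅ k ⁆

card-insert : ∀ {n} (x : Fin n) q → ¬ x ∈ₛ q → ∣ ⁅ x ⁆ ∪ q ∣ ≡ suc ∣ q ∣
card-insert 0F          (true ∷ q)  x∉ = ⊥-elim (x∉ Vec.here)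
card-insert 0F          (false ∷ q) x∉ = cong (suc ∘ ∣_∣) (∪-identityˡ q)
card-insert (Fin.suc x) (true ∷ q)  x∉ = cong suc (card-insert x q (x∉ ∘ Vec.there))
card-insert (Fin.suc x) (false ∷ q) x∉ = card-insert x q (x∉ ∘ Vec.there)

card-pair : ∀ {n} {i j : Fin n} → i ≢ j → ∣ ⁅ i ⁆ ∪ ⁅ j ⁆ ∣ ≡ 2
card-pair {i = i} {j} i≢j = trans (card-insert i ⁅ j ⁆ (λ i∈ → i≢j (x∈⁅y⁆⇒x≡y j i∈))) (cong suc (∣⁅x⁆∣≡1 j))

card-triple : ∀ {n} {i j k : Fin n} → i ≢ j → i ≢ k → j ≢ k → ∣ triple i j k ∣ ≡ 3
card-triple {i = i} {j} {k} i≢j i≢k j≢k =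
  trans (card-insert i (⁅ j ⁆ ∪ ⁅ k ⁆) λ i∈ → case x∈p∪q⁻ ⁅ j ⁆ ⁅ k ⁆ i∈ of λ
    { (inj₁ i∈j) → i≢j (x∈⁅y⁆⇒x≡y j i∈j) ; (inj₂ i∈k) → i≢k (x∈⁅y⁆⇒x≡y k i∈k) }) (cong suc (card-pair j≢k))

triple-swap₁₂ : ∀ {n} (i j k : Fin n) → triple i j k ≡ triple j i k
triple-swap₁₂ i j k = begin
  ⁅ i ⁆ ∪ ⁅ j ⁆ ∪ ⁅ k ⁆     ≡⟨ sym (∪-assoc ⁅ i ⁆ ⁅ j ⁆ ⁅ k ⁆) ⟩
  (⁅ i ⁆ ∪ ⁅ j ⁆) ∪ ⁅ k ⁆   ≡⟨ cong (_∪ ⁅ k ⁆) (∪-comm ⁅ i ⁆ ⁅ j ⁆) ⟩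
  (⁅ j ⁆ ∪ ⁅ i ⁆) ∪ ⁅ k ⁆   ≡⟨ ∪-assoc ⁅ j ⁆ ⁅ i ⁆ ⁅ k ⁆ ⟩
  ⁅ j ⁆ ∪ ⁅ i ⁆ ∪ ⁅ k ⁆     ∎
  where open ≡-Reasoning

triple-irr : ∀ {n} (i k : Fin n) → ∣ triple i i k ∣ ≢ 3
triple-irr i k eq with i ≟ k
... | yes refl = case trans (sym eq) (trans (cong ∣_∣ (trans (cong (⁅ i ⁆ ∪_) (∪-idem ⁅ i ⁆)) (∪-idem ⁅ i ⁆))) (∣⁅x⁆∣≡1 i)) of λ ()
... | no i≢k   = case trans (sym eq) (trans (cong ∣_∣ (trans (sym (∪-assoc ⁅ i ⁆ ⁅ i ⁆ ⁅ k ⁆)) (cong (_∪ ⁅ k ⁆) (∪-idem ⁅ i ⁆)))) (card-pair i≢k)) of λ ()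

T-false : ∀ {b} → ¬ T b → b ≡ false
T-false {true}  ¬t = ⊥-elim (¬t tt)
T-false {false} _  = refl

T-ext : ∀ {a b} → (T a → T b) → (T b → T a) → a ≡ b
T-ext {true}  {true}  _ _ = refl
T-ext {true}  {false} f _ = ⊥-elim (f tt)
T-ext {false} {true}  _ g = ⊥-elim (g tt)
T-ext {false} {false} _ _ = refl

hyp : ∀ {n} → ThreeGraph n → Hyp (Fin n)
hyp G = record
  { E      = λ i j k → edge G (triple i j k)
  ; swap₁₂ = λ i j k → cong (edge G) (triple-swap₁₂ i j k)
  ; swap₂₃ = λ i j k → cong (λ p → edge G (⁅ i ⁆ ∪ p)) (∪-comm ⁅ j ⁆ ⁅ k ⁆)
  ; irr    = λ i k → T-false (λ t → triple-irr i k (uniform G (triple i i k) t))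
  }

card-suc : ∀ {n m} (p : Subset n) → ∣ p ∣ ≡ suc m → ∃[ i ] ∃[ q ] p ≡ ⁅ i ⁆ ∪ q × ∣ q ∣ ≡ m
card-suc (true ∷ p)  eq = 0F , false ∷ p , cong (true ∷_) (sym (∪-identityˡ p)) , suc-injective eq
card-suc (false ∷ p) eq with card-suc p eq
... | i , q , refl , eq′ = Fin.suc i , false ∷ q , refl , eq′

card-zero : ∀ {n} (p : Subset n) → ∣ p ∣ ≡ 0 → p ≡ ∅
card-zero []          _  = refl
card-zero (false ∷ p) eq = cong (false ∷_) (card-zero p eq)

card-three : ∀ {n} (p : Subset n) → ∣ p ∣ ≡ 3 → ∃[ i ] ∃[ j ] ∃[ k ] p ≡ triple i j k
card-three p eq with card-suc p eq
... | i , q , refl , eq′ with card-suc q eq′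
...   | j , r , refl , eq″ with card-suc r eq″
...     | k , s , refl , eq‴ = i , j , k ,
  cong (λ z → ⁅ i ⁆ ∪ ⁅ j ⁆ ∪ z) (trans (cong (⁅ k ⁆ ∪_) (card-zero s eq‴)) (∪-identityʳ ⁅ k ⁆))

-- Sizes as sums over triples

sum₁ : (A → Bool) → List A → ℕ
sum₁ f []       = 0
sum₁ f (x ∷ xs) = bit (f x) + sum₁ f xs

sum₂ : (A → A → Bool) → List A → ℕ
sum₂ f []       = 0
sum₂ f (x ∷ xs) = sum₁ (f x) xs + sum₂ f xs

sum₃ : (A → A → A → Bool) → List A → ℕ
sum₃ f []       = 0
sum₃ f (x ∷ xs) = sum₂ (f x) xs + sum₃ f xs

sum₁-map : (f : B → Bool) (φ : A → B) → ∀ xs → sum₁ f (map φ xs) ≡ sum₁ (f ∘ φ) xs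
sum₁-map f φ []       = refl
sum₁-map f φ (x ∷ xs) = cong (bit (f (φ x)) +_) (sum₁-map f φ xs)

sum₂-map : (f : B → B → Bool) (φ : A → B) → ∀ xs → sum₂ f (map φ xs) ≡ sum₂ (λ x y → f (φ x) (φ y)) xs
sum₂-map f φ []       = refl
sum₂-map f φ (x ∷ xs) = cong₂ _+_ (sum₁-map (f (φ x)) φ xs) (sum₂-map f φ xs)

sum₃-map : (f : B → B → B → Bool) (φ : A → B) → ∀ xs → sum₃ f (map φ xs) ≡ sum₃ (λ x y z → f (φ x) (φ y) (φ z)) xs
sum₃-map f φ []       = refl
sum₃-map f φ (x ∷ xs) = cong₂ _+_ (sum₂-map (f (φ x)) φ xs) (sum₃-map f φ xs)

sum₁-cong : {f g : A → Bool} → (∀ x → f x ≡ g x) → ∀ xs → sum₁ f xs ≡ sum₁ g xs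
sum₁-cong eq []       = refl
sum₁-cong eq (x ∷ xs) = cong₂ _+_ (cong bit (eq x)) (sum₁-cong eq xs)

sum₂-cong : {f g : A → A → Bool} → (∀ x y → f x y ≡ g x y) → ∀ xs → sum₂ f xs ≡ sum₂ g xs
sum₂-cong eq []       = refl
sum₂-cong eq (x ∷ xs) = cong₂ _+_ (sum₁-cong (eq x) xs) (sum₂-cong eq xs)

sum₃-cong : {f g : A → A → A → Bool} → (∀ x y z → f x y z ≡ g x y z) → ∀ xs → sum₃ f xs ≡ sum₃ g xs
sum₃-cong eq []       = refl
sum₃-cong eq (x ∷ xs) = cong₂ _+_ (sum₂-cong (eq x) xs) (sum₃-cong eq xs)

cnt≡sum₃ : (H : Hyp A) → ∀ xs → cnt H xs ≡ sum₃ (E H) xs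
cnt≡sum₃ {A} H []       = refl
cnt≡sum₃ {A} H (x ∷ xs) = cong₂ _+_ (deg≡ xs) (cnt≡sum₃ H xs)
  where
  codeg≡ : ∀ y zs → codeg H x y zs ≡ sum₁ (E H x y) zs
  codeg≡ y []       = refl
  codeg≡ y (z ∷ zs) = cong (bit (E H x y z) +_) (codeg≡ y zs)

  deg≡ : ∀ ys → deg H x ys ≡ sum₂ (E H x) ys
  deg≡ []       = refl
  deg≡ (y ∷ ys) = cong₂ _+_ (codeg≡ y ys) (deg≡ ys)

tabulate-suc : ∀ n → tabulate Fin.suc ≡ map Fin.suc (allFin n)
tabulate-suc n = sym (map-tabulate id Fin.suc)

count₀ : ∀ n (f : Subset n → Bool) → (∀ p → T (f p) → ∣ p ∣ ≡ 0) → countSubsets n f ≡ bit (f ∅)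
count₀ zero    f _ with f []
... | true  = refl
... | false = refl
count₀ (suc n) f h = cong₂ _+_ (empty n (λ p → f (true ∷ p)) (λ p t → case h (true ∷ p) t of λ ()))
                               (count₀ n (λ p → f (false ∷ p)) (λ p → h (false ∷ p)))
  where
  empty : ∀ n (f : Subset n → Bool) → (∀ p → ¬ T (f p)) → countSubsets n f ≡ 0
  empty zero    f h rewrite T-false (h []) = refl
  empty (suc n) f h = cong₂ _+_ (empty n (λ p → f (true ∷ p)) (λ p → h (true ∷ p))) (empty n (λ p → f (false ∷ p)) (λ p → h (false ∷ p)))

count₁ : ∀ n (f : Subset n → Bool) → (∀ p → T (f p) → ∣ p ∣ ≡ 1) → countSubsets n f ≡ sum₁ (λ i → f ⁅ i ⁆) (allFin n)
count₁ zero    f h rewrite T-false (λ t → case h [] t of λ ()) = refl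
count₁ (suc n) f h rewrite tabulate-suc n | sum₁-map (λ i → f ⁅ i ⁆) Fin.suc (allFin n) = cong₂ _+_
  (count₀ n (λ p → f (true ∷ p)) (λ p t → suc-injective (h (true ∷ p) t)))
  (count₁ n (λ p → f (false ∷ p)) (λ p → h (false ∷ p)))

count₂ : ∀ n (f : Subset n → Bool) → (∀ p → T (f p) → ∣ p ∣ ≡ 2) →
         countSubsets n f ≡ sum₂ (λ i j → f (⁅ i ⁆ ∪ ⁅ j ⁆)) (allFin n)
count₂ zero    f h rewrite T-false (λ t → case h [] t of λ ()) = refl
count₂ (suc n) f h rewrite tabulate-suc n | sum₁-map (λ j → f (⁅ 0F ⁆ ∪ ⁅ j ⁆)) Fin.suc (allFin n)
  | sum₂-map (λ i j → f (⁅ i ⁆ ∪ ⁅ j ⁆)) Fin.suc (allFin n) = cong₂ _+_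
  (trans (count₁ n (λ p → f (true ∷ p)) (λ p t → suc-injective (h (true ∷ p) t)))
         (sum₁-cong (λ j → cong (λ p → f (true ∷ p)) (sym (∪-identityˡ ⁅ j ⁆))) (allFin n)))
  (count₂ n (λ p → f (false ∷ p)) (λ p → h (false ∷ p)))

-- Sets that contain the first vertex are counted by `count₂` on the others and give the first row
-- of the sum; sets without it give the remaining rows. This links the recursion over characteristic
-- vectors with the one over vertex lists.
count₃ : ∀ n (f : Subset n → Bool) → (∀ p → T (f p) → ∣ p ∣ ≡ 3) →
         countSubsets n f ≡ sum₃ (λ i j k → f (triple i j k)) (allFin n)
count₃ zero    f h rewrite T-false (λ t → case h [] t of λ ()) = refl
count₃ (suc n) f h rewrite tabulate-suc n | sum₂-map (λ j k → f (triple 0F j k)) Fin.suc (allFin n)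
  | sum₃-map (λ i j k → f (triple i j k)) Fin.suc (allFin n) = cong₂ _+_
  (trans (count₂ n (λ p → f (true ∷ p)) (λ p t → suc-injective (h (true ∷ p) t)))
         (sum₂-cong (λ j k → cong (λ p → f (true ∷ p)) (sym (∪-identityˡ (⁅ j ⁆ ∪ ⁅ k ⁆)))) (allFin n)))
  (count₃ n (λ p → f (false ∷ p)) (λ p → h (false ∷ p)))

size≡total : ∀ {n} (G : ThreeGraph n) → size G ≡ total (hyp G)
size≡total {n} G = trans (count₃ n (edge G) (uniform G)) (sym (cnt≡sum₃ (hyp G) (allFin n)))

-- Images of vertex sets

∪-interchange : ∀ {n} (a b c d : Subset n) → (a ∪ b) ∪ (c ∪ d) ≡ (a ∪ c) ∪ (b ∪ d)
∪-interchange a b c d = begin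
  (a ∪ b) ∪ (c ∪ d)  ≡⟨ ∪-assoc a b (c ∪ d) ⟩
  a ∪ (b ∪ (c ∪ d))  ≡⟨ cong (a ∪_) (sym (∪-assoc b c d)) ⟩
  a ∪ ((b ∪ c) ∪ d)  ≡⟨ cong (λ z → a ∪ (z ∪ d)) (∪-comm b c) ⟩
  a ∪ ((c ∪ b) ∪ d)  ≡⟨ cong (a ∪_) (∪-assoc c b d) ⟩
  a ∪ (c ∪ (b ∪ d))  ≡⟨ sym (∪-assoc a c (b ∪ d)) ⟩
  (a ∪ c) ∪ (b ∪ d)  ∎
  where open ≡-Reasoning

image-∪ : ∀ {m n} (f : Fin m → Fin n) → ∀ p q → image f (p ∪ q) ≡ image f p ∪ image f q
image-∪ f []          []          = sym (∪-idem ∅)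
image-∪ f (true ∷ p)  (true ∷ q)  rewrite image-∪ (f ∘ Fin.suc) p q =
  trans (cong (_∪ (image (f ∘ Fin.suc) p ∪ image (f ∘ Fin.suc) q)) (sym (∪-idem ⁅ f 0F ⁆))) (∪-interchange ⁅ f 0F ⁆ ⁅ f 0F ⁆ _ _)
image-∪ f (true ∷ p)  (false ∷ q) rewrite image-∪ (f ∘ Fin.suc) p q = sym (∪-assoc ⁅ f 0F ⁆ _ _)
image-∪ f (false ∷ p) (true ∷ q)  rewrite image-∪ (f ∘ Fin.suc) p q = begin
  ⁅ f 0F ⁆ ∪ (P′ ∪ Q′)  ≡⟨ sym (∪-assoc ⁅ f 0F ⁆ P′ Q′) ⟩
  (⁅ f 0F ⁆ ∪ P′) ∪ Q′  ≡⟨ cong (_∪ Q′) (∪-comm ⁅ f 0F ⁆ P′) ⟩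
  (P′ ∪ ⁅ f 0F ⁆) ∪ Q′  ≡⟨ ∪-assoc P′ ⁅ f 0F ⁆ Q′ ⟩
  P′ ∪ (⁅ f 0F ⁆ ∪ Q′)  ∎
  where
  open ≡-Reasoning
  P′ = image (f ∘ Fin.suc) p
  Q′ = image (f ∘ Fin.suc) q
image-∪ f (false ∷ p) (false ∷ q) = image-∪ (f ∘ Fin.suc) p q

image-∅ : ∀ {m n} (f : Fin m → Fin n) → image f ∅ ≡ ∅
image-∅ {zero}  f = refl
image-∅ {suc m} f = image-∅ (f ∘ Fin.suc)

image-⁅⁆ : ∀ {m n} (f : Fin m → Fin n) i → image f ⁅ i ⁆ ≡ ⁅ f i ⁆
image-⁅⁆ f 0F          = trans (cong (⁅ f 0F ⁆ ∪_) (image-∅ (f ∘ Fin.suc))) (∪-identityʳ ⁅ f 0F ⁆)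
image-⁅⁆ f (Fin.suc i) = image-⁅⁆ (f ∘ Fin.suc) i

image-triple : ∀ {m n} (f : Fin m → Fin n) i j k → image f (triple i j k) ≡ triple (f i) (f j) (f k)
image-triple f i j k = trans (image-∪ f ⁅ i ⁆ (⁅ j ⁆ ∪ ⁅ k ⁆))
  (cong₂ _∪_ (image-⁅⁆ f i) (trans (image-∪ f ⁅ j ⁆ ⁅ k ⁆) (cong₂ _∪_ (image-⁅⁆ f j) (image-⁅⁆ f k))))

image-∘ : ∀ {l m n} (g : Fin m → Fin n) (f : Fin l → Fin m) → ∀ p → image g (image f p) ≡ image (g ∘ f) p
image-∘ g f []          = image-∅ g
image-∘ g f (true ∷ p)  = trans (image-∪ g ⁅ f 0F ⁆ (image (f ∘ Fin.suc) p)) (cong₂ _∪_ (image-⁅⁆ g (f 0F)) (image-∘ g (f ∘ Fin.suc) p))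
image-∘ g f (false ∷ p) = image-∘ g (f ∘ Fin.suc) p

image-cong : ∀ {m n} {f g : Fin m → Fin n} → (∀ i → f i ≡ g i) → ∀ p → image f p ≡ image g p
image-cong eq []          = refl
image-cong eq (true ∷ p)  = cong₂ _∪_ (cong ⁅_⁆ (eq 0F)) (image-cong (eq ∘ Fin.suc) p)
image-cong eq (false ∷ p) = image-cong (eq ∘ Fin.suc) p

image-suc : ∀ {m n} (f : Fin m → Fin n) p → image (Fin.suc ∘ f) p ≡ false ∷ image f p
image-suc f []          = refl
image-suc f (true ∷ p)  = cong ((false ∷ ⁅ f 0F ⁆) ∪_) (image-suc (f ∘ Fin.suc) p)
image-suc f (false ∷ p) = image-suc (f ∘ Fin.suc) p

image-id : ∀ {n} (p : Subset n) → image id p ≡ p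
image-id []          = refl
image-id (true ∷ p)  = trans (cong (⁅ 0F ⁆ ∪_) (trans (image-suc id p) (cong (false ∷_) (image-id p))))
                             (cong (true ∷_) (∪-identityˡ p))
image-id (false ∷ p) = trans (image-suc id p) (cong (false ∷_) (image-id p))

T-does : {Q : Set} (d : Dec Q) → T (does d) → Q
T-does (yes q) _ = q

does-T : {Q : Set} (d : Dec Q) → Q → T (does d)
does-T (yes _) _ = tt
does-T (no ¬q) q = ⊥-elim (¬q q)

module _ {n : ℕ} {Q : Subset n → Set} (Q? : ∀ p → Dec (Q p)) where

  triples⇒ : ∀ p → Edge (triples Q?) p → Q p
  triples⇒ p e = T-does (Q? p) (proj₂ (Equivalence.to T-∧ e))

  triples⇐ : ∀ p → ∣ p ∣ ≡ 3 → Q p → Edge (triples Q?) p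
  triples⇐ p c q = Equivalence.from T-∧ (≡⇒≡ᵇ ∣ p ∣ 3 c , does-T (Q? p) q)

Path-Free : ∀ {n} → ThreeGraph n → Set
Path-Free = Free ｛ 7 , P ｝

loosePath : List (Subset 7)
loosePath = triple 0F 1F 2F ∷ triple 2F 3F 4F ∷ triple 4F 5F 6F ∷ []

free⇒pathFree : ∀ {n} (G : ThreeGraph n) → Path-Free G → PathFree (hyp G)
free⇒pathFree {n} G free {a} {b} {c} {d} {e} {f} {g} u p q r = free P refl (φ , lookup-injective u , edges)
  where
  φ : Fin 7 → Fin n
  φ = lookup (a ∷ b ∷ c ∷ d ∷ e ∷ f ∷ g ∷ [])

  edges : ∀ s → Edge P s → Edge G (image φ s)
  edges s t with triples⇒ (λ s → Any.any? (Vec-≡-dec Bool-≟ s) loosePath) s t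
  ... | here refl                 = subst (Edge G) (sym (image-triple φ 0F 1F 2F)) p
  ... | there (here refl)         = subst (Edge G) (sym (image-triple φ 2F 3F 4F)) q
  ... | there (there (here refl)) = subst (Edge G) (sym (image-triple φ 4F 5F 6F)) r

pathFree⇒free : ∀ {n} (G : ThreeGraph n) → PathFree (hyp G) → Path-Free G
pathFree⇒free G pf .P refl (φ , inj , h) = pf (Uniq.map⁺ inj (Uniq.allFin⁺ 7))
  (subst (Edge G) (image-triple φ 0F 1F 2F) (h (triple 0F 1F 2F) tt))
  (subst (Edge G) (image-triple φ 2F 3F 4F) (h (triple 2F 3F 4F) tt))
  (subst (Edge G) (image-triple φ 4F 5F 6F) (h (triple 4F 5F 6F) tt))

-- Containment and full configurations

_⊆ᴱ_ : Hyp A → Hyp A → Set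
H ⊆ᴱ G = ∀ x y z → Ed H x y z → Ed G x y z

module _ {A : Set} {H G : Hyp A} (H⊆G : H ⊆ᴱ G) where

  codeg-mono : ∀ x y zs → codeg H x y zs ≤ codeg G x y zs
  codeg-mono x y []       = z≤n
  codeg-mono x y (z ∷ zs) = +-mono-≤ (bit-mono (H⊆G x y z)) (codeg-mono x y zs)

  deg-mono : ∀ x ys → deg H x ys ≤ deg G x ys
  deg-mono x []       = z≤n
  deg-mono x (y ∷ ys) = +-mono-≤ (codeg-mono x y ys) (deg-mono x ys)

  cnt-mono : ∀ xs → cnt H xs ≤ cnt G xs
  cnt-mono []       = z≤n
  cnt-mono (x ∷ xs) = +-mono-≤ (deg-mono x xs) (cnt-mono xs)

-- If an edge of `G` were missing in `H`, listing its vertices first would make the comparison of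
-- the counts strict. All uniqueness statements come down to this.
squeeze : ∀ {n} {H G : Hyp (Fin n)} → H ⊆ᴱ G → total G ≤ total H → G ⊆ᴱ H
squeeze {n} {H} {G} H⊆G le x y z g with T? (E H x y z)
... | yes h = h
... | no ¬h = ⊥-elim (<-irrefl refl (≤-trans lt (≤-trans (≤-reflexive (sym (total-complete G C))) (≤-trans le (≤-reflexive (total-complete H C))))))
  where
  C : Completion (x ∷ y ∷ z ∷ [])
  C = complete (edge-unique G g)

  open Completion C

  lt : cnt H (x ∷ y ∷ z ∷ rest) < cnt G (x ∷ y ∷ z ∷ rest)
  lt = +-mono-<-≤ (+-mono-<-≤ (+-mono-<-≤ (subst₂ _<_ (sym (bit-zero ¬h)) (sym (bit-one g)) ≤-refl)
    (codeg-mono H⊆G x y rest)) (deg-mono H⊆G x (z ∷ rest))) (cnt-mono H⊆G (y ∷ z ∷ rest))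

module _ {A : Set} (H : Hyp A) where

  codeg-full : ∀ {x y} zs → (∀ {z} → z ∈ zs → Ed H x y z) → codeg H x y zs ≡ length zs
  codeg-full []       _ = refl
  codeg-full (z ∷ zs) h = cong₂ _+_ (bit-one (h (here refl))) (codeg-full zs (h ∘ there))

  deg-full : ∀ {x ys} → Unique ys → (∀ {y z} → y ∈ ys → z ∈ ys → y ≢ z → Ed H x y z) → deg H x ys ≡ c2 (length ys)
  deg-full {ys = []}     _       _ = refl
  deg-full {ys = y ∷ ys} (a ∷ u) h = cong₂ _+_
    (codeg-full ys (λ z∈ → h (here refl) (there z∈) (All.lookup a z∈)))
    (deg-full u (λ y∈ z∈ → h (there y∈) (there z∈)))

  cnt-full : ∀ {xs} → Unique xs → (∀ {x y z} → x ∈ xs → y ∈ xs → z ∈ xs → x ≢ y → x ≢ z → y ≢ z → Ed H x y z) →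
             cnt H xs ≡ c3 (length xs)
  cnt-full {[]}     _       _ = refl
  cnt-full {x ∷ xs} (a ∷ u) h = cong₂ _+_
    (deg-full u (λ y∈ z∈ → h (here refl) (there y∈) (there z∈) (All.lookup a y∈) (All.lookup a z∈)))
    (cnt-full u (λ x∈ y∈ z∈ → h (there x∈) (there y∈) (there z∈)))

-- Isomorphisms

enumeration : ∀ {n} {xs : List (Fin n)} → Unique xs → (∀ v → v ∈ xs) → xs ↭ allFin n
enumeration {xs = xs} u all∈ with complete u
... | record { rest = [] ; perm = p }                  = subst (_↭ allFin _) (++-identityʳ xs) p
... | record { rest = z ∷ _ ; unique = w }             = ⊥-elim (++-disjoint xs w (all∈ z) (here refl))

enumeration′ : ∀ {n} {xs : List (Fin n)} → Unique xs → length xs ≡ n → xs ↭ allFin n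
enumeration′ {n} {xs} u len with complete u
... | C@record { rest = [] ; perm = p } = subst (_↭ allFin _) (++-identityʳ xs) p
... | C@record { rest = z ∷ zs } = ⊥-elim (m≢1+m+n (length xs) (trans len (trans (sym (Completion.size-rest C))
        (trans (length-++ xs) (+-suc (length xs) (length zs))))))

image-inverse : ∀ {m n} (f : Fin m → Fin n) (g : Fin n → Fin m) → (∀ i → g (f i) ≡ i) → ∀ p → image g (image f p) ≡ p
image-inverse f g inv p = trans (image-∘ g f p) (trans (image-cong inv p) (image-id p))

≅-refl : ∀ {n} (G : ThreeGraph n) → G ≅ G
≅-refl G = idₚ , λ e → cong (edge G) (sym (image-id e))

module _ {m n : ℕ} {H : ThreeGraph m} {G : ThreeGraph n} (iso : H ≅ G) where

  private
    to : Fin m → Fin n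
    to = proj₁ iso ⟨$⟩ʳ_

  iso-injective : Injective _≡_ _≡_ to
  iso-injective {i} {j} eq = trans (sym (inverseˡ (proj₁ iso))) (trans (cong (proj₁ iso ⟨$⟩ˡ_) eq) (inverseˡ (proj₁ iso)))

  iso-edge : ∀ i j k → edge H (triple i j k) ≡ edge G (triple (to i) (to j) (to k))
  iso-edge i j k = trans (proj₂ iso (triple i j k)) (cong (edge G) (image-triple to i j k))

  iso-size : size H ≡ size G
  iso-size = begin
    size H                                  ≡⟨ size≡total H ⟩
    total (hyp H)                           ≡⟨ cnt≡sum₃ (hyp H) (allFin m) ⟩
    sum₃ (E (hyp H)) (allFin m)             ≡⟨ sum₃-cong iso-edge (allFin m) ⟩
    sum₃ (E (pullback to (hyp G))) (allFin m) ≡⟨ sym (cnt≡sum₃ (pullback to (hyp G)) (allFin m)) ⟩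
    total (pullback to (hyp G))             ≡⟨ cnt-pullback to (hyp G) (allFin m) ⟩
    cnt (hyp G) (map to (allFin m))         ≡⟨ cnt-↭ (hyp G) (enumeration (Uniq.map⁺ iso-injective (Uniq.allFin⁺ m)) onto) ⟩
    total (hyp G)                           ≡⟨ sym (size≡total G) ⟩
    size G                                  ∎
    where
    open ≡-Reasoning

    onto : ∀ v → v ∈ map to (allFin m)
    onto v = subst (_∈ map to (allFin m)) (inverseʳ (proj₁ iso)) (∈-map⁺ to (∈-allFin (proj₁ iso ⟨$⟩ˡ v)))

  iso-pathFree : PathFree (hyp G) → PathFree (hyp H)
  iso-pathFree pf u p q r = pf (Uniq.map⁺ iso-injective u)
    (subst T (iso-edge _ _ _) p) (subst T (iso-edge _ _ _) q) (subst T (iso-edge _ _ _) r)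

module _ {n : ℕ} (H : ThreeGraph n) {xs : List (Fin n)} (p : xs ↭ allFin n) (G : ThreeGraph (length xs))
         (sub : ∀ i j k → Ed (hyp H) (lookup xs i) (lookup xs j) (lookup xs k) → Ed (hyp G) i j k)
         (le : size G ≤ size H) where

  private
    u : Unique xs
    u = Unique-↭ (↭-sym p) (Uniq.allFin⁺ n)

    mem : ∀ v → v ∈ xs
    mem v = ∈-resp-↭ (↭-sym p) (∈-allFin v)

    to : Fin n → Fin (length xs)
    to v = Any.index (mem v)

    from : Fin (length xs) → Fin n
    from = lookup xs

    from-to : ∀ v → from (to v) ≡ v
    from-to v = sym (lookup-index (mem v))

    to-from : ∀ i → to (from i) ≡ i
    to-from i = lookup-injective u (from-to (from i))

    same : ∀ i j k → Ed (hyp G) i j k → Ed (hyp H) (from i) (from j) (from k)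
    same = squeeze {H = induced (hyp H) xs} {G = hyp G} sub (begin
      total (hyp G)                   ≡⟨ sym (size≡total G) ⟩
      size G                          ≤⟨ le ⟩
      size H                          ≡⟨ size≡total H ⟩
      total (hyp H)                   ≡⟨ cnt-↭ (hyp H) (↭-sym p) ⟩
      cnt (hyp H) xs                  ≡⟨ sym (total-induced (hyp H) xs) ⟩
      total (induced (hyp H) xs)      ∎)
      where open ≤-Reasoning

  -- The structure theorems only show that `H`, relabelled along `xs`, is contained in `G`. Since
  -- `H` is at least as large, `squeeze` gives the reverse inclusion.
  embed⇒iso : H ≅ G
  embed⇒iso = permutation to from to-from from-to , λ e → T-ext (forth e) (back e)
    where
    forth : ∀ e → Edge H e → Edge G (image to e)
    forth e t with card-three e (uniform H e t)
    ... | i , j , k , refl = subst (Edge G) (sym (image-triple to i j k))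
      (sub (to i) (to j) (to k) (subst (Edge H) (sym (cong₂ (λ x q → ⁅ x ⁆ ∪ q) (from-to i) (cong₂ (λ x y → ⁅ x ⁆ ∪ ⁅ y ⁆) (from-to j) (from-to k)))) t))

    back : ∀ e → Edge G (image to e) → Edge H e
    back e t with card-three (image to e) (uniform G (image to e) t)
    ... | i , j , k , eq = subst (Edge H)
      (trans (sym (image-triple from i j k)) (trans (cong (image from) (sym eq)) (image-inverse to from from-to e)))
      (same i j k (subst (Edge G) eq t))

-- The extremal 3-graphs

triple∈⁻ : ∀ {n} {v i j k : Fin n} → v ∈ₛ triple i j k → v ∈ i ∷ j ∷ k ∷ []
triple∈⁻ {i = i} {j} {k} v∈ with x∈p∪q⁻ ⁅ i ⁆ _ v∈
... | inj₁ v∈i = here (x∈⁅y⁆⇒x≡y i v∈i)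
... | inj₂ v∈jk with x∈p∪q⁻ ⁅ j ⁆ _ v∈jk
...   | inj₁ v∈j = there (here (x∈⁅y⁆⇒x≡y j v∈j))
...   | inj₂ v∈k = there (there (here (x∈⁅y⁆⇒x≡y k v∈k)))

triple∈⁺ : ∀ {n} {v i j k : Fin n} → v ∈ i ∷ j ∷ k ∷ [] → v ∈ₛ triple i j k
triple∈⁺ {v = v} (here refl)                 = x∈p∪q⁺ (inj₁ (x∈⁅x⁆ v))
triple∈⁺ {v = v} (there (here refl))         = x∈p∪q⁺ (inj₂ (x∈p∪q⁺ (inj₁ (x∈⁅x⁆ v))))
triple∈⁺ {v = v} (there (there (here refl))) = x∈p∪q⁺ (inj₂ (x∈p∪q⁺ (inj₂ (x∈⁅x⁆ v))))

-- With an arbitrary centre on the given vertex set, so that a star-shaped 3-graph embeds by the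
-- identity map.
starAt : ∀ {n} → Fin n → ThreeGraph n
starAt v = triples (v ∈ₛ?_)

starAt-star : ∀ {n} (v : Fin n) → Star (hyp (starAt v))
starAt-star v = v , λ e → triple∈⁻ (triples⇒ (v ∈ₛ?_) _ e)

-- The outer edges of a path are disjoint, but both would contain the centre.
star-pathFree : {H : Hyp A} → Star H → PathFree H
star-pathFree (v , st) u p _ r = disjoint (Unique-++ˡ (_ ∷ _ ∷ _ ∷ []) u) u (st p) (st r)
  where
  disjoint : ∀ {v a b c d e f g} → Unique (a ∷ b ∷ c ∷ []) → Unique (a ∷ b ∷ c ∷ d ∷ e ∷ f ∷ g ∷ []) →
             v ∈ a ∷ b ∷ c ∷ [] → v ∈ e ∷ f ∷ g ∷ [] → ⊥
  disjoint _ u v∈ v∈′ = ++-disjoint (_ ∷ _ ∷ _ ∷ []) u v∈ (there v∈′)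

starAt-size : ∀ {n} (v : Fin n) → size (starAt v) ≡ c2 (n ∸ 1)
starAt-size {n} v = ≤-antisym (≤-trans (≤-reflexive (size≡total (starAt v))) (star-bound (hyp (starAt v)) (starAt-star v))) (begin
  c2 (n ∸ 1)                  ≡⟨ cong (λ k → c2 (k ∸ 1)) (sym size-rest) ⟩
  c2 (length rest)            ≡⟨ sym (deg-full H (Unique-++ʳ (v ∷ []) unique) full) ⟩
  deg H v rest                ≤⟨ m≤m+n (deg H v rest) (cnt H rest) ⟩
  cnt H (v ∷ rest)            ≡⟨ sym (total-complete H C) ⟩
  total H                     ≡⟨ sym (size≡total (starAt v)) ⟩
  size (starAt v)             ∎)
  where
  open ≤-Reasoning

  H : Hyp (Fin n)
  H = hyp (starAt v)

  C : Completion (v ∷ [])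
  C = complete ([] ∷ [])

  open Completion C

  full : ∀ {y z} → y ∈ rest → z ∈ rest → y ≢ z → Ed H v y z
  full y∈ z∈ y≢z = triples⇐ (v ∈ₛ?_) _
    (card-triple {i = v} (λ { refl → Unique[x∷xs]⇒x∉xs unique y∈ }) (λ { refl → Unique[x∷xs]⇒x∉xs unique z∈ }) y≢z)
    (triple∈⁺ (here refl))

-- The complete 3-graph on all vertices but `v`; for n = 7 this is the first-order extremal 3-graph
-- with any choice of its isolated vertex.
isolatedAt : ∀ {n} → Fin n → ThreeGraph n
isolatedAt v = triples (λ e → ¬? (v ∈ₛ? e))

isolatedAt-size : ∀ {n} (v : Fin n) → c3 (n ∸ 1) ≤ size (isolatedAt v)
isolatedAt-size {n} v = begin
  c3 (n ∸ 1)                  ≡⟨ cong (λ k → c3 (k ∸ 1)) (sym size-rest) ⟩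
  c3 (length rest)            ≡⟨ sym (cnt-full H (Unique-++ʳ (v ∷ []) unique) full) ⟩
  cnt H rest                  ≤⟨ m≤n+m (cnt H rest) (deg H v rest) ⟩
  cnt H (v ∷ rest)            ≡⟨ sym (total-complete H C) ⟩
  total H                     ≡⟨ sym (size≡total (isolatedAt v)) ⟩
  size (isolatedAt v)         ∎
  where
  open ≤-Reasoning

  H : Hyp (Fin n)
  H = hyp (isolatedAt v)

  C : Completion (v ∷ [])
  C = complete ([] ∷ [])

  open Completion C

  full : ∀ {x y z} → x ∈ rest → y ∈ rest → z ∈ rest → x ≢ y → x ≢ z → y ≢ z → Ed H x y z
  full {x} {y} {z} x∈ y∈ z∈ x≢y x≢z y≢z = triples⇐ (λ e → ¬? (v ∈ₛ? e)) _ (card-triple x≢y x≢z y≢z)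
    (λ v∈ → Unique[x∷xs]⇒x∉xs unique (among (triple∈⁻ v∈)))
    where
    among : v ∈ x ∷ y ∷ z ∷ [] → v ∈ rest
    among (here refl)                 = x∈
    among (there (here refl))         = y∈
    among (there (there (here refl))) = z∈

-- A path has seven vertices, so it would cover `v`.
isolated-pathFree : {H : Hyp (Fin 7)} (v : Fin 7) → (∀ {x y z} → Ed H x y z → v ∉ x ∷ y ∷ z ∷ []) → PathFree H
isolated-pathFree {H} v iso {a} {b} {c} {d} {e} {f} {g} u p q r = go (∈-resp-↭ (↭-sym (enumeration′ u refl)) (∈-allFin v))
  where
  go : v ∉ a ∷ b ∷ c ∷ d ∷ e ∷ f ∷ g ∷ []
  go (here eq)                                               = iso p (here eq)
  go (there (here eq))                                       = iso p (there (here eq))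
  go (there (there (here eq)))                               = iso p (there (there (here eq)))
  go (there (there (there (here eq))))                       = iso q (there (here eq))
  go (there (there (there (there (here eq)))))               = iso r (here eq)
  go (there (there (there (there (there (here eq))))))       = iso r (there (here eq))
  go (there (there (there (there (there (there (here eq))))))) = iso r (there (there (here eq)))

-- Two edges of a path span at least five vertices, so at most one lies in the head. The outer edges
-- are disjoint, so they cannot both be tail edges through `c`. What remains is an outer head edge
-- followed by tail edges: it meets the middle edge in `c`, which then also lies in the other outer
-- edge.
comet-pathFree : {H : Hyp (Fin n)} → SubComet H → PathFree H
comet-pathFree {n} {H} K {p} {q} {r} {s} {t} {v} {w} uq e₁ e₂ e₃ =
  go (meets? e₁) (meets? e₂) (meets? e₃)
  where
  open SubComet K

  X hs : List (Fin n)
  X  = c ∷ a ∷ b ∷ d ∷ []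
  hs = a ∷ b ∷ d ∷ []

  Inside : Fin n → Fin n → Fin n → Set
  Inside x y z = ∀ {u} → u ∈ x ∷ y ∷ z ∷ [] → u ∈ X

  meets? : ∀ {x y z} → Ed H x y z → Inside x y z ⊎ (c ∈ x ∷ y ∷ z ∷ [] × All (_∉ hs) (x ∷ y ∷ z ∷ []))
  meets? {x} {y} {z} e with x ∈? hs | y ∈? hs | z ∈? hs
  ... | yes x∈ | _ | _ = inj₁ λ { (here refl) → there x∈ ; (there (here refl)) → head x∈ e
                                ; (there (there (here refl))) → head x∈ (sw₂₃ H _ _ _ e) }
  ... | no _ | yes y∈ | _ = inj₁ λ { (here refl) → head y∈ (sw₁₂ H _ _ _ e) ; (there (here refl)) → there y∈
                                   ; (there (there (here refl))) → head y∈ (rot H _ _ _ e) }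
  ... | no _ | no _ | yes z∈ = inj₁ λ { (here refl) → head z∈ (rot H _ _ _ (rot H _ _ _ e))
                                      ; (there (here refl)) → head z∈ (sw₂₃ H _ _ _ (rot H _ _ _ (rot H _ _ _ e)))
                                      ; (there (there (here refl))) → there z∈ }
  ... | no x∉ | no y∉ | no z∉ = let out = x∉ ∷ y∉ ∷ z∉ ∷ [] in inj₂ (tail e out , out)

  big : ∀ {ys} → Unique ys → 5 ≤ length ys → (∀ {u} → u ∈ ys → u ∈ X) → ⊥
  big uy 5≤ sub = <-irrefl refl (≤-trans 5≤ (unique-⊆⇒length≤ uy sub))

  to-c : ∀ {u} → u ∈ X → u ∉ hs → u ≡ c
  to-c (here eq)  _   = eq
  to-c (there u∈) u∉ = ⊥-elim (u∉ u∈)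

  go : Inside p q r ⊎ (c ∈ p ∷ q ∷ r ∷ [] × All (_∉ hs) (p ∷ q ∷ r ∷ [])) →
       Inside r s t ⊎ (c ∈ r ∷ s ∷ t ∷ [] × All (_∉ hs) (r ∷ s ∷ t ∷ [])) →
       Inside t v w ⊎ (c ∈ t ∷ v ∷ w ∷ [] × All (_∉ hs) (t ∷ v ∷ w ∷ [])) → ⊥
  go (inj₁ i₁) (inj₁ i₂) _ = big (Unique-++ˡ (p ∷ q ∷ r ∷ s ∷ t ∷ []) uq) at-most λ
    { (here refl) → i₁ (here refl) ; (there (here refl)) → i₁ (there (here refl)) ; (there (there u∈)) → i₂ u∈ }
  go _ (inj₁ i₂) (inj₁ i₃) = big (Unique-++ʳ (p ∷ q ∷ []) uq) at-most λ
    { (here refl) → i₂ (here refl) ; (there (here refl)) → i₂ (there (here refl)) ; (there (there u∈)) → i₃ u∈ }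
  go (inj₁ i₁) _ (inj₁ i₃) = big (Unique-++ˡ (p ∷ q ∷ r ∷ t ∷ v ∷ []) (Unique-restrict (p ∷ q ∷ r ∷ []) uq (Unique-++ʳ (p ∷ q ∷ r ∷ s ∷ []) uq) there)) at-most λ
    { (here refl) → i₁ (here refl) ; (there (here refl)) → i₁ (there (here refl)) ; (there (there (here refl))) → i₁ (there (there (here refl)))
    ; (there (there (there (here refl)))) → i₃ (here refl) ; (there (there (there (there (here refl))))) → i₃ (there (here refl)) }
  go (inj₂ (c₁ , _)) _ (inj₂ (c₃ , _)) = ++-disjoint (p ∷ q ∷ r ∷ []) uq c₁ (there c₃)
  go (inj₁ i₁) (inj₂ (_ , r∉ ∷ _)) (inj₂ (c₃ , _)) with to-c (i₁ (there (there (here refl)))) r∉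
  ... | refl = ++-disjoint (p ∷ q ∷ r ∷ []) uq (there (there (here refl))) (there c₃)
  go (inj₂ (c₁ , _)) (inj₂ (_ , _ ∷ _ ∷ t∉ ∷ [])) (inj₁ i₃) with to-c (i₃ (here refl)) t∉
  ... | refl = ++-disjoint (p ∷ q ∷ r ∷ []) uq c₁ (there (here refl))

module _ {H : Hyp (Fin n)} (Sp : Split H) where
  open Split Sp

  private
    closed₁₃ : ∀ {x y z} → x ∈ U → Ed H x y z → z ∈ U
    closed₁₃ x∈ e = closed x∈ (sw₂₃ H _ _ _ e)

  -- A path is connected, so it lies inside a closed set or avoids it; `c` serves as reference
  -- vertex.
  split-path : ∀ {a b c d e f g} → Ed H a b c → Ed H c d e → Ed H e f g → ∀ {v} → v ∈ a ∷ b ∷ c ∷ d ∷ e ∷ f ∷ g ∷ [] →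
               (v ∈ U → c ∈ U) × (c ∈ U → v ∈ U)
  split-path p q r (here refl)                 = (λ v∈ → closed₁₃ v∈ p) , (λ c∈ → closed c∈ (rot H _ _ _ (rot H _ _ _ p)))
  split-path p q r (there (here refl))         = (λ v∈ → closed v∈ (rot H _ _ _ p)) , (λ c∈ → closed₁₃ c∈ (rot H _ _ _ (rot H _ _ _ p)))
  split-path p q r (there (there (here refl))) = id , id
  split-path p q r (there (there (there (here refl)))) = (λ v∈ → closed v∈ (sw₁₂ H _ _ _ q)) , (λ c∈ → closed c∈ q)
  split-path p q r (there (there (there (there (here refl))))) = (λ v∈ → closed v∈ (rot H _ _ _ (rot H _ _ _ q))) , (λ c∈ → closed₁₃ c∈ q)
  split-path p q r (there (there (there (there (there (here refl)))))) =
    (λ v∈ → closed (closed v∈ (sw₁₂ H _ _ _ r)) (rot H _ _ _ (rot H _ _ _ q))) , (λ c∈ → closed (closed₁₃ c∈ q) r)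
  split-path p q r (there (there (there (there (there (there (here refl))))))) =
    (λ v∈ → closed (closed v∈ (rot H _ _ _ (rot H _ _ _ r))) (rot H _ _ _ (rot H _ _ _ q))) , (λ c∈ → closed₁₃ (closed₁₃ c∈ q) r)

  -- A path inside U would need seven vertices.
  split-outside : ∀ {a b c d e f g} → Unique (a ∷ b ∷ c ∷ d ∷ e ∷ f ∷ g ∷ []) → Ed H a b c → Ed H c d e → Ed H e f g →
                  Unique (U ++ a ∷ b ∷ c ∷ d ∷ e ∷ f ∷ g ∷ [])
  split-outside {c = c} u p q r with c ∈? U
  ... | yes c∈ = ⊥-elim (<-irrefl refl (unique-⊆⇒length≤ u (λ v∈ → proj₂ (split-path p q r v∈) c∈)))
  ... | no c∉  = Uniq.++⁺ unique u (λ { (v∈U , v∈) → c∉ (proj₁ (split-path p q r v∈) v∈U) })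

  -- A path would avoid `U`, which requires 6 + 7 = 13 vertices.
  split-pathFree : n ≤ 12 → PathFree H
  split-pathFree n≤12 u p q r = <-irrefl refl (≤-trans
    (≤-trans (unique-⊆⇒length≤ (split-outside u p q r) (λ {v} _ → ∈-allFin v))
      (≤-reflexive (length-tabulate id))) n≤12)

module Comet (k : ℕ) where

  private
    headₛ tailₛ : Subset (4 + k)
    headₛ = Subset.⊤ {4} Vec.++ ∅
    tailₛ = ⁅ 0F ⁆ ∪ (∅ {4} Vec.++ Subset.⊤)

    inner outer : List (Fin (4 + k))
    outer = 1F ∷ 2F ∷ 3F ∷ []
    inner = 0F ∷ outer

    Q? : ∀ e → Dec (e Subset.⊆ headₛ ⊎ (0F ∈ₛ e × e Subset.⊆ tailₛ))
    Q? e = (e ⊆? headₛ) ⊎-dec ((0F ∈ₛ? e) ×-dec (e ⊆? tailₛ))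

    head⁻ : ∀ {v} → v ∈ₛ headₛ → v ∈ inner
    head⁻ {0F} _ = here refl
    head⁻ {1F} _ = there (here refl)
    head⁻ {2F} _ = there (there (here refl))
    head⁻ {3F} _ = there (there (there (here refl)))
    head⁻ {Fin.suc (Fin.suc (Fin.suc (Fin.suc v)))} (Vec.there (Vec.there (Vec.there (Vec.there v∈)))) = ⊥-elim (∉⊥ v∈)

    head⁺ : ∀ {v} → v ∈ inner → v ∈ₛ headₛ
    head⁺ (here refl)                         = Vec.here
    head⁺ (there (here refl))                 = Vec.there Vec.here
    head⁺ (there (there (here refl)))         = Vec.there (Vec.there Vec.here)
    head⁺ (there (there (there (here refl)))) = Vec.there (Vec.there (Vec.there Vec.here))

    tail⁻ : ∀ {v} → v ∈ₛ tailₛ → v ∉ outer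
    tail⁻ (Vec.there ())                         (here refl)
    tail⁻ (Vec.there (Vec.there ()))             (there (here refl))
    tail⁻ (Vec.there (Vec.there (Vec.there ()))) (there (there (here refl)))

    tail⁺ : ∀ {v} → v ∉ outer → v ∈ₛ tailₛ
    tail⁺ {0F} _  = Vec.here
    tail⁺ {1F} v∉ = ⊥-elim (v∉ (here refl))
    tail⁺ {2F} v∉ = ⊥-elim (v∉ (there (here refl)))
    tail⁺ {3F} v∉ = ⊥-elim (v∉ (there (there (here refl))))
    tail⁺ {Fin.suc (Fin.suc (Fin.suc (Fin.suc v)))} _ = Vec.there (Vec.there (Vec.there (Vec.there (x∈p∪q⁺ (inj₂ ∈⊤)))))

  triple-⊆ : ∀ {i j l} {p : Subset (4 + k)} → i ∈ₛ p → j ∈ₛ p → l ∈ₛ p → triple i j l Subset.⊆ p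
  triple-⊆ i∈ j∈ l∈ v∈ with triple∈⁻ v∈
  ... | here refl                 = i∈
  ... | there (here refl)         = j∈
  ... | there (there (here refl)) = l∈

  head-edge : ∀ {i j l} → i ≢ j → i ≢ l → j ≢ l → i ∈ inner → j ∈ inner → l ∈ inner → Ed (hyp (Co (4 + k))) i j l
  head-edge i≢j i≢l j≢l i∈ j∈ l∈ = triples⇐ Q? _ (card-triple i≢j i≢l j≢l) (inj₁ (triple-⊆ (head⁺ i∈) (head⁺ j∈) (head⁺ l∈)))

  tail-edge : ∀ {i j l} → i ≢ j → i ≢ l → j ≢ l → 0F ∈ i ∷ j ∷ l ∷ [] → i ∉ outer → j ∉ outer → l ∉ outer →
              Ed (hyp (Co (4 + k))) i j l
  tail-edge i≢j i≢l j≢l 0∈ i∉ j∉ l∉ = triples⇐ Q? _ (card-triple i≢j i≢l j≢l)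
    (inj₂ (triple∈⁺ 0∈ , triple-⊆ (tail⁺ i∉) (tail⁺ j∉) (tail⁺ l∉)))

  subComet : SubComet (hyp (Co (4 + k)))
  subComet = record
    { unique = ((λ ()) ∷ (λ ()) ∷ (λ ()) ∷ []) ∷ ((λ ()) ∷ (λ ()) ∷ []) ∷ ((λ ()) ∷ []) ∷ [] ∷ []
    ; head   = λ {x} {y} {z} x∈ e → case triples⇒ Q? (triple x y z) e of λ
        { (inj₁ ⊆head)       → head⁻ (⊆head (triple∈⁺ (there (here refl))))
        ; (inj₂ (_ , ⊆tail)) → ⊥-elim (tail⁻ (⊆tail (triple∈⁺ (here refl))) x∈) }
    ; tail   = λ { {x} {y} {z} e (x∉ ∷ _) → case triples⇒ Q? (triple x y z) e of λ
        { (inj₁ ⊆head)    → here (centre (head⁻ (⊆head (triple∈⁺ (here refl)))) x∉)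
        ; (inj₂ (0∈ , _)) → triple∈⁻ 0∈ } }
    }
    where
    centre : ∀ {v} → v ∈ inner → v ∉ outer → 0F ≡ v
    centre (here eq)  _  = sym eq
    centre (there v∈) v∉ = ⊥-elim (v∉ v∈)

  co-size : size (Co (4 + k)) ≡ 4 + c2 k
  co-size = ≤-antisym (≤-trans (≤-reflexive (size≡total (Co (4 + k)))) (comet-bound G subComet)) (begin
    4 + c2 k
      ≡⟨ cong (λ l → 4 + c2 l) (sym length-rest) ⟩
    4 + c2 (length rest)
      ≡⟨ cong₂ _+_ (sym core) (sym (deg-full G (Unique-++ʳ inner (Uniq.allFin⁺ (4 + k))) star-full)) ⟩
    cnt G inner + deg G 0F rest
      ≤⟨ +-monoʳ-≤ (cnt G inner) (≤-trans (m≤m+n (deg G 0F rest) _) (≤-trans (m≤m+n _ (cnt G rest)) (m≤n+m _ (cross₂ G inner rest)))) ⟩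
    cnt G inner + (cross₂ G inner rest + (cross₁ G inner rest + cnt G rest))
      ≡⟨ sym (cnt-++ G inner rest) ⟩
    total G
      ≡⟨ sym (size≡total (Co (4 + k))) ⟩
    size (Co (4 + k)) ∎)
    where
    open ≤-Reasoning

    G : Hyp (Fin (4 + k))
    G = hyp (Co (4 + k))

    rest : List (Fin (4 + k))
    rest = tabulate (4 Fin.↑ʳ_)

    length-rest : length rest ≡ k
    length-rest = length-tabulate {n = k} (4 Fin.↑ʳ_)

    core : cnt G inner ≡ 4
    core = cnt-full G (SubComet.unique subComet) (λ i∈ j∈ l∈ i≢j i≢l j≢l → head-edge i≢j i≢l j≢l i∈ j∈ l∈)

    far : ∀ {v} → v ∈ rest → v ∉ inner
    far v∈ v∈′ = ++-disjoint inner (Uniq.allFin⁺ (4 + k)) v∈′ v∈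

    star-full : ∀ {y z} → y ∈ rest → z ∈ rest → y ≢ z → Ed G 0F y z
    star-full y∈ z∈ y≢z = tail-edge (λ { refl → far y∈ (here refl) }) (λ { refl → far z∈ (here refl) }) y≢z (here refl)
      (λ { (here ()) ; (there (here ())) ; (there (there (here ()))) }) (far y∈ ∘ there) (far z∈ ∘ there)

comet⇒iso : ∀ {n} (H : ThreeGraph n) → SubComet (hyp H) → size (Co n) ≤ size H → H ≅ Co n
-- The comet matching the vertex list has order `4 + length rest`, which equals `n` only
-- propositionally.
comet⇒iso {n} H K le = subst (λ m → H ≅ Co m) size-rest
  (embed⇒iso H perm (Co (4 + length rest)) sub (subst (λ m → size (Co m) ≤ size H) (sym size-rest) le))
  where
  open SubComet K renaming (unique to distinct)
  open Completion (complete distinct)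

  L : List (Fin n)
  L = c ∷ a ∷ b ∷ d ∷ rest

  at : Fin (length L) → Fin n
  at = lookup L

  outer inner : List (Fin (length L))
  outer = 1F ∷ 2F ∷ 3F ∷ []
  inner = 0F ∷ outer

  inj : ∀ {i j} → at i ≡ at j → i ≡ j
  inj = lookup-injective unique

  inner⁻ : ∀ {i} → at i ∈ c ∷ a ∷ b ∷ d ∷ [] → i ∈ inner
  inner⁻ i∈ = Any.map inj (mapped i∈)
    where
    mapped : ∀ {v} → v ∈ c ∷ a ∷ b ∷ d ∷ [] → Any.Any (λ j → v ≡ at j) inner
    mapped (here eq)                         = here eq
    mapped (there (here eq))                 = there (here eq)
    mapped (there (there (here eq)))         = there (there (here eq))
    mapped (there (there (there (here eq)))) = there (there (there (here eq)))

  outer⁻ : ∀ {i} → at i ∈ a ∷ b ∷ d ∷ [] → i ∈ outer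
  outer⁻ (here eq)                 = here (inj eq)
  outer⁻ (there (here eq))         = there (here (inj eq))
  outer⁻ (there (there (here eq))) = there (there (here (inj eq)))

  outer⁺ : ∀ {i} → i ∈ outer → at i ∈ a ∷ b ∷ d ∷ []
  outer⁺ (here refl)                 = here refl
  outer⁺ (there (here refl))         = there (here refl)
  outer⁺ (there (there (here refl))) = there (there (here refl))

  sub : ∀ i j l → Ed (hyp H) (at i) (at j) (at l) → Ed (hyp (Co (4 + length rest))) i j l
  sub i j l e = go (i ∈? outer) (j ∈? outer) (l ∈? outer)
    where
    open Comet (length rest)

    i≢j : i ≢ j
    i≢j = distinct₁₂ (hyp H) e ∘ cong at

    i≢l : i ≢ l
    i≢l = distinct₁₃ (hyp H) e ∘ cong at

    j≢l : j ≢ l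
    j≢l = distinct₂₃ (hyp H) e ∘ cong at

    e₁₃ : Ed (hyp H) (at i) (at l) (at j)
    e₁₃ = sw₂₃ (hyp H) _ _ _ e

    e₂ : Ed (hyp H) (at j) (at i) (at l)
    e₂ = sw₁₂ (hyp H) _ _ _ e

    e₃ : Ed (hyp H) (at l) (at i) (at j)
    e₃ = sw₁₂ (hyp H) _ _ _ e₁₃

    centre : c ∈ at i ∷ at j ∷ at l ∷ [] → 0F ∈ i ∷ j ∷ l ∷ []
    centre (here eq)                 = here (inj eq)
    centre (there (here eq))         = there (here (inj eq))
    centre (there (there (here eq))) = there (there (here (inj eq)))

    go : Dec (i ∈ outer) → Dec (j ∈ outer) → Dec (l ∈ outer) → Ed (hyp (Co (4 + length rest))) i j l
    go (yes i∈) _ _ = head-edge i≢j i≢l j≢l (there i∈) (inner⁻ (head (outer⁺ i∈) e)) (inner⁻ (head (outer⁺ i∈) e₁₃))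
    go _ (yes j∈) _ = head-edge i≢j i≢l j≢l (inner⁻ (head (outer⁺ j∈) e₂)) (there j∈)
      (inner⁻ (head (outer⁺ j∈) (sw₂₃ (hyp H) _ _ _ e₂)))
    go _ _ (yes l∈) = head-edge i≢j i≢l j≢l (inner⁻ (head (outer⁺ l∈) e₃)) (inner⁻ (head (outer⁺ l∈) (sw₂₃ (hyp H) _ _ _ e₃))) (there l∈)
    go (no i∉) (no j∉) (no l∉) = tail-edge i≢j i≢l j≢l
      (centre (tail e ((i∉ ∘ outer⁻) ∷ (j∉ ∘ outer⁻) ∷ (l∉ ∘ outer⁻) ∷ []))) i∉ j∉ l∉

∈-take⁺ : ∀ m {n} {i : Fin m} (e : Subset (m + n)) → i Fin.↑ˡ n ∈ₛ e → i ∈ₛ Vec.take m e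
∈-take⁺ (suc m) {i = 0F}        (x ∷ e) Vec.here       = Vec.here
∈-take⁺ (suc m) {i = Fin.suc i} (x ∷ e) (Vec.there i∈) = Vec.there (∈-take⁺ m e i∈)

∈-drop⁺ : ∀ m {n} {j : Fin n} (e : Subset (m + n)) → m Fin.↑ʳ j ∈ₛ e → j ∈ₛ Vec.drop m e
∈-drop⁺ zero    e       j∈             = j∈
∈-drop⁺ (suc m) (x ∷ e) (Vec.there j∈) = ∈-drop⁺ m e j∈

∈-drop⁻ : ∀ m {n} {j : Fin n} (e : Subset (m + n)) → j ∈ₛ Vec.drop m e → m Fin.↑ʳ j ∈ₛ e
∈-drop⁻ zero    e       j∈ = j∈
∈-drop⁻ (suc m) (x ∷ e) j∈ = Vec.there (∈-drop⁻ m e j∈)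

card-take-drop : ∀ m {n} (e : Subset (m + n)) → ∣ e ∣ ≡ ∣ Vec.take m e ∣ + ∣ Vec.drop m e ∣
card-take-drop zero    e           = refl
card-take-drop (suc m) (true ∷ e)  = cong suc (card-take-drop m e)
card-take-drop (suc m) (false ∷ e) = card-take-drop m e

empty⇒card : (p : Subset n) → ¬ Subset.Nonempty p → ∣ p ∣ ≡ 0
empty⇒card []          _ = refl
empty⇒card (true ∷ p)  ¬ne = ⊥-elim (¬ne (0F , Vec.here))
empty⇒card (false ∷ p) ¬ne = empty⇒card p (λ { (i , i∈) → ¬ne (Fin.suc i , Vec.there i∈) })

↑ˡ≢↑ʳ : ∀ {m n} (i : Fin m) (j : Fin n) → i Fin.↑ˡ n ≢ m Fin.↑ʳ j
↑ˡ≢↑ʳ (Fin.suc i) j eq = ↑ˡ≢↑ʳ i j (Fin-suc-injective eq)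

module K₆⊔ {m : ℕ} (G : ThreeGraph m) where

  private
    Q? : ∀ e → Dec ((T (edge (K 6) (Vec.take 6 e)) × ¬ Subset.Nonempty (Vec.drop 6 e))
                    ⊎ (¬ Subset.Nonempty (Vec.take 6 e) × T (edge G (Vec.drop 6 e))))
    Q? e = (T? (edge (K 6) (Vec.take 6 e)) ×-dec ¬? (nonempty? (Vec.drop 6 e)))
           ⊎-dec (¬? (nonempty? (Vec.take 6 e)) ×-dec T? (edge G (Vec.drop 6 e)))

  union : Hyp (Fin (6 + m))
  union = hyp (K 6 ⊔ G)

  left-edge : ∀ (i j k : Fin 6) → i ≢ j → i ≢ k → j ≢ k → Ed union (i Fin.↑ˡ m) (j Fin.↑ˡ m) (k Fin.↑ˡ m)
  left-edge i j k i≢j i≢k j≢k = triples⇐ Q? e card (inj₁ (triples⇐ U? (Vec.take 6 e) card′ tt , ¬right))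
    where
    e : Subset (6 + m)
    e = triple (i Fin.↑ˡ m) (j Fin.↑ˡ m) (k Fin.↑ˡ m)

    card : ∣ e ∣ ≡ 3
    card = card-triple (i≢j ∘ ↑ˡ-injective m i j) (i≢k ∘ ↑ˡ-injective m i k) (j≢k ∘ ↑ˡ-injective m j k)

    ¬right : ¬ Subset.Nonempty (Vec.drop 6 e)
    ¬right (v , v∈) with triple∈⁻ (∈-drop⁻ 6 e v∈)
    ... | here eq                 = ↑ˡ≢↑ʳ i v (sym eq)
    ... | there (here eq)         = ↑ˡ≢↑ʳ j v (sym eq)
    ... | there (there (here eq)) = ↑ˡ≢↑ʳ k v (sym eq)

    card′ : ∣ Vec.take 6 e ∣ ≡ 3
    card′ = trans (sym (trans (card-take-drop 6 e)
      (trans (cong (∣ Vec.take 6 e ∣ +_) (empty⇒card (Vec.drop 6 e) ¬right)) (+-identityʳ _)))) card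

  right-edge : ∀ i j k → Ed (hyp G) i j k → Ed union (6 Fin.↑ʳ i) (6 Fin.↑ʳ j) (6 Fin.↑ʳ k)
  right-edge i j k t = triples⇐ Q? (triple (6 Fin.↑ʳ i) (6 Fin.↑ʳ j) (6 Fin.↑ʳ k)) (uniform G _ t)
    (inj₂ ((λ { (0F , ()) ; (1F , Vec.there ()) ; (2F , Vec.there (Vec.there ())) ; (3F , Vec.there (Vec.there (Vec.there ())))
              ; (4F , Vec.there (Vec.there (Vec.there (Vec.there ()))))
              ; (5F , Vec.there (Vec.there (Vec.there (Vec.there (Vec.there ()))))) }) , t))

  data View : Fin (6 + m) → Set where
    left  : ∀ i → View (i Fin.↑ˡ m)
    right : ∀ j → View (6 Fin.↑ʳ j)

  view : ∀ v → View v
  view 0F = left 0F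
  view 1F = left 1F
  view 2F = left 2F
  view 3F = left 3F
  view 4F = left 4F
  view 5F = left 5F
  view (Fin.suc (Fin.suc (Fin.suc (Fin.suc (Fin.suc (Fin.suc j)))))) = right j

  ↑ˡ∈ : ∀ i → i Fin.↑ˡ m ∈ 0F ∷ 1F ∷ 2F ∷ 3F ∷ 4F ∷ 5F ∷ []
  ↑ˡ∈ i = ∈-map⁺ (Fin._↑ˡ m) (∈-allFin i)

  union-split : Split union
  union-split = record { unique = Uniq.map⁺ (↑ˡ-injective m _ _) (Uniq.allFin⁺ 6) ; closed = closed }
    where
    closed : ∀ {x y z} → x ∈ 0F ∷ 1F ∷ 2F ∷ 3F ∷ 4F ∷ 5F ∷ [] → Ed union x y z → y ∈ 0F ∷ 1F ∷ 2F ∷ 3F ∷ 4F ∷ 5F ∷ []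
    closed {x} {y} {z} x∈ e with ∈-map⁻ (Fin._↑ˡ m) {xs = allFin 6} x∈ | view y | triples⇒ Q? (triple x y z) e
    ... | _ | left j | _ = ↑ˡ∈ j
    ... | _ | right j | inj₁ (_ , ¬right) = ⊥-elim (¬right (j , ∈-drop⁺ 6 (triple x y z) (triple∈⁺ (there (here refl)))))
    ... | i , _ , refl | _ | inj₂ (¬left , _) = ⊥-elim (¬left (i , ∈-take⁺ 6 (triple x y z) (triple∈⁺ (here refl))))

-- Closedness is asked only within the listed vertices, so that the lemma can be applied once more
-- to the seven vertices left after splitting off the first clique for n = 13.
split-embed : (H : Hyp A) {u₁ u₂ u₃ u₄ u₅ u₆ : A} {ys : List A} → let U = u₁ ∷ u₂ ∷ u₃ ∷ u₄ ∷ u₅ ∷ u₆ ∷ [] in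
  Unique (U ++ ys) → (∀ {x y z} → x ∈ U → y ∈ U ++ ys → z ∈ U ++ ys → Ed H x y z → y ∈ U) →
  (G : ThreeGraph (length ys)) → (∀ i j k → Ed H (lookup ys i) (lookup ys j) (lookup ys k) → Ed (hyp G) i j k) →
  ∀ i j k → Ed H (lookup (U ++ ys) i) (lookup (U ++ ys) j) (lookup (U ++ ys) k) → Ed (hyp (K 6 ⊔ G)) i j k
split-embed {A} H {u₁} {u₂} {u₃} {u₄} {u₅} {u₆} {ys} uniq closed G sub i j k e = go (view i) (view j) (view k) e
  where
  open K₆⊔ G

  U : List A
  U = u₁ ∷ u₂ ∷ u₃ ∷ u₄ ∷ u₅ ∷ u₆ ∷ []

  at : Fin (6 + length ys) → A
  at = lookup (U ++ ys)

  closed₁₃ : ∀ {x y z} → x ∈ U → y ∈ U ++ ys → z ∈ U ++ ys → Ed H x y z → z ∈ U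
  closed₁₃ x∈ y∈ z∈ f = closed x∈ z∈ y∈ (sw₂₃ H _ _ _ f)

  at-left : ∀ (i : Fin 6) → at (i Fin.↑ˡ length ys) ∈ U
  at-left 0F = here refl
  at-left 1F = there (here refl)
  at-left 2F = there (there (here refl))
  at-left 3F = there (there (there (here refl)))
  at-left 4F = there (there (there (there (here refl))))
  at-left 5F = there (there (there (there (there (here refl)))))

  at∈ : ∀ i → at i ∈ U ++ ys
  at∈ i = ∈-lookup i

  outside : ∀ j → ¬ lookup ys j ∈ U
  outside j j∈ = ++-disjoint U uniq j∈ (∈-lookup j)

  go : ∀ {i j k} → View i → View j → View k → Ed H (at i) (at j) (at k) → Ed (hyp (K 6 ⊔ G)) i j k
  go (left i)  (left j)  (left k)  f = left-edge i j k
    (distinct₁₂ H f ∘ cong (λ i → at (i Fin.↑ˡ length ys))) (distinct₁₃ H f ∘ cong (λ i → at (i Fin.↑ˡ length ys)))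
    (distinct₂₃ H f ∘ cong (λ i → at (i Fin.↑ˡ length ys)))
  go (right i) (right j) (right k) f = right-edge i j k (sub i j k f)
  go {i} {j} {k} (left i′)  (right j′) _          f = ⊥-elim (outside j′ (closed (at-left i′) (at∈ j) (at∈ k) f))
  go {i} {j} {k} (left i′)  _          (right k′) f = ⊥-elim (outside k′ (closed₁₃ (at-left i′) (at∈ j) (at∈ k) f))
  go {i} {j} {k} (right i′) (left j′)  _          f = ⊥-elim (outside i′ (closed (at-left j′) (at∈ i) (at∈ k) (sw₁₂ H _ _ _ f)))
  go {i} {j} {k} (right i′) _          (left k′)  f = ⊥-elim (outside i′ (closed (at-left k′) (at∈ i) (at∈ j) (rot H _ _ _ (rot H _ _ _ f))))

-- Second order

𝓟 : Family
𝓟 = ｛ 7 , P ｝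

-- A maximizer is at least as large as the witness `W`, hence reaches `k`, where `bound` identifies
-- it.
characterise : ∀ {n k} (Target : ThreeGraph n → Set) →
  (∀ H → Target H → Admissible 𝓟 1 H × size H ≡ k) →
  (∀ H → Admissible 𝓟 1 H → size H ≤ k × (k ≤ size H → Target H)) →
  ∃ Target → IsEx 2 n 𝓟 k × (∀ H → Ex 2 n 𝓟 H ⇔ Target H)
characterise {n} {k} Target sound bound (W , w) = maximum , λ H → mk⇔
  (λ { (adm , (_ , max)) → proj₂ (bound H adm) (≤-trans (≤-reflexive (sym (proj₂ (sound W w)))) (max W (proj₁ (sound W w)))) })
  (λ t → proj₁ (sound H t) , subst (IsMaxSize (Admissible 𝓟 1)) (sym (proj₂ (sound H t))) maximum)
  where
  maximum : IsMaxSize (Admissible 𝓟 1) k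
  maximum = (W , sound W w) , λ H adm → proj₁ (bound H adm)

free-bound : (G : ThreeGraph n) → Path-Free G → size G ≤ capᴾ n
free-bound {n} G free = ≤-trans (≤-reflexive (size≡total G)) (bounded n (hyp G) (free⇒pathFree G free))

subgraph⇒⊑ : (H G : ThreeGraph n) → hyp H ⊆ᴱ hyp G → H ⊑ G
subgraph⇒⊑ H G sub = id , id , λ e t → subst (Edge G) (sym (image-id e)) (go e t)
  where
  go : ∀ e → Edge H e → Edge G e
  go e t with card-three e (uniform H e t)
  ... | i , j , k , refl = sub i j k t

⊑-edge : ∀ {m n} {H : ThreeGraph m} {G : ThreeGraph n} (s : H ⊑ G) → ∀ {i j k} → Ed (hyp H) i j k →
         Ed (hyp G) (proj₁ s i) (proj₁ s j) (proj₁ s k)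
⊑-edge {G = G} (f , _ , h) {i} {j} {k} e = subst (Edge G) (image-triple f i j k) (h (triple i j k) e)

≅-sym : ∀ {m n} {H : ThreeGraph m} {G : ThreeGraph n} → H ≅ G → G ≅ H
≅-sym {G = G} (π , h) = flipₚ π , λ e →
  trans (cong (edge G) (sym (image-inverse (π ⟨$⟩ˡ_) (π ⟨$⟩ʳ_) (λ _ → inverseʳ π) e))) (sym (h (image (π ⟨$⟩ˡ_) e)))

-- A certificate against containment in a star: it is preserved by embeddings, and in a star any two
-- edges share the centre.
TwoDisjoint : Hyp A → Set
TwoDisjoint {A} H = ∃[ a ] ∃[ b ] ∃[ c ] ∃[ d ] ∃[ e ] ∃[ f ]
  Unique {A = A} (a ∷ b ∷ c ∷ d ∷ e ∷ f ∷ []) × Ed H a b c × Ed H d e f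

star-¬twoDisjoint : {H : Hyp A} → Star H → ¬ TwoDisjoint H
star-¬twoDisjoint (v , st) (_ , _ , _ , _ , _ , _ , u , p , q) = ++-disjoint (_ ∷ _ ∷ _ ∷ []) u (st p) (st q)

⊑-twoDisjoint : ∀ {m n} {H : ThreeGraph m} {G : ThreeGraph n} → H ⊑ G → TwoDisjoint (hyp H) → TwoDisjoint (hyp G)
⊑-twoDisjoint {H = H} {G} s@(_ , inj , _) (_ , _ , _ , _ , _ , _ , u , p , q) =
  _ , _ , _ , _ , _ , _ , Uniq.map⁺ inj u , ⊑-edge {H = H} {G} s p , ⊑-edge {H = H} {G} s q

≅-twoDisjoint : ∀ {m n} {H : ThreeGraph m} {G : ThreeGraph n} → H ≅ G → TwoDisjoint (hyp G) → TwoDisjoint (hyp H)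
≅-twoDisjoint {H = H} {G} iso (_ , _ , _ , _ , _ , _ , u , p , q) =
  _ , _ , _ , _ , _ , _ , Uniq.map⁺ (iso-injective {H = G} {H} iso′) u ,
  subst T (iso-edge {H = G} {H} iso′ _ _ _) p , subst T (iso-edge {H = G} {H} iso′ _ _ _) q
  where
  iso′ : G ≅ H
  iso′ = ≅-sym {H = H} {G} iso

module _ (m : ℕ) where

  private
    n′ : ℕ
    n′ = 8 + m

    7≤n : 7 ≤ n′
    7≤n = m≤m+n 7 (suc m)

  starAt-free : (v : Fin n′) → Path-Free (starAt v)
  starAt-free v = pathFree⇒free (starAt v) (star-pathFree {H = hyp (starAt v)} (starAt-star v))

  starAt-maximizer : (v : Fin n′) → Maximizer (Admissible 𝓟 0) (starAt v)
  starAt-maximizer v = starAt-free v , (starAt v , starAt-free v , refl) ,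
    λ G free → ≤-trans (free-bound G free) (≤-reflexive (sym (starAt-size v)))

  admissible⇒¬star : (H : ThreeGraph n′) → Admissible 𝓟 1 H → ¬ Star (hyp H)
  admissible⇒¬star H (_ , ¬⊑) (v , st) = ¬⊑ (starAt v) (starAt-maximizer v)
    (subgraph⇒⊑ H (starAt v) (λ i j k e → triples⇐ (v ∈ₛ?_) (triple i j k) (uniform H _ e) (triple∈⁺ (st e))))

  split-size : {H : ThreeGraph n′} → Path-Free H → Split (hyp H) → size H ≤ 20 + capᴾ (2 + m)
  split-size {H} free S = begin
    size H                                    ≡⟨ size≡total H ⟩
    total (hyp H)                             ≡⟨ split-total S ⟩
    cnt (hyp H) (Split.U S) + cnt (hyp H) rest
      ≤⟨ +-mono-≤ (cnt≤ (hyp H) (Split.U S)) (cnt≤capᴾ {H = hyp H} (free⇒pathFree H free) (Unique-++ʳ (Split.U S) unique) (bounded _)) ⟩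
    20 + capᴾ (length rest)                   ≡⟨ cong (λ l → 20 + capᴾ l) (+-cancelˡ-≡ 6 _ _ size-rest) ⟩
    20 + capᴾ (2 + m)                         ∎
    where
    open ≤-Reasoning
    open Completion (completion S)

  -- Admissibility quantifies over all first-order maximizers, so it must be known that for n ≥ 8
  -- none of them is anything but a star. Every other shape has fewer than C(n - 1, 2) edges.
  maximizer⇒star : (G : ThreeGraph n′) → Maximizer (Admissible 𝓟 0) G → Star (hyp G)
  maximizer⇒star G (free , _ , max) = from (shape 7≤n (hyp G) (free⇒pathFree G free))
    where
    large : c2 (7 + m) ≤ size G
    large = ≤-trans (≤-reflexive (sym (starAt-size {n′} 0F))) (max (starAt 0F) (starAt-free 0F))

    total≤ : ∀ {k} → total (hyp G) ≤ k → size G ≤ k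
    total≤ = ≤-trans (≤-reflexive (size≡total G))

    comet< : ∀ m → 5 + c2 (4 + m) ≤ c2 (7 + m)
    comet< m = slack (10 + m * 3) (lemma m (c2 (4 + m)))
      where
      lemma : ∀ m q → 5 + q + (10 + m * 3) ≡ 6 + m + (5 + m + (4 + m + q))
      lemma = solve-∀

    small< : ∀ m → suc (capᴾ₂ (8 + m)) ≤ c2 (7 + m)
    small< 0 = at-most
    small< 1 = at-most
    small< 2 = at-most
    small< 3 = at-most
    small< 4 = at-most
    small< (suc (suc (suc (suc (suc k))))) = slack (26 + k * 3) (lemma k (c2 (9 + k)))
      where
      lemma : ∀ k q → suc (q + 3) + (26 + k * 3) ≡ 11 + k + (10 + k + (9 + k + q))
      lemma = solve-∀

    split< : ∀ m → 21 + capᴾ (2 + m) ≤ c2 (7 + m)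
    split< 0 = at-most
    split< 1 = at-most
    split< 2 = at-most
    split< 3 = at-most
    split< 4 = at-most
    split< 5 = at-most
    split< (suc (suc (suc (suc (suc (suc k)))))) = slack (36 + k * 6) (lemma k (c2 (7 + k)))
      where
      lemma : ∀ k q → 21 + q + (36 + k * 6) ≡ 12 + k + (11 + k + (10 + k + (9 + k + (8 + k + (7 + k + q)))))
      lemma = solve-∀

    from : Shapeᴾ (hyp G) → Star (hyp G)
    from (star st) = st
    from (comet K) = ⊥-elim (<-irrefl refl (≤-trans (s≤s (total≤ (comet-bound (hyp G) K))) (≤-trans (comet< m) large)))
    from (small h) = ⊥-elim (<-irrefl refl (≤-trans (s≤s (total≤ h)) (≤-trans (small< m) large)))
    from (split S) = ⊥-elim (<-irrefl refl (≤-trans (s≤s (split-size {G} free S)) (≤-trans (split< m) large)))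

  twoDisjoint⇒admissible : (H : ThreeGraph n′) → PathFree (hyp H) → TwoDisjoint (hyp H) → Admissible 𝓟 1 H
  twoDisjoint⇒admissible H pf two = pathFree⇒free H pf ,
    λ G max H⊑G → star-¬twoDisjoint {H = hyp G} (maximizer⇒star G max) (⊑-twoDisjoint {H = H} {G} H⊑G two)

  ≅⇒admissible : ∀ {l} (H : ThreeGraph n′) (G : ThreeGraph l) → H ≅ G → PathFree (hyp G) → TwoDisjoint (hyp G) → Admissible 𝓟 1 H
  ≅⇒admissible H G iso pf two = twoDisjoint⇒admissible H (iso-pathFree {H = H} {G} iso pf) (≅-twoDisjoint {H = H} {G} iso two)

union-twoDisjoint : ∀ {l} (G : ThreeGraph l) → TwoDisjoint (hyp (K 6 ⊔ G))
union-twoDisjoint {l} G = 0F , 1F , 2F , 3F , 4F , 5F , Uniq.map⁺ (↑ˡ-injective l _ _) (Uniq.allFin⁺ 6) ,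
  left-edge 0F 1F 2F (λ ()) (λ ()) (λ ()) , left-edge 3F 4F 5F (λ ()) (λ ()) (λ ())
  where open K₆⊔ G

co-twoDisjoint : ∀ k → TwoDisjoint (hyp (Co (6 + k)))
co-twoDisjoint k = 1F , 2F , 3F , 0F , 4F , 5F ,
  ((λ ()) ∷ (λ ()) ∷ (λ ()) ∷ (λ ()) ∷ (λ ()) ∷ []) ∷ ((λ ()) ∷ (λ ()) ∷ (λ ()) ∷ (λ ()) ∷ []) ∷
  ((λ ()) ∷ (λ ()) ∷ (λ ()) ∷ []) ∷ ((λ ()) ∷ (λ ()) ∷ []) ∷ ((λ ()) ∷ []) ∷ [] ∷ [] ,
  head-edge {1F} {2F} {3F} (λ ()) (λ ()) (λ ()) (there (here refl)) (there (there (here refl))) (there (there (there (here refl)))) ,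
  tail-edge {0F} {4F} {5F} (λ ()) (λ ()) (λ ()) (here refl)
    (λ { (here ()) ; (there (here ())) ; (there (there (here ()))) })
    (λ { (here ()) ; (there (here ())) ; (there (there (here ()))) })
    (λ { (here ()) ; (there (here ())) ; (there (there (here ()))) })
  where open Comet (2 + k)

-- The four ranges of n

split⇒iso : ∀ {n l} (H : ThreeGraph n) → Split (hyp H) → 6 + l ≡ n → size (K 6 ⊔ K l) ≤ size H → H ≅ K 6 ⊔ K l
split⇒iso {n} {l} H S eq le = subst (λ l → H ≅ K 6 ⊔ K l) len
  (embed⇒iso H perm (K 6 ⊔ K (length rest))
    (split-embed (hyp H) unique (λ x∈ _ _ → closed x∈) (K (length rest)) clique)
    (subst (λ l → size (K 6 ⊔ K l) ≤ size H) (sym len) le))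
  where
  open Split S using (closed)
  open Completion (completion S)

  len : length rest ≡ l
  len = +-cancelˡ-≡ 6 _ _ (trans size-rest (sym eq))

  clique : ∀ i j k → Ed (hyp H) (lookup rest i) (lookup rest j) (lookup rest k) → Ed (hyp (K (length rest))) i j k
  clique i j k e = triples⇐ U? (triple i j k) (card-triple (distinct₁₂ (hyp H) e ∘ cong (lookup rest))
    (distinct₁₃ (hyp H) e ∘ cong (lookup rest)) (distinct₂₃ (hyp H) e ∘ cong (lookup rest))) tt

-- The numerical hypotheses become closed for each of the five values of `m` and then hold by
-- evaluation, including the count of all edges in `order`.
cliques : ∀ m → 8 + m ≤ 12 → size (K 6 ⊔ K (2 + m)) ≡ 20 + ((2 + m) C 3) →
  4 + c2 (4 + m) < 20 + ((2 + m) C 3) → capᴾ₂ (8 + m) < 20 + ((2 + m) C 3) → 20 + capᴾ (2 + m) ≤ 20 + ((2 + m) C 3) →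
  IsEx 2 (8 + m) 𝓟 (20 + ((2 + m) C 3)) × (∀ H → Ex 2 (8 + m) 𝓟 H ⇔ (H ≅ K 6 ⊔ K (2 + m)))
cliques m n≤12 order comet< small< split≤ = characterise (_≅ G)
  (λ H iso → ≅⇒admissible m H G iso (split-pathFree {H = hyp G} (K₆⊔.union-split (K (2 + m))) n≤12) (union-twoDisjoint (K (2 + m)))
           , trans (iso-size {H = H} {G} iso) order)
  (λ H adm → from H adm (shape (m≤m+n 7 (suc m)) (hyp H) (free⇒pathFree H (proj₁ adm))))
  (G , ≅-refl G)
  where
  G : ThreeGraph (8 + m)
  G = K 6 ⊔ K (2 + m)

  k : ℕ
  k = 20 + ((2 + m) C 3)

  less : ∀ (H : ThreeGraph (8 + m)) {l} → total (hyp H) ≤ l → l < k → size H ≤ k × (k ≤ size H → H ≅ G)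
  less H h l<k = <⇒≤ lt , λ ge → ⊥-elim (<-irrefl refl (≤-trans lt ge))
    where
    lt : size H < k
    lt = ≤-trans (s≤s (≤-trans (≤-reflexive (size≡total H)) h)) l<k

  from : ∀ H → Admissible 𝓟 1 H → Shapeᴾ (hyp H) → size H ≤ k × (k ≤ size H → H ≅ G)
  from H adm (star st) = ⊥-elim (admissible⇒¬star m H adm st)
  from H adm (comet K) = less H (comet-bound (hyp H) K) comet<
  from H adm (small h) = less H h small<
  from H adm (split S) = ≤-trans (split-size m {H} (proj₁ adm) S) split≤ ,
    λ ge → split⇒iso H S refl (≤-trans (≤-reflexive order) ge)

two-cliques : ThreeGraph 13
two-cliques = K 6 ⊔ K 6 ⊔ K 1

-- By `split-outside` a path avoids the first clique. As 6 + 7 = 13 it would use every other vertex,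
-- the isolated one included.
two-cliques-pathFree : PathFree (hyp two-cliques)
two-cliques-pathFree {a} {b} {c} {d} {e} {f} {g} u p q r = go
  (∈-++⁻ (0F ∷ 1F ∷ 2F ∷ 3F ∷ 4F ∷ 5F ∷ [])
    (∈-resp-↭ (↭-sym (enumeration′ (split-outside {H = H} (K₆⊔.union-split (K 6 ⊔ K 1)) u p q r) refl)) (∈-allFin last)))
  where
  H : Hyp (Fin 13)
  H = hyp two-cliques

  last : Fin 13
  last = # 12

  lonely : ∀ j k → ¬ Ed H last j k
  lonely = toWitness {a? = all? λ j → all? λ k → ¬? (T? (E H last j k))} tt

  clear : ∀ x y z → Ed H x y z → last ∉ x ∷ y ∷ z ∷ []
  clear x y z e (here refl)                 = lonely y z e
  clear x y z e (there (here refl))         = lonely x z (sw₁₂ H x y z e)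
  clear x y z e (there (there (here refl))) = lonely x y (rot H y z x (rot H x y z e))

  go : last ∈ 0F ∷ 1F ∷ 2F ∷ 3F ∷ 4F ∷ 5F ∷ [] ⊎ last ∈ a ∷ b ∷ c ∷ d ∷ e ∷ f ∷ g ∷ [] → ⊥
  go (inj₁ (there (there (there (there (there (there ())))))))
  go (inj₂ (here eq))                                               = clear a b c p (here eq)
  go (inj₂ (there (here eq)))                                       = clear a b c p (there (here eq))
  go (inj₂ (there (there (here eq))))                               = clear a b c p (there (there (here eq)))
  go (inj₂ (there (there (there (here eq)))))                       = clear c d e q (there (here eq))
  go (inj₂ (there (there (there (there (here eq))))))               = clear e f g r (here eq)
  go (inj₂ (there (there (there (there (there (here eq)))))))       = clear e f g r (there (here eq))
  go (inj₂ (there (there (there (there (there (there (here eq)))))))) = clear e f g r (there (there (here eq)))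

-- At most 20 edges lie in `U`, so at least 20 lie on the other seven vertices. There the remaining
-- shapes have at most 15 edges, hence a second set of six splits off.
split⇒two-cliques : (H : ThreeGraph 13) → PathFree (hyp H) → Split (hyp H) → 40 ≤ size H → H ≅ two-cliques
split⇒two-cliques H pf S 40≤ = from (shape (≤-reflexive (sym len)) R (induced-pathFree {H = hyp H} u pf))
  where
  open Split S using (U; closed)
  open Completion (completion S)

  len : length rest ≡ 7
  len = +-cancelˡ-≡ 6 _ _ size-rest

  u : Unique rest
  u = Unique-++ʳ U unique

  R : Hyp (Fin (length rest))
  R = induced (hyp H) rest

  20≤ : 20 ≤ total R
  20≤ = +-cancelˡ-≤ 20 _ _ (begin
    40                                 ≤⟨ 40≤ ⟩
    size H                             ≡⟨ size≡total H ⟩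
    total (hyp H)                      ≡⟨ split-total S ⟩
    cnt (hyp H) U + cnt (hyp H) rest   ≤⟨ +-mono-≤ (cnt≤ (hyp H) U) (≤-reflexive (sym (total-induced (hyp H) rest))) ⟩
    20 + total R                       ∎)
    where open ≤-Reasoning

  impossible : ∀ {k} → total R ≤ k → {T (k <ᵇ 20)} → H ≅ two-cliques
  impossible {k} h {t} = ⊥-elim (<-irrefl refl (≤-trans (<ᵇ⇒< k 20 t) (≤-trans 20≤ h)))

  from : Shapeᴾ R → H ≅ two-cliques
  from (star st) = impossible (subst (λ l → total R ≤ c2 (l ∸ 1)) len (star-bound R st))
  from (comet K) = impossible (subst (λ l → total R ≤ 4 + c2 (l ∸ 4)) len (comet-bound R K))
  from (small h) = impossible (subst (λ l → total R ≤ capᴾ₂ l) len h)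
  from (split S′) = last (complement U′ u′ U′⊆)
    where
    φ : Fin (length rest) → Fin 13
    φ = lookup rest

    U′ : List (Fin 13)
    U′ = map φ (Split.U S′)

    u′ : Unique U′
    u′ = Uniq.map⁺ (lookup-injective u) (Split.unique S′)

    U′⊆ : ∀ {x} → x ∈ U′ → x ∈ rest
    U′⊆ x∈ with ∈-map⁻ φ x∈
    ... | i , _ , refl = ∈-lookup i

    closed′ : ∀ {x y z} → x ∈ U′ → y ∈ rest → z ∈ rest → Ed (hyp H) x y z → y ∈ U′
    closed′ {x} {y} {z} x∈ y∈ z∈ e with ∈-map⁻ φ x∈
    ... | i , i∈ , refl = subst (_∈ U′) (sym (lookup-index y∈)) (∈-map⁺ φ (Split.closed S′ i∈
      (subst₂ (λ y z → Ed (hyp H) (φ i) y z) (lookup-index y∈) (lookup-index z∈) e)))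

    last : (∃[ zs ] U′ ++ zs ↭ rest) → H ≅ two-cliques
    last ([] , p) = case trans (↭-length p) len of λ ()
    last (_ ∷ _ ∷ _ , p) = case trans (↭-length p) len of λ ()
    last (v ∷ [] , p) = embed⇒iso H (↭-trans (++⁺ˡ U p) perm) two-cliques
      (split-embed (hyp H) (Unique-↭ (++⁺ˡ U (↭-sym p)) unique) (λ x∈ _ _ → closed x∈) (K 6 ⊔ K 1)
        (split-embed (hyp H) (Unique-↭ (↭-sym p) u) (λ x∈ y∈ z∈ → closed′ x∈ (∈-resp-↭ p y∈) (∈-resp-↭ p z∈)) (K 1)
          λ { 0F 0F _ e → ⊥-elim (distinct₁₂ (hyp H) e refl) }))
      40≤

-- The two families cross here: 20 + 20 = 40 = 4 + C(9, 2).
thirteen : IsEx 2 13 𝓟 40 × (∀ H → Ex 2 13 𝓟 H ⇔ ((H ≅ two-cliques) ⊎ (H ≅ Co 13)))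
thirteen = characterise (λ H → (H ≅ two-cliques) ⊎ (H ≅ Co 13)) sound
  (λ H adm → from H adm (shape at-most (hyp H) (free⇒pathFree H (proj₁ adm)))) (two-cliques , inj₁ (≅-refl two-cliques))
  where
  sound : ∀ H → (H ≅ two-cliques) ⊎ (H ≅ Co 13) → Admissible 𝓟 1 H × size H ≡ 40
  sound H (inj₁ iso) = ≅⇒admissible 5 H two-cliques iso two-cliques-pathFree (union-twoDisjoint (K 6 ⊔ K 1))
                     -- The size of `two-cliques` evaluates to 40.
                     , iso-size {H = H} {two-cliques} iso
  sound H (inj₂ iso) = ≅⇒admissible 5 H (Co 13) iso (comet-pathFree {H = hyp (Co 13)} (Comet.subComet 9)) (co-twoDisjoint 7)
                     , trans (iso-size {H = H} {Co 13} iso) (Comet.co-size 9)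

  from : ∀ H → Admissible 𝓟 1 H → Shapeᴾ (hyp H) → size H ≤ 40 × (40 ≤ size H → (H ≅ two-cliques) ⊎ (H ≅ Co 13))
  from H adm (star st) = ⊥-elim (admissible⇒¬star 5 H adm st)
  from H adm (comet K) = ≤-trans (≤-reflexive (size≡total H)) (comet-bound (hyp H) K)
                       , λ ge → inj₂ (comet⇒iso H K (≤-trans (≤-reflexive (Comet.co-size 9)) ge))
  from H adm (small h) = ≤-trans lt (n≤1+n 39) , λ ge → ⊥-elim (<-irrefl refl (≤-trans ge lt))
    where
    lt : size H ≤ 39
    lt = ≤-trans (≤-reflexive (size≡total H)) h
  from H adm (split S) = split-size 5 {H} (proj₁ adm) S
                       , λ ge → inj₁ (split⇒two-cliques H (free⇒pathFree H (proj₁ adm)) S ge)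

c2≡C : ∀ n → c2 n ≡ n C 2
c2≡C zero    = refl
c2≡C (suc n) = trans (cong₂ _+_ (sym (nC1≡n n)) (c2≡C n)) (nCk+nC[k+1]≡[n+1]C[k+1] n 1)

comets : ∀ m → IsEx 2 (14 + m) 𝓟 (4 + c2 (10 + m)) × (∀ H → Ex 2 (14 + m) 𝓟 H ⇔ (H ≅ Co (14 + m)))
comets m = characterise (_≅ G)
  (λ H iso → ≅⇒admissible (6 + m) H G iso (comet-pathFree {H = hyp G} (Comet.subComet (10 + m))) (co-twoDisjoint (8 + m))
           , trans (iso-size {H = H} {G} iso) order)
  (λ H adm → from H adm (shape (m≤m+n 7 (7 + m)) (hyp H) (free⇒pathFree H (proj₁ adm))))
  (G , ≅-refl G)
  where
  G : ThreeGraph (14 + m)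
  G = Co (14 + m)

  k : ℕ
  k = 4 + c2 (10 + m)

  order : size G ≡ k
  order = Comet.co-size (10 + m)

  less : ∀ (H : ThreeGraph (14 + m)) → size H < k → size H ≤ k × (k ≤ size H → H ≅ G)
  less H lt = <⇒≤ lt , λ ge → ⊥-elim (<-irrefl refl (≤-trans lt ge))

  split< : ∀ m → 21 + capᴾ (8 + m) ≤ 4 + c2 (10 + m)
  split< m = slack (7 + m * 3) (lemma m (c2 (7 + m)))
    where
    lemma : ∀ m q → 21 + q + (7 + m * 3) ≡ 4 + (9 + m + (8 + m + (7 + m + q)))
    lemma = solve-∀

  from : ∀ H → Admissible 𝓟 1 H → Shapeᴾ (hyp H) → size H ≤ k × (k ≤ size H → H ≅ G)
  from H adm (star st) = ⊥-elim (admissible⇒¬star (6 + m) H adm st)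
  from H adm (comet K) = ≤-trans (≤-reflexive (size≡total H)) (comet-bound (hyp H) K)
                       , λ ge → comet⇒iso H K (≤-trans (≤-reflexive order) ge)
  from H adm (small h) = less H (s≤s (≤-trans (≤-reflexive (size≡total H)) (≤-trans h (≤-reflexive (+-comm (c2 (10 + m)) 3)))))
  from H adm (split S) = less H (≤-trans (s≤s (split-size (6 + m) {H} (proj₁ adm) S)) (split< m))

isolatedAt-free : (v : Fin 7) → Path-Free (isolatedAt v)
isolatedAt-free v = pathFree⇒free (isolatedAt v) (isolated-pathFree {H = hyp (isolatedAt v)} v
  (λ {x} {y} {z} e v∈ → triples⇒ (λ e → ¬? (v ∈ₛ? e)) (triple x y z) e (triple∈⁺ v∈)))

isolatedAt-maximizer : (v : Fin 7) → Maximizer (Admissible 𝓟 0) (isolatedAt v)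
isolatedAt-maximizer v = isolatedAt-free v , (isolatedAt v , isolatedAt-free v , refl) ,
  λ G free → ≤-trans (free-bound G free) (isolatedAt-size v)

split⇒isolated : {H : Hyp (Fin 7)} → Split H → ∃[ v ] (∀ {x y z} → Ed H x y z → v ∉ x ∷ y ∷ z ∷ [])
split⇒isolated {H} S = go rest refl
  where
  open Split S using (U; closed)
  open Completion (completion S)

  go : ∀ ys → rest ≡ ys → ∃[ v ] (∀ {x y z} → Ed H x y z → v ∉ x ∷ y ∷ z ∷ [])
  go [] eq = case trans (sym size-rest) (cong (λ ys → 6 + length ys) eq) of λ ()
  go (_ ∷ _ ∷ _) eq = case trans (sym size-rest) (cong (λ ys → 6 + length ys) eq) of λ ()
  go (v ∷ []) eq = v , λ e → λ
    { (here refl)                 → v∉ (in-U e)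
    ; (there (here refl))         → v∉ (in-U (sw₁₂ H _ _ _ e))
    ; (there (there (here refl))) → v∉ (in-U (rot H _ _ _ (rot H _ _ _ e))) }
    where
    v∉ : v ∉ U
    v∉ v∈ = ++-disjoint U unique v∈ (subst (v ∈_) (sym eq) (here refl))

    side : ∀ x → x ∈ U ⊎ x ≡ v
    side x with ∈-++⁻ U (mem x)
    ... | inj₁ x∈ = inj₁ x∈
    ... | inj₂ x∈ with subst (x ∈_) eq x∈
    ...   | here x≡v = inj₂ x≡v

    in-U : ∀ {x y z} → Ed H x y z → x ∈ U
    in-U {x} {y} e with side x | side y
    ... | inj₁ x∈   | _         = x∈
    ... | inj₂ _    | inj₁ y∈   = closed y∈ (sw₁₂ H _ _ _ e)
    ... | inj₂ refl | inj₂ refl = ⊥-elim (distinct₁₂ H e refl)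

star⇒iso : (H : ThreeGraph 7) → Star (hyp H) → 15 ≤ size H → H ≅ S 7
star⇒iso H (c , st) 15≤ = subst (λ k → H ≅ S (suc k)) len (embed⇒iso H perm (S (suc (length rest))) sub
  (subst (λ k → size (S (suc k)) ≤ size H) (sym len) 15≤))
  where
  open Completion (complete {xs = c ∷ []} ([] ∷ []))

  len : length rest ≡ 6
  len = suc-injective size-rest

  L : List (Fin 7)
  L = c ∷ rest

  inj : ∀ {i j} → lookup L i ≡ lookup L j → i ≡ j
  inj = lookup-injective unique

  sub : ∀ i j k → Ed (hyp H) (lookup L i) (lookup L j) (lookup L k) → Ed (hyp (S (suc (length rest)))) i j k
  sub i j k e = triples⇐ (0F ∈ₛ?_) (triple i j k) (card-triple {i = i} {j} {k} (distinct₁₂ (hyp H) e ∘ cong (lookup L))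
    (distinct₁₃ (hyp H) e ∘ cong (lookup L)) (distinct₂₃ (hyp H) e ∘ cong (lookup L))) (triple∈⁺ (centre (st e)))
    where
    centre : c ∈ lookup L i ∷ lookup L j ∷ lookup L k ∷ [] → 0F ∈ i ∷ j ∷ k ∷ []
    centre (here eq)                 = here (inj eq)
    centre (there (here eq))         = there (here (inj eq))
    centre (there (there (here eq))) = there (there (here (inj eq)))

injective⇒onto : {f : Fin n → Fin n} → Injective _≡_ _≡_ f → ∀ v → ∃[ i ] v ≡ f i
injective⇒onto {n} {f} inj v with ∈-map⁻ f (∈-resp-↭ (↭-sym (enumeration′ (Uniq.map⁺ inj (Uniq.allFin⁺ n)) len)) (∈-allFin v))
  where
  len : length (map f (allFin n)) ≡ n
  len = trans (length-map f (allFin n)) (length-tabulate id)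
... | i , _ , eq = i , eq

S₇-covered : ∀ i → ∃[ j ] ∃[ k ] Ed (hyp (S 7)) i j k
S₇-covered 0F = 1F , 2F , tt
S₇-covered 1F = 0F , 2F , tt
S₇-covered 2F = 0F , 1F , tt
S₇-covered 3F = 0F , 1F , tt
S₇-covered 4F = 0F , 1F , tt
S₇-covered 5F = 0F , 1F , tt
S₇-covered 6F = 0F , 1F , tt

seven-vertices : IsEx 2 7 𝓟 15 × (∀ H → Ex 2 7 𝓟 H ⇔ (H ≅ S 7))
seven-vertices = characterise (_≅ S 7)
  (λ H iso → (pathFree⇒free H (iso-pathFree {H = H} {S 7} iso (star-pathFree {H = hyp (S 7)} (starAt-star 0F))) , avoids H iso)
           , iso-size {H = H} {S 7} iso)
  (λ H adm → from H adm (shape at-most (hyp H) (free⇒pathFree H (proj₁ adm))))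
  (S 7 , ≅-refl (S 7))
  where
  less : ∀ (H : ThreeGraph 7) {l} → total (hyp H) ≤ l → {T (l <ᵇ 15)} → size H ≤ 15 × (15 ≤ size H → H ≅ S 7)
  less H {l} h {t} = <⇒≤ lt , λ ge → ⊥-elim (<-irrefl refl (≤-trans lt ge))
    where
    lt : size H < 15
    lt = ≤-trans (s≤s (≤-trans (≤-reflexive (size≡total H)) h)) (<ᵇ⇒< l 15 t)

  from : ∀ H → Admissible 𝓟 1 H → Shapeᴾ (hyp H) → size H ≤ 15 × (15 ≤ size H → H ≅ S 7)
  from H adm (star st) = ≤-trans (≤-reflexive (size≡total H)) (star-bound (hyp H) st) , star⇒iso H st
  from H adm (comet K) = less H (comet-bound (hyp H) K)
  from H adm (small h) = less H h
  from H (_ , ¬⊑) (split Sp) with split⇒isolated Sp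
  ... | v , iso = ⊥-elim (¬⊑ (isolatedAt v) (isolatedAt-maximizer v) (subgraph⇒⊑ H (isolatedAt v) λ i j k e →
    triples⇐ (λ e → ¬? (v ∈ₛ? e)) (triple i j k) (uniform H _ e) (λ v∈ → iso e (triple∈⁻ v∈))))

  -- With at least 20 edges, a first-order maximizer on seven vertices must split and so has an
  -- isolated vertex. An embedding between vertex sets of equal size is onto, but every vertex of
  -- the star lies in an edge.
  avoids : ∀ H → H ≅ S 7 → ∀ G → Maximizer (Admissible 𝓟 0) G → ¬ (H ⊑ G)
  avoids H iso G (free , _ , max) s@(f , inj , _) = go (shape at-most (hyp G) (free⇒pathFree G free))
    where
    20≤ : 20 ≤ total (hyp G)
    20≤ = ≤-trans (isolatedAt-size {7} 0F) (≤-trans (max (isolatedAt 0F) (isolatedAt-free 0F)) (≤-reflexive (size≡total G)))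

    impossible : ∀ {k} → total (hyp G) ≤ k → {T (k <ᵇ 20)} → ⊥
    impossible {k} h {t} = <-irrefl refl (≤-trans (<ᵇ⇒< k 20 t) (≤-trans 20≤ h))

    iso′ : S 7 ≅ H
    iso′ = ≅-sym {H = H} {S 7} iso

    covered : ∀ i → ∃[ j ] ∃[ k ] Ed (hyp H) i j k
    covered i = _ , _ , subst (λ i → Ed (hyp H) i (to j) (to k)) (inverseˡ (proj₁ iso))
      (subst T (iso-edge {H = S 7} {H} iso′ _ j k) (proj₂ (proj₂ (S₇-covered (proj₁ iso ⟨$⟩ʳ i)))))
      where
      to : Fin 7 → Fin 7
      to = proj₁ iso ⟨$⟩ˡ_

      j k : Fin 7
      j = proj₁ (S₇-covered (proj₁ iso ⟨$⟩ʳ i))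
      k = proj₁ (proj₂ (S₇-covered (proj₁ iso ⟨$⟩ʳ i)))

    go : Shapeᴾ (hyp G) → ⊥
    go (star st) = impossible (star-bound (hyp G) st)
    go (comet K) = impossible (comet-bound (hyp G) K)
    go (small h) = impossible h
    go (split Sp) = no-isolated (split⇒isolated Sp)
      where
      no-isolated : ¬ (∃[ v ] (∀ {x y z} → Ed (hyp G) x y z → v ∉ x ∷ y ∷ z ∷ []))
      no-isolated (v , lone) = at-image (injective⇒onto inj v)
        where
        at-image : ¬ (∃[ i ] v ≡ f i)
        at-image (i , v≡fi) = lone (⊑-edge {H = H} {G} s (proj₂ (proj₂ (covered i)))) (here v≡fi)

mainTheorem2 : (IsEx 2 7 ｛ 7 , P ｝ 15
    × (∀ H → Ex 2 7 ｛ 7 , P ｝ H ⇔ (H ≅ S 7)))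
    × (∀ n → 8 ≤ n → n ≤ 12 →
    IsEx 2 n ｛ 7 , P ｝ (20 + ((n ∸ 6) C 3))
    × (∀ H → Ex 2 n ｛ 7 , P ｝ H ⇔ (H ≅ K 6 ⊔ K (n ∸ 6))))
    × (IsEx 2 13 ｛ 7 , P ｝ 40
    × (∀ H → Ex 2 13 ｛ 7 , P ｝ H ⇔ ((H ≅ K 6 ⊔ K 6 ⊔ K 1) ⊎ (H ≅ Co 13))))
    × (∀ n → 14 ≤ n →
    IsEx 2 n ｛ 7 , P ｝ (4 + ((n ∸ 4) C 2))
    × (∀ H → Ex 2 n ｛ 7 , P ｝ H ⇔ (H ≅ Co n)))
mainTheorem2 = seven-vertices , eight-to-twelve , thirteen , fourteen-up
  where
  Clique Fourteen : ℕ → Set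
  Clique n = IsEx 2 n ｛ 7 , P ｝ (20 + ((n ∸ 6) C 3)) × (∀ H → Ex 2 n ｛ 7 , P ｝ H ⇔ (H ≅ K 6 ⊔ K (n ∸ 6)))
  Fourteen n = IsEx 2 n ｛ 7 , P ｝ (4 + ((n ∸ 4) C 2)) × (∀ H → Ex 2 n ｛ 7 , P ｝ H ⇔ (H ≅ Co n))

  eight-to-twelve : ∀ n → 8 ≤ n → n ≤ 12 → Clique n
  eight-to-twelve n 8≤n n≤12 = subst Clique (m+[n∸m]≡n 8≤n) (go (n ∸ 8) (∸-monoˡ-≤ 8 n≤12))
    where
    go : ∀ m → m ≤ 4 → Clique (8 + m)
    go 0 _ = cliques 0 at-most refl at-most at-most at-most
    go 1 _ = cliques 1 at-most refl at-most at-most at-most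
    go 2 _ = cliques 2 at-most refl at-most at-most at-most
    go 3 _ = cliques 3 at-most refl at-most at-most at-most
    go 4 _ = cliques 4 at-most refl at-most at-most at-most
    go (suc (suc (suc (suc (suc m))))) (s≤s (s≤s (s≤s (s≤s ()))))

  fourteen-up : ∀ n → 14 ≤ n → Fourteen n
  fourteen-up n 14≤n = subst Fourteen (m+[n∸m]≡n 14≤n)
    (subst (λ k → IsEx 2 (14 + (n ∸ 14)) ｛ 7 , P ｝ (4 + k) × (∀ H → Ex 2 (14 + (n ∸ 14)) ｛ 7 , P ｝ H ⇔ (H ≅ Co (14 + (n ∸ 14)))))
      (c2≡C (10 + (n ∸ 14))) (comets (n ∸ 14)))
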